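{- Let $d\ge 2$ and $l\ge 0$ be integers and $z_1,\ldots,z_d$ indeterminates. Then \[ \sum_{\mathcal{G}\in \mathrm{DSG}(d),\ |E(\mathcal{G})|=l} w(\mathcal{G})\;=\;\sum_{c\in C(l,d-1)} e_c(z_1,\ldots,z_d)\sum_{G\in \mathrm{VD}(c)}(-1)^{\#\mathrm{inv}(G)}. \]
   Context: $e_k(z_1,\ldots,z_d)$ is the $k$-th elementary symmetric polynomial ($e_0=1$, $e_k=0$ for $k>d$). $C(l,d-1)$ is the set of compositions $c=(c(1),\ldots,c(d-1))$ of $l$ into $d-1$ nonnegative integer parts, and $e_c(z_1,\ldots,z_d)=\prod_{i=1}^{d-1}e_{c(i)}(z_1,\ldots,z_d)$. $\mathrm{DSG}(d)$ is the set of directed graphs $\mathcal{G}$ on vertex set $\{1,\ldots,d\}$ with no parallel edges, no loops and no 2-cycles (so for each pair $i\ne j$ at most one of the edges $(i,j),(j,i)$ is present); $E(\mathcal{G})$ is its edge set, an edge $(i,j)$ goes from $i$ to $j$, and $w(\mathcal{G})=\prod_{(i,j)\in E(\mathcal{G})} z_i$. Points of $\mathbb{Z}^2$: for $1\le i\le d-1$, $\mathrm{source}(i)=(\lceil (i+1)/2\rceil,\,-\lfloor (i-1)/2\rfloor)$, and $\mathrm{sink}(i,r)=(i,\,d-i-r)$; for a point $\mathrm{sink}(i,r)$ its first coordinate is $i$. For $c\in C(l,d-1)$ let $B_{c,d}$ be the set of points $\mathrm{sink}(i,c(i))$, $1\le i\le d-1$. Let $E$ be the set of directed edges $(i,j)\to(i,j+1)$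 and $(i,j)\to(i+1,j+1)$ on $\mathbb{Z}^2$. $\mathrm{VD}(c)$ is the set of directed graphs $G$ consisting of $d-1$ paths $G_1,\ldots,G_{d-1}$ such that $G_l$ begins at $\mathrm{source}(l)$ and either (a) $G_l$ is a directed path all of whose edges lie in $E$ and which ends at a vertex $\mathrm{sink}(G_l)\in B_{c,d}$, or (b) $l=2i$ for some integer $i$ with $c(i)=d$, and $G_l$ consists of a single directed edge from $\mathrm{source}(l)$ to $\mathrm{sink}(G_l)=\mathrm{sink}(i,d)$; and the paths satisfying (a) are pairwise vertex-disjoint. $\#\mathrm{inv}(G)$ is the number of inversions of the sequence of first coordinates of $\mathrm{sink}(G_1),\ldots,\mathrm{sink}(G_{d-1})$. -}

module Defs where

open import Data.Nat as ℕ using (ℕ; zero; suc; _∸_; _≤_; ⌊_/2⌋; ⌈_/2⌉)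
open import Data.Integer as ℤ using (ℤ; +_)
open import Data.Fin using (Fin; toℕ; zero; suc)
open import Data.List using (List; []; _∷_; map; concatMap; filterᵇ; foldr; _++_; allFin; upTo)
open import Data.Nat.ListAction using (sum)
open import Data.Bool using (Bool; true; false; if_then_else_; _∧_; _∨_; not)
open import Data.Product using (_×_; _,_; proj₁; proj₂)
open import Data.Product.Properties using (≡-dec)
open import Relation.Nullary.Decidable using (⌊_⌋)
open import Algebra.Bundles using (CommutativeRing)

bools : List Bool
bools = false ∷ true ∷ []

allFns : {A : Set} → List A → (n : ℕ) → List (Fin n → A)
allFns xs zero = (λ ()) ∷ []
allFns xs (suc n) =
  concatMap (λ x → map (λ f → λ { zero → x ; (suc i) → f i }) (allFns xs n)) xs

depFns : {A : Set} (n : ℕ) → (Fin n → List A) → List (Fin n → A)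
depFns zero ch = (λ ()) ∷ []
depFns (suc n) ch =
  concatMap (λ x → map (λ f → λ { zero → x ; (suc i) → f i })
                        (depFns n (λ i → ch (suc i))))
            (ch zero)

allBoolLists : ℕ → List (List Bool)
allBoolLists zero = [] ∷ []
allBoolLists (suc n) = concatMap (λ b → map (b ∷_) (allBoolLists n)) bools

allF : (n : ℕ) → (Fin n → Bool) → Bool
allF n p = foldr _∧_ true (map p (allFin n))

anyF : (n : ℕ) → (Fin n → Bool) → Bool
anyF n p = foldr _∨_ false (map p (allFin n))

sumF : (n : ℕ) → (Fin n → ℕ) → ℕ
sumF n f = sum (map f (allFin n))

infix 4 _==_ _<ᵇ_

_==_ : ℕ → ℕ → Bool
m == n = ⌊ m ℕ.≟ n ⌋

_<ᵇ_ : ℕ → ℕ → Bool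
m <ᵇ n = ⌊ m ℕ.<? n ⌋

card : (d : ℕ) → (Fin d → Bool) → ℕ
card d S = sumF d (λ i → if S i then 1 else 0)

subsetsOfSize : (d k : ℕ) → List (Fin d → Bool)
subsetsOfSize d k = filterᵇ (λ S → card d S == k) (allFns bools d)

-- C(l,n): compositions of l into n nonnegative parts (each part is ≤ l)
Compositions : (l n : ℕ) → List (Fin n → ℕ)
Compositions l n = filterᵇ (λ c → sumF n c == l) (allFns (upTo (suc l)) n)

-- DSG(d): a directed graph without parallel edges on {1..d} is its
-- edge relation g : Fin d → Fin d → Bool (g i j = true iff (i,j) ∈ E).

Digraph : ℕ → Set
Digraph d = Fin d → Fin d → Bool

isDSG : (d : ℕ) → Digraph d → Bool
isDSG d g = allF d (λ i → not (g i i))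
          ∧ allF d (λ i → allF d (λ j → not (g i j ∧ g j i)))

DSG : (d : ℕ) → List (Digraph d)
DSG d = filterᵇ (isDSG d) (allFns (allFns bools d) d)

edgeCount : (d : ℕ) → Digraph d → ℕ
edgeCount d g = sumF d (λ i → sumF d (λ j → if g i j then 1 else 0))

Point : Set
Point = ℤ × ℤ

_≟P_ : (p q : Point) → Bool
p ≟P q = ⌊ ≡-dec ℤ._≟_ ℤ._≟_ p q ⌋

-- source(i) = (⌈(i+1)/2⌉, -⌊(i-1)/2⌋), for i ≥ 1 (1-based index i)
source : ℕ → Point
source i = (+ ⌈ suc i /2⌉ , ℤ.- (+ ⌊ i ∸ 1 /2⌋))

sink : (d i r : ℕ) → Point
sink d i r = (+ i , (+ d ℤ.- + i) ℤ.- + r)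

-- a path with edges in E is given by its start and its list of steps:
-- false = (x,y) → (x,y+1),  true = (x,y) → (x+1,y+1)
step : Point → Bool → Point
step (x , y) false = (x , y ℤ.+ + 1)
step (x , y) true  = (x ℤ.+ + 1 , y ℤ.+ + 1)

vertices : Point → List Bool → List Point
vertices p [] = p ∷ []
vertices p (b ∷ bs) = p ∷ vertices (step p b) bs

endpoint : Point → List Bool → Point
endpoint p [] = p
endpoint p (b ∷ bs) = endpoint (step p b) bs

-- all E-paths from s to t (every step raises y by 1, so such a path has
-- exactly ∣ y(t) - y(s) ∣ steps; the filter discards everything else)
pathsTo : Point → Point → List (List Bool)
pathsTo s t =
  filterᵇ (λ bs → endpoint s bs ≟P t) (allBoolLists ℤ.∣ proj₂ t ℤ.- proj₂ s ∣)

-- VD(c).  Indices 1..d-1 are represented by k : Fin (d ∸ 1), meaning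
-- the paper's index suc (toℕ k).

data PathChoice : Set where
  along : List Bool → PathChoice   -- case (a): E-path from the source
  jump  : PathChoice               -- case (b): single edge source(2i) → sink(i,d)

idx : {n : ℕ} → Fin n → ℕ
idx k = suc (toℕ k)

Bpt : (d : ℕ) → (Fin (d ∸ 1) → ℕ) → Fin (d ∸ 1) → Point
Bpt d c j = sink d (idx j) (c j)

jumpOK : (d : ℕ) → (Fin (d ∸ 1) → ℕ) → ℕ → Bool
jumpOK d c l = anyF (d ∸ 1) (λ j → (idx j ℕ.* 2 == l) ∧ (c j == d))

choices : (d : ℕ) → (Fin (d ∸ 1) → ℕ) → Fin (d ∸ 1) → List PathChoice
choices d c k =
  map along (concatMap (λ j → pathsTo (source (idx k)) (Bpt d c j)) (allFin (d ∸ 1)))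
  ++ (if jumpOK d c (idx k) then jump ∷ [] else [])

sinkOf : (d : ℕ) → ℕ → PathChoice → Point
sinkOf d l (along bs) = endpoint (source l) bs
sinkOf d l jump = sink d ⌊ l /2⌋ d

disjointPts : List Point → List Point → Bool
disjointPts xs ys = foldr _∧_ true (map (λ p → not (foldr _∨_ false (map (p ≟P_) ys))) xs)

disjointPair : ℕ → ℕ → PathChoice → PathChoice → Bool
disjointPair p q (along bs) (along cs) =
  disjointPts (vertices (source p) bs) (vertices (source q) cs)
disjointPair p q _ _ = true

Family : ℕ → Set
Family d = Fin (d ∸ 1) → PathChoice

pairwiseDisjoint : (d : ℕ) → Family d → Bool
pairwiseDisjoint d G =
  allF (d ∸ 1) (λ p → allF (d ∸ 1) (λ q →
    if toℕ p <ᵇ toℕ q then disjointPair (idx p) (idx q) (G p) (G q) else true))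

VD : (d : ℕ) → (Fin (d ∸ 1) → ℕ) → List (Family d)
VD d c = filterᵇ (pairwiseDisjoint d) (depFns (d ∸ 1) (choices d c))

sinkX : (d : ℕ) → Family d → Fin (d ∸ 1) → ℤ
sinkX d G k = proj₁ (sinkOf d (idx k) (G k))

inv : (d : ℕ) → Family d → ℕ
inv d G = sumF (d ∸ 1) (λ p → sumF (d ∸ 1) (λ q →
  if (toℕ p <ᵇ toℕ q) ∧ ⌊ sinkX d G q ℤ.<? sinkX d G p ⌋ then 1 else 0))

-- Ring-valued parts, over an arbitrary commutative ring R
-- (the identity in ℤ[z₁,…,z_d] is equivalent to its validity for all
-- commutative rings R and all z : Fin d → R).

module InRing {a ℓ} (R : CommutativeRing a ℓ) where
  open CommutativeRing R

  sumL : List Carrier → Carrier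
  sumL = foldr _+_ 0#

  prodF : (n : ℕ) → (Fin n → Carrier) → Carrier
  prodF n f = foldr _*_ 1# (map f (allFin n))

  sign : ℕ → Carrier
  sign zero = 1#
  sign (suc n) = - sign n

  elem : (d : ℕ) → (Fin d → Carrier) → ℕ → Carrier
  elem d z k = sumL (map (λ S → prodF d (λ i → if S i then z i else 1#)) (subsetsOfSize d k))

  elemC : (d : ℕ) → (Fin d → Carrier) → (Fin (d ∸ 1) → ℕ) → Carrier
  elemC d z c = prodF (d ∸ 1) (λ k → elem d z (c k))

  weight : (d : ℕ) → (Fin d → Carrier) → Digraph d → Carrier
  weight d z g = prodF d (λ i → prodF d (λ j → if g i j then z i else 1#))

  LHS : (d l : ℕ) → (Fin d → Carrier) → Carrier
  LHS d l z = sumL (map (weight d z) (filterᵇ (λ g → edgeCount d g == l) (DSG d)))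

  RHS : (d l : ℕ) → (Fin d → Carrier) → Carrier
  RHS d l z = sumL (map (λ c → elemC d z c * sumL (map (λ G → sign (inv d G)) (VD d c)))
                        (Compositions l (d ∸ 1)))

{-# OPTIONS --safe #-}
module Submission where

-- A pair {i, j} carries no edge, i → j or j → i, so the left side is the degree-l part of
-- ∏_{i<j} (1 + zᵢ + zⱼ).  For fixed c the signed families sum to a determinant of path numbers:
-- expanding one path of lowest height at a time by multilinearity in the rows, a collision of two paths
-- shows up as two equal rows.  Multilinearity in the columns then gathers the sum over c into the
-- determinant with entries Σ_r e_r(z) N(source k, sink(j, r)).
--
-- Modulo v² = s − v every polynomial is a(s) + v b(s).  The entries are the coefficients of b for
-- g_k(v) ∏ᵢ(1 + v + zᵢ), with g_1, g_2, g_3, … = 1, v, s, vs, … ; a jump accounts for the one case in which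
-- the path number fails to be such a coefficient.  When a variable w is added, replacing g_{k+1} by
-- (v − w) g_k multiplies all rows but the first by s − w(w + 1), since (v − w)(v + 1 + w) = s − w(w + 1);
-- evaluating at s = w(w + 1) splits off the factor ∏ᵢ(1 + w + zᵢ), exactly as for Orlando's formula.

open import Defs
open import Level using (Level)
open import Data.Bool using (Bool; true; false; if_then_else_; _∧_; _∨_; not)
open import Data.Bool.ListAction using (all; any)
open import Data.Bool.Properties using (T-≡; ∧-comm; ∧-conicalˡ; ∧-conicalʳ)
open import Data.Fin using (Fin; zero; suc; toℕ)
import Data.Fin.Properties as Fin
open import Data.Integer as ℤ using (ℤ; +_; -[1+_])
import Data.Integer.Properties as ℤ
open import Data.Integer.Solver using (module +-*-Solver)
open import Data.List.Base using (List; []; _∷_; map; concatMap; filterᵇ; foldr; _++_; allFin; upTo; tabulate; length)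
open import Data.List.Properties using (map-∘; map-++; map-tabulate; map-upTo; map-concatMap; ++-assoc; length-++; length-map; tabulate-cong)
open import Data.List.Membership.Propositional using (_∈_; _∉_)
open import Data.List.Membership.Propositional.Properties using (∈-∃++; ∈-concatMap⁻; ∈-map⁺; ∈-map⁻; ∈-filter⁻; ∈-++⁺ˡ; ∈-++⁺ʳ; ∈-++⁻; ∈-insert; ∈-allFin; ∈-upTo⁻)
open import Data.List.Relation.Binary.Permutation.Propositional using (_↭_; ↭-refl; ↭-sym; ↭-trans; prep)
open import Data.List.Relation.Binary.Permutation.Propositional.Properties using (drop-mid; ∈-resp-↭; ↭-empty-inv; map⁺) renaming (shift to ↭-shift)
open import Data.List.Relation.Binary.Pointwise using (Pointwise; []; _∷_; Pointwise-length)
open import Data.List.Relation.Unary.All as All using (All; []; _∷_)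
open import Data.List.Relation.Unary.All.Properties using () renaming (++⁻ˡ to All-++⁻ˡ; ++⁻ʳ to All-++⁻ʳ; ++⁺ to All-++⁺)
open import Data.List.Relation.Unary.AllPairs using (AllPairs; []; _∷_)
open import Data.List.Relation.Unary.AllPairs.Properties using (tabulate⁺; tabulate⁺-<)
open import Data.List.Relation.Unary.Any as Any using (Any; here; there; any?)
open import Data.Nat as ℕ using (ℕ; zero; suc; _≤_; _<_; _∸_; z≤n; s≤s; ⌊_/2⌋)
open import Data.Nat.ListAction using (sum)
open import Data.Nat.ListAction.Properties using (sum-↭; sum-++)
import Data.Nat.Properties as ℕ
open import Data.Product using (_×_; _,_; proj₁; proj₂; ∃; ∃-syntax)
open import Data.Product.Properties using (≡-dec)
open import Data.Sum using (_⊎_; inj₁; inj₂)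
import Data.Vec.Functional as Vector
open import Function using (_∘_; id)
open import Function.Bundles using (Equivalence)
open import Relation.Binary.PropositionalEquality as ≡ using (_≡_; _≢_)
import Relation.Binary.Reasoning.Setoid as SetoidReasoning
open import Relation.Nullary using (¬_; Dec; yes; no; contradiction)
open import Relation.Nullary.Decidable using (⌊_⌋; T?; isYes≗does)
import Algebra.Properties.CommutativeSemigroup as CSemi
import Algebra.Properties.Ring as RingProperties
import Algebra.Solver.Ring.NaturalCoefficients.Default as Solver
open import Algebra.Bundles using (CommutativeRing)

-- The relation v² = s - v comes from the path numbers. Put n = d - r. From `source 1` there are C(n
-- - 1 - j, j) paths to `sink d (suc j) r`, which is the coefficient of s^j in the Fibonacci
-- polynomial F_n with F_{n+1} = F_n + s F_{n-1}; its characteristic root is 1 + v with v(1 + v) =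
-- s. Raising the source index by two and the sink index by one is a translation of the plane,
-- whence the powers of s in the later g_k. The condition that the parts of c sum to l couples the
-- columns and so obstructs multilinearity. It is removed by passing to R[τ]/(τ^(l+1)) with τ zᵢ in
-- place of zᵢ and reading off the coefficient of τ^l. In an arbitrary commutative ring neither 2
-- nor s - w(w + 1) can be cancelled. Hence the vanishing for equal rows is proved without the swap
-- rule, and the linear factor is removed by column operations instead of a division.

private variable
  p q r t : Level
  A : Set p
  B : Set q
  C : Set r

-- Finite sums and products

allFin-map-suc : (n : ℕ) (f : Fin (suc n) → A) → map f (allFin (suc n)) ≡ f zero ∷ map (f ∘ suc) (allFin n)
allFin-map-suc n f = ≡.cong (f zero ∷_) (≡.trans (map-tabulate suc f) (≡.sym (map-tabulate id (f ∘ suc))))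

module Sums {a ℓ} (R : CommutativeRing a ℓ) where
  open CommutativeRing R hiding (zero)
  open InRing R using (sumL; prodF; sign)
  open RingProperties ring using (-‿distribˡ-*; -0#≈0#; -‿+-comm)
  open SetoidReasoning setoid
  open CSemi +-commutativeSemigroup using (interchange)
  module Mul = CSemi *-commutativeSemigroup

  Σ[_] : {A : Set p} → List A → (A → Carrier) → Carrier
  Σ[ xs ] f = sumL (map f xs)

  [_]? : Bool → Carrier → Carrier
  [ b ]? x = if b then x else 0#

  []?-cong : ∀ b {x y} → x ≈ y → [ b ]? x ≈ [ b ]? y
  []?-cong true eq = eq
  []?-cong false eq = refl

  []?-* : ∀ b x y → x * [ b ]? y ≈ [ b ]? (x * y)
  []?-* true x y = refl
  []?-* false x y = zeroʳ x

  Σ-cong-∈ : (xs : List A) {f g : A → Carrier} → (∀ {x} → x ∈ xs → f x ≈ g x) → Σ[ xs ] f ≈ Σ[ xs ] g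
  Σ-cong-∈ [] eq = refl
  Σ-cong-∈ (x ∷ xs) eq = +-cong (eq (here ≡.refl)) (Σ-cong-∈ xs (eq ∘ there))

  Σ-cong : (xs : List A) {f g : A → Carrier} → (∀ x → f x ≈ g x) → Σ[ xs ] f ≈ Σ[ xs ] g
  Σ-cong xs eq = Σ-cong-∈ xs (λ {x} _ → eq x)

  Σ-zero : (xs : List A) → Σ[ xs ] (λ _ → 0#) ≈ 0#
  Σ-zero [] = refl
  Σ-zero (x ∷ xs) = trans (+-identityˡ _) (Σ-zero xs)

  Σ-vanish : (xs : List A) {f : A → Carrier} → (∀ x → f x ≈ 0#) → Σ[ xs ] f ≈ 0#
  Σ-vanish xs eq = trans (Σ-cong xs eq) (Σ-zero xs)

  Σ-+ : (xs : List A) (f g : A → Carrier) → Σ[ xs ] (λ x → f x + g x) ≈ Σ[ xs ] f + Σ[ xs ] g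
  Σ-+ [] f g = sym (+-identityˡ _)
  Σ-+ (x ∷ xs) f g = trans (+-congˡ (Σ-+ xs f g)) (interchange _ _ _ _)

  Σ-neg : (xs : List A) (f : A → Carrier) → Σ[ xs ] (λ x → - f x) ≈ - Σ[ xs ] f
  Σ-neg [] f = sym -0#≈0#
  Σ-neg (x ∷ xs) f = trans (+-congˡ (Σ-neg xs f)) (-‿+-comm _ _)

  Σ-*ˡ : (xs : List A) (c : Carrier) (f : A → Carrier) → Σ[ xs ] (λ x → c * f x) ≈ c * Σ[ xs ] f
  Σ-*ˡ [] c f = sym (zeroʳ c)
  Σ-*ˡ (x ∷ xs) c f = trans (+-congˡ (Σ-*ˡ xs c f)) (sym (distribˡ c _ _))

  Σ-*ʳ : (xs : List A) (c : Carrier) (f : A → Carrier) → Σ[ xs ] (λ x → f x * c) ≈ Σ[ xs ] f * c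
  Σ-*ʳ xs c f = trans (Σ-cong xs (λ x → *-comm _ _)) (trans (Σ-*ˡ xs c f) (*-comm _ _))

  Σ-++ : (xs ys : List A) (f : A → Carrier) → Σ[ xs ++ ys ] f ≈ Σ[ xs ] f + Σ[ ys ] f
  Σ-++ [] ys f = sym (+-identityˡ _)
  Σ-++ (x ∷ xs) ys f = trans (+-congˡ (Σ-++ xs ys f)) (sym (+-assoc _ _ _))

  Σ-map : (g : A → B) (xs : List A) (f : B → Carrier) → Σ[ map g xs ] f ≡ Σ[ xs ] (f ∘ g)
  Σ-map g xs f = ≡.cong sumL (≡.sym (map-∘ xs))

  Σ-concatMap : (g : A → List B) (xs : List A) (f : B → Carrier) → Σ[ concatMap g xs ] f ≈ Σ[ xs ] (λ x → Σ[ g x ] f)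
  Σ-concatMap g [] f = refl
  Σ-concatMap g (x ∷ xs) f = trans (Σ-++ (g x) _ f) (+-congˡ (Σ-concatMap g xs f))

  Σ-filterᵇ : (p : A → Bool) (xs : List A) (f : A → Carrier) → Σ[ filterᵇ p xs ] f ≈ Σ[ xs ] (λ x → [ p x ]? (f x))
  Σ-filterᵇ p [] f = refl
  Σ-filterᵇ p (x ∷ xs) f with p x
  ... | true = +-congˡ (Σ-filterᵇ p xs f)
  ... | false = trans (Σ-filterᵇ p xs f) (sym (+-identityˡ _))

  Σ-swap : (xs : List A) (ys : List B) (f : A → B → Carrier) →
    Σ[ xs ] (λ x → Σ[ ys ] (f x)) ≈ Σ[ ys ] (λ y → Σ[ xs ] (λ x → f x y))
  Σ-swap [] ys f = sym (Σ-zero ys)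
  Σ-swap (x ∷ xs) ys f = trans (+-congˡ (Σ-swap xs ys f)) (sym (Σ-+ ys _ _))

  -- The summand is supplied through head and tail, up to `≈`. Thus the enumerated pattern-matching
  -- lambdas are never compared as functions, which would call for extensionality.
  Σ-allFns : (xs : List A) (n : ℕ) {Φ : (Fin (suc n) → A) → Carrier} (Ψ : A → (Fin n → A) → Carrier) →
    (∀ f → Φ f ≈ Ψ (f zero) (f ∘ suc)) → Σ[ allFns xs (suc n) ] Φ ≈ Σ[ xs ] (λ x → Σ[ allFns xs n ] (Ψ x))
  Σ-allFns xs n Ψ eq = trans (Σ-concatMap _ xs _)
    (Σ-cong xs (λ x → trans (reflexive (Σ-map _ (allFns xs n) _)) (Σ-cong (allFns xs n) (λ f → eq _))))

  Σ-depFns : (n : ℕ) (ch : Fin (suc n) → List A) {Φ : (Fin (suc n) → A) → Carrier} (Ψ : A → (Fin n → A) → Carrier) →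
    (∀ f → Φ f ≈ Ψ (f zero) (f ∘ suc)) →
    Σ[ depFns (suc n) ch ] Φ ≈ Σ[ ch zero ] (λ x → Σ[ depFns n (ch ∘ suc) ] (Ψ x))
  Σ-depFns n ch Ψ eq = trans (Σ-concatMap _ (ch zero) _)
    (Σ-cong (ch zero) (λ x → trans (reflexive (Σ-map _ (depFns n _) _)) (Σ-cong (depFns n _) (λ f → eq _))))

  -- Families are lists rather than functions on `Fin n`, so that one member can be singled out as
  -- `pre ++ x ∷ post` and replaced.
  Σ-tuples : List (List A) → (List A → Carrier) → Carrier
  Σ-tuples [] Ψ = Ψ []
  Σ-tuples (xs ∷ xss) Ψ = Σ[ xs ] (λ x → Σ-tuples xss (λ t → Ψ (x ∷ t)))

  Σ-tuples-cong-∈ : (xss : List (List A)) {Φ Ψ : List A → Carrier} →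
    (∀ {t} → Pointwise _∈_ t xss → Φ t ≈ Ψ t) → Σ-tuples xss Φ ≈ Σ-tuples xss Ψ
  Σ-tuples-cong-∈ [] eq = eq []
  Σ-tuples-cong-∈ (xs ∷ xss) eq = Σ-cong-∈ xs (λ x∈ → Σ-tuples-cong-∈ xss (λ t∈ → eq (x∈ ∷ t∈)))

  Σ-tuples-cong : (xss : List (List A)) {Φ Ψ : List A → Carrier} →
    (∀ t → Φ t ≈ Ψ t) → Σ-tuples xss Φ ≈ Σ-tuples xss Ψ
  Σ-tuples-cong xss eq = Σ-tuples-cong-∈ xss (λ {t} _ → eq t)

  Σ-tuples-*ˡ : (xss : List (List A)) (c : Carrier) (Ψ : List A → Carrier) →
    Σ-tuples xss (λ t → c * Ψ t) ≈ c * Σ-tuples xss Ψ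
  Σ-tuples-*ˡ [] c Ψ = refl
  Σ-tuples-*ˡ (xs ∷ xss) c Ψ = trans (Σ-cong xs (λ x → Σ-tuples-*ˡ xss c _)) (Σ-*ˡ xs c _)

  Σ-tuples-+ : (xss : List (List A)) (Φ Ψ : List A → Carrier) →
    Σ-tuples xss (λ t → Φ t + Ψ t) ≈ Σ-tuples xss Φ + Σ-tuples xss Ψ
  Σ-tuples-+ [] Φ Ψ = refl
  Σ-tuples-+ (xs ∷ xss) Φ Ψ = trans (Σ-cong xs (λ x → Σ-tuples-+ xss _ _)) (Σ-+ xs _ _)

  Σ-tuples-neg : (xss : List (List A)) (Ψ : List A → Carrier) →
    Σ-tuples xss (λ t → - Ψ t) ≈ - Σ-tuples xss Ψ
  Σ-tuples-neg [] Ψ = refl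
  Σ-tuples-neg (xs ∷ xss) Ψ = trans (Σ-cong xs (λ x → Σ-tuples-neg xss _)) (Σ-neg xs _)

  Σ-tuples-zero : (xss : List (List A)) → Σ-tuples xss (λ _ → 0#) ≈ 0#
  Σ-tuples-zero [] = refl
  Σ-tuples-zero (xs ∷ xss) = Σ-vanish xs (λ _ → Σ-tuples-zero xss)

  Σ-tuples-swap : (xss : List (List A)) (ys : List B) (Ψ : List A → B → Carrier) →
    Σ-tuples xss (λ t → Σ[ ys ] (Ψ t)) ≈ Σ[ ys ] (λ y → Σ-tuples xss (λ t → Ψ t y))
  Σ-tuples-swap [] ys Ψ = refl
  Σ-tuples-swap (xs ∷ xss) ys Ψ = trans (Σ-cong xs (λ x → Σ-tuples-swap xss ys _)) (Σ-swap xs ys _)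

  Σ-depFns-tuples : (n : ℕ) (ch : Fin n → List A) (h : Fin n → A → B) (Ψ : List B → Carrier) →
    Σ[ depFns n ch ] (λ f → Ψ (tabulate (λ k → h k (f k)))) ≈ Σ-tuples (tabulate (λ k → map (h k) (ch k))) Ψ
  Σ-depFns-tuples zero ch h Ψ = +-identityʳ _
  Σ-depFns-tuples (suc n) ch h Ψ =
    trans (Σ-depFns n ch (λ x f → Ψ (h zero x ∷ tabulate (λ k → h (suc k) (f k)))) (λ f → refl))
      (trans (Σ-cong (ch zero) (λ x → Σ-depFns-tuples n (ch ∘ suc) (h ∘ suc) (λ t → Ψ (h zero x ∷ t))))
        (reflexive (≡.sym (Σ-map (h zero) (ch zero) _))))

  Σ-allFns-tuples : (n : ℕ) (xs : List A) (h : Fin n → A → B) (Ψ : List B → Carrier) →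
    Σ[ allFns xs n ] (λ f → Ψ (tabulate (λ k → h k (f k)))) ≈ Σ-tuples (tabulate (λ k → map (h k) xs)) Ψ
  Σ-allFns-tuples zero xs h Ψ = +-identityʳ _
  Σ-allFns-tuples (suc n) xs h Ψ =
    trans (Σ-allFns xs n (λ x f → Ψ (h zero x ∷ tabulate (λ k → h (suc k) (f k)))) (λ f → refl))
      (trans (Σ-cong xs (λ x → Σ-allFns-tuples n xs (h ∘ suc) (λ t → Ψ (h zero x ∷ t))))
        (reflexive (≡.sym (Σ-map (h zero) xs _))))

  prodF-suc : (n : ℕ) (f : Fin (suc n) → Carrier) → prodF (suc n) f ≈ f zero * prodF n (f ∘ suc)
  prodF-suc n f = reflexive (≡.cong (foldr _*_ 1#) (allFin-map-suc n f))

  prodF-cong : (n : ℕ) {f g : Fin n → Carrier} → (∀ i → f i ≈ g i) → prodF n f ≈ prodF n g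
  prodF-cong zero eq = refl
  prodF-cong (suc n) {f} {g} eq = trans (prodF-suc n f)
    (trans (*-cong (eq zero) (prodF-cong n (eq ∘ suc))) (sym (prodF-suc n g)))

  prodF-* : (n : ℕ) (f g : Fin n → Carrier) → prodF n (λ i → f i * g i) ≈ prodF n f * prodF n g
  prodF-* zero f g = sym (*-identityˡ _)
  prodF-* (suc n) f g = begin
    prodF (suc n) (λ i → f i * g i) ≈⟨ prodF-suc n (λ i → f i * g i) ⟩
    (f zero * g zero) * prodF n (λ i → f (suc i) * g (suc i)) ≈⟨ *-congˡ (prodF-* n (f ∘ suc) (g ∘ suc)) ⟩
    (f zero * g zero) * (prodF n (f ∘ suc) * prodF n (g ∘ suc)) ≈⟨ Mul.interchange _ _ _ _ ⟩
    (f zero * prodF n (f ∘ suc)) * (g zero * prodF n (g ∘ suc)) ≈⟨ *-cong (prodF-suc n f) (prodF-suc n g) ⟨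
    prodF (suc n) f * prodF (suc n) g ∎

  sign-+ : ∀ m n → sign (m ℕ.+ n) ≈ sign m * sign n
  sign-+ zero n = sym (*-identityˡ _)
  sign-+ (suc m) n = trans (-‿cong (sign-+ m n)) (-‿distribˡ-* _ _)

-- Determinants as Laplace expansions over lists

data Repeated {A : Set p} (x : A) : List A → Set p where
  here  : ∀ {xs} → x ∈ xs → Repeated x (x ∷ xs)
  there : ∀ {y xs} → Repeated x xs → Repeated x (y ∷ xs)

module Determinants {a ℓ} (R : CommutativeRing a ℓ) where
  open CommutativeRing R hiding (zero)
  open Sums R
  open RingProperties ring using (-‿distribʳ-*; -0#≈0#; -‿+-comm; +-inverseʳ-unique)
  open SetoidReasoning setoid
  open CSemi +-commutativeSemigroup using (interchange)

  -‿cong₂ : ∀ {x y u v} → x ≈ y → u ≈ v → x - u ≈ y - v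
  -‿cong₂ p q = +-cong p (-‿cong q)

  -- The alternating sum over all ways to remove one entry: the cofactor expansion along a row,
  -- where `φ` receives the removed column and the remaining ones in order.
  pickΣ : (B → List B → Carrier) → List B → Carrier
  pickΣ φ [] = 0#
  pickΣ φ (x ∷ xs) = φ x xs - pickΣ (λ y ys → φ y (x ∷ ys)) xs

  -- Extra columns must give 0 (not 1) for det-columns-Σ to hold without a length hypothesis.
  det : (A → B → Carrier) → List A → List B → Carrier
  det M [] [] = 1#
  det M [] (_ ∷ _) = 0#
  det M (r ∷ rs) = pickΣ (λ x xs → M r x * det M rs xs)

  pickΣ-cong : {φ ψ : B → List B → Carrier} → (∀ x xs → φ x xs ≈ ψ x xs) → ∀ cs → pickΣ φ cs ≈ pickΣ ψ cs
  pickΣ-cong eq [] = refl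
  pickΣ-cong eq (x ∷ xs) = -‿cong₂ (eq x xs) (pickΣ-cong (λ y ys → eq y (x ∷ ys)) xs)

  pickΣ-zero : (cs : List B) → pickΣ (λ _ _ → 0#) cs ≈ 0#
  pickΣ-zero [] = refl
  pickΣ-zero (x ∷ xs) = trans (-‿cong₂ refl (pickΣ-zero xs)) (-‿inverseʳ 0#)

  pickΣ-vanish : {φ : B → List B → Carrier} → (∀ x xs → φ x xs ≈ 0#) → ∀ cs → pickΣ φ cs ≈ 0#
  pickΣ-vanish eq cs = trans (pickΣ-cong eq cs) (pickΣ-zero cs)

  pickΣ-+ : (φ ψ : B → List B → Carrier) → ∀ cs → pickΣ (λ x xs → φ x xs + ψ x xs) cs ≈ pickΣ φ cs + pickΣ ψ cs
  pickΣ-+ φ ψ [] = sym (+-identityˡ _)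
  pickΣ-+ φ ψ (x ∷ xs) = trans (-‿cong₂ refl (pickΣ-+ _ _ xs))
    (trans (+-congˡ (sym (-‿+-comm _ _))) (interchange _ _ _ _))

  pickΣ-*ˡ : (c : Carrier) (φ : B → List B → Carrier) → ∀ cs → pickΣ (λ x xs → c * φ x xs) cs ≈ c * pickΣ φ cs
  pickΣ-*ˡ c φ [] = sym (zeroʳ c)
  pickΣ-*ˡ c φ (x ∷ xs) = trans (-‿cong₂ refl (pickΣ-*ˡ c _ xs))
    (trans (+-congˡ (-‿distribʳ-* c _)) (sym (distribˡ c _ _)))

  pickΣ-neg : (φ : B → List B → Carrier) → ∀ cs → pickΣ (λ x xs → - φ x xs) cs ≈ - pickΣ φ cs
  pickΣ-neg φ [] = sym -0#≈0#
  pickΣ-neg φ (x ∷ xs) = trans (-‿cong₂ refl (pickΣ-neg _ xs)) (-‿+-comm _ _)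

  pickΣ-Σ : (qs : List A) (φ : A → B → List B → Carrier) → ∀ cs →
    pickΣ (λ x xs → Σ[ qs ] (λ q → φ q x xs)) cs ≈ Σ[ qs ] (λ q → pickΣ (φ q) cs)
  pickΣ-Σ [] φ cs = pickΣ-zero cs
  pickΣ-Σ (q ∷ qs) φ cs = trans (pickΣ-+ _ _ cs) (+-congˡ (pickΣ-Σ qs φ cs))

  -- Removing x and then y leaves the same list as removing y and then x, with the opposite sign.
  -- Matching these terms directly gives zero even where 2 is a zero divisor.
  pickΣ-symmetric : (φ : B → B → List B → Carrier) → (∀ x y l → φ x y l ≈ φ y x l) → ∀ cs →
    pickΣ (λ x xs → pickΣ (φ x) xs) cs ≈ 0#
  pickΣ-symmetric φ φ-sym [] = refl
  pickΣ-symmetric φ φ-sym (x ∷ xs) = begin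
    P - pickΣ (λ y ys → φ y x ys - pickΣ (λ z zs → φ y z (x ∷ zs)) ys) xs
      -- The terms with the head removed second are, by symmetry, another copy of `P`.
      ≈⟨ -‿cong₂ refl (trans (pickΣ-+ _ _ xs) (+-cong (pickΣ-cong (λ y ys → φ-sym y x ys) xs) (pickΣ-neg _ xs))) ⟩
    P - (P - pickΣ (λ y ys → pickΣ (λ z zs → φ y z (x ∷ zs)) ys) xs)
      ≈⟨ -‿cong₂ refl (-‿cong₂ refl (pickΣ-symmetric _ (λ y z l → φ-sym y z (x ∷ l)) xs)) ⟩
    P - (P - 0#) ≈⟨ -‿cong₂ refl (trans (+-congˡ -0#≈0#) (+-identityʳ P)) ⟩
    P - P ≈⟨ -‿inverseʳ P ⟩
    0# ∎
    where P = pickΣ (φ x) xs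

  det-expand₂ : (M : A → B → Carrier) (r s : A) (rs : List A) (cs : List B) →
    det M (r ∷ s ∷ rs) cs ≈ pickΣ (λ x xs → pickΣ (λ y ys → (M r x * M s y) * det M rs ys) xs) cs
  det-expand₂ M r s rs = pickΣ-cong (λ x xs → trans (sym (pickΣ-*ˡ (M r x) _ xs))
    (pickΣ-cong (λ y ys → sym (*-assoc _ _ _)) xs))

  det-equal-rows : (M : A → B → Carrier) (r : A) (rs : List A) (cs : List B) → det M (r ∷ r ∷ rs) cs ≈ 0#
  det-equal-rows M r rs cs = trans (det-expand₂ M r r rs cs)
    (pickΣ-symmetric _ (λ x y l → *-congʳ (*-comm _ _)) cs)

  -- The sum of the two determinants is a double removal of a symmetric expression.
  det-swap-rows : (M : A → B → Carrier) (r s : A) (rs : List A) (cs : List B) →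
    det M (r ∷ s ∷ rs) cs ≈ - det M (s ∷ r ∷ rs) cs
  det-swap-rows M r s rs cs = +-inverseʳ-unique _ _ (begin
    det M (s ∷ r ∷ rs) cs + det M (r ∷ s ∷ rs) cs
      ≈⟨ +-cong (det-expand₂ M s r rs cs) (det-expand₂ M r s rs cs) ⟩
    _ ≈⟨ pickΣ-+ _ _ cs ⟨
    _ ≈⟨ pickΣ-cong (λ x xs → sym (pickΣ-+ _ _ xs)) cs ⟩
    _ ≈⟨ pickΣ-symmetric (λ x y l → (M s x * M r y) * det M rs l + (M r x * M s y) * det M rs l)
          (λ x y l → trans (+-comm _ _) (+-cong (*-congʳ (*-comm _ _)) (*-congʳ (*-comm _ _)))) cs ⟩
    0# ∎)

  det-head-repeated : (M : A → B → Carrier) {r : A} {rs : List A} → r ∈ rs → ∀ cs → det M (r ∷ rs) cs ≈ 0#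
  det-head-repeated M {r} (here {xs = rs} ≡.refl) cs = det-equal-rows M r rs cs
  det-head-repeated M {r} (there {x = s} {xs = rs} r∈rs) cs = begin
    det M (r ∷ s ∷ rs) cs ≈⟨ det-swap-rows M r s rs cs ⟩
    - det M (s ∷ r ∷ rs) cs ≈⟨ -‿cong (pickΣ-vanish (λ x xs → trans (*-congˡ (det-head-repeated M r∈rs xs)) (zeroʳ _)) cs) ⟩
    - 0# ≈⟨ -0#≈0# ⟩
    0# ∎

  det-repeated : (M : A → B → Carrier) {r : A} {rs : List A} → Repeated r rs → ∀ cs → det M rs cs ≈ 0#
  det-repeated M (here r∈rs) cs = det-head-repeated M r∈rs cs
  det-repeated M (there dup) cs = pickΣ-vanish (λ x xs → trans (*-congˡ (det-repeated M dup xs)) (zeroʳ _)) cs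

  det-cong : {M N : A → B → Carrier} → (∀ r x → M r x ≈ N r x) → ∀ rs cs → det M rs cs ≈ det N rs cs
  det-cong eq [] [] = refl
  det-cong eq [] (_ ∷ _) = refl
  det-cong eq (r ∷ rs) = pickΣ-cong (λ x xs → *-cong (eq r x) (det-cong eq rs xs))

  pickΣ-Pointwise : {D : Set p} {_∼_ : B → D → Set r} {φ : B → List B → Carrier} {ψ : D → List D → Carrier} →
    (∀ {x y xs ys} → x ∼ y → Pointwise _∼_ xs ys → φ x xs ≈ ψ y ys) →
    ∀ {cs ds} → Pointwise _∼_ cs ds → pickΣ φ cs ≈ pickΣ ψ ds
  pickΣ-Pointwise eq [] = refl
  pickΣ-Pointwise eq (x∼y ∷ xs∼ys) = -‿cong₂ (eq x∼y xs∼ys)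
    (pickΣ-Pointwise (λ u∼v us∼vs → eq u∼v (x∼y ∷ us∼vs)) xs∼ys)

  -- Entries need to agree for related rows and columns only. This serves to compare rows (s - σ)f
  -- under Horner columns with rows f under coefficient columns, where agreement depends on degree
  -- bounds.
  det-Pointwise : {A′ : Set p} {B′ : Set q} {_≃_ : A → A′ → Set r} {_∼_ : B → B′ → Set t}
    {M : A → B → Carrier} {N : A′ → B′ → Carrier} →
    (∀ {r s x y} → r ≃ s → x ∼ y → M r x ≈ N s y) →
    ∀ {rs ss cs ds} → Pointwise _≃_ rs ss → Pointwise _∼_ cs ds → det M rs cs ≈ det N ss ds
  det-Pointwise eq [] [] = refl
  det-Pointwise eq [] (_ ∷ _) = refl
  det-Pointwise eq (r≃s ∷ rs≃ss) = pickΣ-Pointwise (λ x∼y xs∼ys → *-cong (eq r≃s x∼y) (det-Pointwise eq rs≃ss xs∼ys))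

  det-add-row-multiple : (M : A → B → Carrier) {r s t : A} {k : Carrier} (rs : List A) →
    (∀ x → M r x ≈ M t x + k * M s x) → ∀ cs → det M (s ∷ r ∷ rs) cs ≈ det M (s ∷ t ∷ rs) cs
  det-add-row-multiple M {r} {s} {t} {k} rs eq cs = begin
    det M (s ∷ r ∷ rs) cs
      ≈⟨ pickΣ-cong (λ x xs → trans (*-congˡ (trans (pickΣ-cong (λ y ys → trans (*-congʳ (eq y)) (trans (distribʳ _ _ _) (+-congˡ (*-assoc _ _ _)))) xs)
          (trans (pickΣ-+ _ _ xs) (+-congˡ (pickΣ-*ˡ k _ xs))))) (trans (distribˡ _ _ _) (+-congˡ (Mul.x∙yz≈y∙xz _ _ _)))) cs ⟩
    _ ≈⟨ trans (pickΣ-+ _ _ cs) (+-congˡ (pickΣ-*ˡ k _ cs)) ⟩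
    det M (s ∷ t ∷ rs) cs + k * det M (s ∷ s ∷ rs) cs
      ≈⟨ +-congˡ (trans (*-congˡ (det-equal-rows M s rs cs)) (zeroʳ k)) ⟩
    det M (s ∷ t ∷ rs) cs + 0# ≈⟨ +-identityʳ _ ⟩
    det M (s ∷ t ∷ rs) cs ∎

  det-map-rows : (M : B → C → Carrier) (f : A → B) → ∀ rs cs → det M (map f rs) cs ≈ det (M ∘ f) rs cs
  det-map-rows M f [] [] = refl
  det-map-rows M f [] (_ ∷ _) = refl
  det-map-rows M f (r ∷ rs) = pickΣ-cong (λ x xs → *-congˡ (det-map-rows M f rs xs))

  pickΣ-map : (φ : C → List C → Carrier) (f : B → C) → ∀ cs → pickΣ φ (map f cs) ≈ pickΣ (λ x xs → φ (f x) (map f xs)) cs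
  pickΣ-map φ f [] = refl
  pickΣ-map φ f (x ∷ xs) = -‿cong₂ refl (pickΣ-map _ f xs)

  det-map-cols : (M : A → C → Carrier) (f : B → C) → ∀ rs cs → det M rs (map f cs) ≈ det (λ r x → M r (f x)) rs cs
  det-map-cols M f [] [] = refl
  det-map-cols M f [] (_ ∷ _) = refl
  det-map-cols M f (r ∷ rs) cs = trans (pickΣ-map _ f cs) (pickΣ-cong (λ x xs → *-congˡ (det-map-cols M f rs xs)) cs)

  -- For empty `qs` this says that a zero row makes the determinant vanish.
  det-row-Σ : (M : A → B → Carrier) (pre : List A) {r : A} (qs : List A) (post : List A) →
    (∀ x → M r x ≈ Σ[ qs ] (λ q → M q x)) → ∀ cs →
    det M (pre ++ r ∷ post) cs ≈ Σ[ qs ] (λ q → det M (pre ++ q ∷ post) cs)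
  det-row-Σ M [] qs post eq cs =
    trans (pickΣ-cong (λ x xs → trans (*-congʳ (eq x)) (sym (Σ-*ʳ qs _ _))) cs) (pickΣ-Σ qs _ cs)
  det-row-Σ M (r ∷ pre) qs post eq cs =
    trans (pickΣ-cong (λ x xs → trans (*-congˡ (det-row-Σ M pre qs post eq xs)) (sym (Σ-*ˡ qs _ _))) cs) (pickΣ-Σ qs _ cs)

  det-rows-Σ : (M : A → B → Carrier) (xss : List (List A)) → ∀ cs →
    Σ-tuples xss (λ t → det M t cs) ≈ det (λ qs x → Σ[ qs ] (λ q → M q x)) xss cs
  det-rows-Σ M [] [] = refl
  det-rows-Σ M [] (_ ∷ _) = refl
  det-rows-Σ M (qs ∷ xss) cs = begin
    Σ[ qs ] (λ q → Σ-tuples xss (λ t → det M (q ∷ t) cs))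
      ≈⟨ Σ-cong qs (λ q → Σ-tuples-pick xss _ cs) ⟩
    Σ[ qs ] (λ q → pickΣ (λ x xs → Σ-tuples xss (λ t → M q x * det M t xs)) cs)
      ≈⟨ pickΣ-Σ qs _ cs ⟨
    pickΣ (λ x xs → Σ[ qs ] (λ q → Σ-tuples xss (λ t → M q x * det M t xs))) cs
      ≈⟨ pickΣ-cong (λ x xs → trans (Σ-cong qs (λ q → trans (Σ-tuples-*ˡ xss _ _) (*-congˡ (det-rows-Σ M xss xs)))) (Σ-*ʳ qs _ _)) cs ⟩
    det _ (qs ∷ xss) cs ∎
    where
    Σ-tuples-pick : (xss : List (List A)) (φ : List A → B → List B → Carrier) → ∀ cs →
      Σ-tuples xss (λ t → pickΣ (φ t) cs) ≈ pickΣ (λ x xs → Σ-tuples xss (λ t → φ t x xs)) cs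
    Σ-tuples-pick [] φ cs = refl
    Σ-tuples-pick (xs ∷ xss) φ cs = trans (Σ-cong xs (λ x → Σ-tuples-pick xss _ cs)) (sym (pickΣ-Σ xs _ cs))

  -- Linearity and alternation in the columns

  module ColumnLinear (x y z : B) (s : Carrier) where
    Linear : (List B → Carrier) → Set _
    Linear F = ∀ pre post → F (pre ++ x ∷ post) ≈ F (pre ++ y ∷ post) + s * F (pre ++ z ∷ post)

    +-neg-lin : ∀ {u v w u′ v′ w′} → u ≈ v + s * w → u′ ≈ v′ + s * w′ → u - u′ ≈ (v - v′) + s * (w - w′)
    +-neg-lin {u} {v} {w} {u′} {v′} {w′} eq eq′ = begin
      u - u′ ≈⟨ -‿cong₂ eq eq′ ⟩
      (v + s * w) - (v′ + s * w′) ≈⟨ +-congˡ (-‿+-comm _ _) ⟨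
      (v + s * w) + (- v′ + - (s * w′)) ≈⟨ interchange _ _ _ _ ⟩
      (v - v′) + (s * w - s * w′) ≈⟨ +-congˡ (trans (+-congˡ (-‿distribʳ-* s w′)) (sym (distribˡ s _ _))) ⟩
      (v - v′) + s * (w - w′) ∎

    pickΣ-linear : (φ : B → List B → Carrier) → (∀ u → Linear (φ u)) →
      (∀ l → φ x l ≈ φ y l + s * φ z l) → Linear (pickΣ φ)
    pickΣ-linear φ lin lin₀ [] post = +-neg-lin (lin₀ post)
      (trans (pickΣ-cong (λ u us → lin u [] us) post) (trans (pickΣ-+ _ _ post) (+-congˡ (pickΣ-*ˡ s _ post))))
    pickΣ-linear φ lin lin₀ (u ∷ pre) post = +-neg-lin (lin u pre post)
      (pickΣ-linear (λ v vs → φ v (u ∷ vs)) (λ v pre′ → lin v (u ∷ pre′)) (λ l → lin₀ (u ∷ l)) pre post)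

    det-linear : (M : A → B → Carrier) → (∀ r → M r x ≈ M r y + s * M r z) → ∀ rs → Linear (det M rs)
    det-linear M eq [] [] post = sym (trans (+-identityˡ _) (zeroʳ s))
    det-linear M eq [] (_ ∷ _) post = sym (trans (+-identityˡ _) (zeroʳ s))
    det-linear M eq (r ∷ rs) = pickΣ-linear _
      (λ u pre post → trans (*-congˡ (det-linear M eq rs pre post))
        (trans (distribˡ _ _ _) (+-congˡ (Mul.x∙yz≈y∙xz _ _ _))))
      (λ l → trans (*-congʳ (eq r)) (trans (distribʳ _ _ _) (+-congˡ (*-assoc _ _ _))))

  module ColumnAlternating (x : B) where
    Alternating : (List B → Carrier) → Set _
    Alternating F = ∀ pre post → F (pre ++ x ∷ x ∷ post) ≈ 0#

    -- Picking either copy of `x` leaves the same list, with opposite signs; every other pick keeps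
    -- the two copies adjacent.
    pickΣ-alternating : (φ : B → List B → Carrier) → (∀ u → Alternating (φ u)) → Alternating (pickΣ φ)
    pickΣ-alternating φ alt [] post = begin
      φ x (x ∷ post) - (φ x (x ∷ post) - pickΣ (λ u us → φ u (x ∷ x ∷ us)) post)
        ≈⟨ -‿cong₂ refl (-‿cong₂ refl (pickΣ-vanish (λ u us → alt u [] us) post)) ⟩
      φ x (x ∷ post) - (φ x (x ∷ post) - 0#) ≈⟨ -‿cong₂ refl (trans (+-congˡ -0#≈0#) (+-identityʳ _)) ⟩
      φ x (x ∷ post) - φ x (x ∷ post) ≈⟨ -‿inverseʳ _ ⟩
      0# ∎
    pickΣ-alternating φ alt (u ∷ pre) post = trans
      (-‿cong₂ (alt u pre post) (pickΣ-alternating (λ v vs → φ v (u ∷ vs)) (λ v pre′ → alt v (u ∷ pre′)) pre post))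
      (-‿inverseʳ 0#)

    det-alternating : (M : A → B → Carrier) → ∀ rs → Alternating (det M rs)
    det-alternating M [] [] post = refl
    det-alternating M [] (_ ∷ _) post = refl
    det-alternating M (r ∷ rs) = pickΣ-alternating _
      (λ u pre post → trans (*-congˡ (det-alternating M rs pre post)) (zeroʳ _))

  det-zero-column : (M : A → B → Carrier) (x : B) → ∀ rs → (∀ {r} → r ∈ rs → M r x ≈ 0#) → ∀ cs → det M rs (x ∷ cs) ≈ 0#
  det-zero-column M x [] eq cs = refl
  det-zero-column M x (r ∷ rs) eq cs = trans (-‿cong₂ (trans (*-congʳ (eq (here ≡.refl))) (zeroˡ _))
    (pickΣ-vanish (λ y ys → trans (*-congˡ (det-zero-column M x rs (eq ∘ there) ys)) (zeroʳ _)) cs)) (-‿inverseʳ 0#)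

  -- Expansion over a choice in each column

  weights : (B → Carrier) → List B → Carrier
  weights w xs = foldr _*_ 1# (map w xs)

  -- When a column other than the head is picked, the value x chosen for the head column stays
  -- behind. `reorder` returns that choice and its weight to the tuple of the remaining columns, so
  -- that the cofactor expansion commutes with the choices.
  pickΣ-weighted-tuples : (w : B → Carrier) (φ : B → List B → Carrier) (css : List (List B)) →
    Σ-tuples css (λ t → weights w t * pickΣ φ t) ≈
    pickΣ (λ cs rest → Σ[ cs ] (λ x → w x * Σ-tuples rest (λ t → weights w t * φ x t))) css
  pickΣ-weighted-tuples w φ [] = zeroʳ _
  pickΣ-weighted-tuples w φ (cs ∷ css) = begin
    Σ[ cs ] (λ x → Σ-tuples css (λ t → (w x * weights w t) * (φ x t - pickΣ (λ y ys → φ y (x ∷ ys)) t)))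
      ≈⟨ Σ-cong cs (λ x → trans (Σ-tuples-cong css (λ t → trans (*-assoc _ _ _) (*-congˡ (trans (distribˡ _ _ _) (+-congˡ (sym (-‿distribʳ-* _ _)))))))
          (trans (Σ-tuples-*ˡ css (w x) _) (trans (*-congˡ (trans (Σ-tuples-+ css _ _) (+-congˡ (Σ-tuples-neg css _)))) (trans (distribˡ _ _ _) (+-congˡ (sym (-‿distribʳ-* _ _))))))) ⟩
    Σ[ cs ] (λ x → w x * Σ-tuples css (λ t → weights w t * φ x t) - w x * Σ-tuples css (λ t → weights w t * pickΣ (λ y ys → φ y (x ∷ ys)) t))
      ≈⟨ trans (Σ-+ cs _ _) (+-congˡ (Σ-neg cs _)) ⟩
    Q - Σ[ cs ] (λ x → w x * Σ-tuples css (λ t → weights w t * pickΣ (λ y ys → φ y (x ∷ ys)) t))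
      ≈⟨ -‿cong₂ refl (Σ-cong cs (λ x → trans (*-congˡ (pickΣ-weighted-tuples w (λ y ys → φ y (x ∷ ys)) css)) (sym (pickΣ-*ˡ (w x) _ css)))) ⟩
    Q - Σ[ cs ] (λ x → pickΣ (λ cs′ rest → w x * Σ[ cs′ ] (λ y → w y * Σ-tuples rest (λ t → weights w t * φ y (x ∷ t)))) css)
      ≈⟨ -‿cong₂ refl (pickΣ-Σ cs _ css) ⟨
    Q - pickΣ (λ cs′ rest → Σ[ cs ] (λ x → w x * Σ[ cs′ ] (λ y → w y * Σ-tuples rest (λ t → weights w t * φ y (x ∷ t))))) css
      ≈⟨ -‿cong₂ refl (pickΣ-cong (λ cs′ rest → reorder cs′ rest) css) ⟩
    Q - pickΣ (λ cs′ rest → Σ[ cs′ ] (λ y → w y * Σ[ cs ] (λ x → Σ-tuples rest (λ t → (w x * weights w t) * φ y (x ∷ t))))) css ∎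
    where
    Q = Σ[ cs ] (λ x → w x * Σ-tuples css (λ t → weights w t * φ x t))
    reorder : ∀ cs′ rest → Σ[ cs ] (λ x → w x * Σ[ cs′ ] (λ y → w y * Σ-tuples rest (λ t → weights w t * φ y (x ∷ t)))) ≈
      Σ[ cs′ ] (λ y → w y * Σ[ cs ] (λ x → Σ-tuples rest (λ t → (w x * weights w t) * φ y (x ∷ t))))
    reorder cs′ rest = begin
      _ ≈⟨ Σ-cong cs (λ x → trans (sym (Σ-*ˡ cs′ (w x) _)) (Σ-cong cs′ (λ y → trans (Mul.x∙yz≈y∙xz _ _ _)
            (*-congˡ (trans (sym (Σ-tuples-*ˡ rest (w x) _)) (Σ-tuples-cong rest (λ t → sym (*-assoc _ _ _)))))))) ⟩
      _ ≈⟨ Σ-swap cs cs′ _ ⟩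
      _ ≈⟨ Σ-cong cs′ (λ y → Σ-*ˡ cs (w y) _) ⟩
      _ ∎

  -- This gathers all compositions in one determinant: the alternatives for column j will be the
  -- possible values of the part c(j).
  det-columns-Σ : (w : B → Carrier) (M : A → B → Carrier) → ∀ rs (css : List (List B)) →
    Σ-tuples css (λ t → weights w t * det M rs t) ≈ det (λ r cs → Σ[ cs ] (λ x → w x * M r x)) rs css
  det-columns-Σ w M [] [] = *-identityʳ _
  det-columns-Σ w M [] (cs ∷ css) = Σ-vanish cs (λ x → trans (Σ-tuples-cong css (λ t → zeroʳ _)) (Σ-tuples-zero css))
  det-columns-Σ w M (r ∷ rs) css = trans (pickΣ-weighted-tuples w _ css)
    (pickΣ-cong (λ cs rest → trans (Σ-cong cs (λ x → trans (*-congˡ (trans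
        (Σ-tuples-cong rest (λ t → Mul.x∙yz≈y∙xz _ _ _)) (Σ-tuples-*ˡ rest (M r x) _))) (sym (*-assoc _ _ _))))
      (trans (Σ-*ʳ cs _ _) (*-congˡ (det-columns-Σ w M rs rest)))) css)

-- The Hurwitz-type determinant

range : ℕ → ℕ → List ℕ
range i zero = []
range i (suc m) = i ∷ range (suc i) m

module Hurwitz {a ℓ} (R : CommutativeRing a ℓ) where
  open CommutativeRing R hiding (zero)
  open InRing R using (prodF)
  open Sums R
  open Determinants R
  open RingProperties ring using (-0#≈0#)
  open SetoidReasoning setoid
  open Solver commutativeSemiring using (solve; _:+_; _:*_; _:=_; con)
  open CSemi +-commutativeSemigroup using (interchange)

  Seq : Set a
  Seq = ℕ → Carrier

  shift : Seq → Seq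
  shift f zero = 0#
  shift f (suc e) = f e

  -- Modulo v² = s − v one has ∏ᵢ (1 + v + y i) = C(s) + (1 + v) B(s).
  mutual
    B-coeff : (d : ℕ) → (Fin d → Carrier) → Seq
    B-coeff zero y e = 0#
    B-coeff (suc d) y e = C-coeff d (y ∘ suc) e + (1# + y zero) * B-coeff d (y ∘ suc) e

    C-coeff : (d : ℕ) → (Fin d → Carrier) → Seq
    C-coeff zero y zero = 1#
    C-coeff zero y (suc e) = 0#
    C-coeff (suc d) y e = y zero * C-coeff d (y ∘ suc) e + shift (B-coeff d (y ∘ suc)) e

  -- Row k, counted from 0, is the v-part of the k-th member of 1, v, s, vs, ... times ∏ᵢ (1 + v + y
  -- i) = C + (1 + v) B. That v-part is B for the factor 1, and it is C for the factor v because v(1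
  -- + v) B = s B. Each further pair of rows is multiplied by s.
  hurwitz : (d : ℕ) → (Fin d → Carrier) → ℕ → Seq
  hurwitz d y zero = B-coeff d y
  hurwitz d y (suc zero) = C-coeff d y
  hurwitz d y (suc (suc k)) = shift (hurwitz d y k)

  pairProduct : (d : ℕ) → (Fin d → Carrier) → Carrier
  pairProduct zero y = 1#
  pairProduct (suc d) y = prodF d (λ i → 1# + y zero + y (suc i)) * pairProduct d (y ∘ suc)

  mutual
    -- Give v weight 1 and s weight 2. Then ∏ᵢ (1 + v + y i) has weight at most d, so that 2 deg C ≤
    -- d and 2 deg B ≤ d - 1.
    B-vanish : ∀ d y e → d ≤ e ℕ.+ e → B-coeff d y e ≈ 0#
    B-vanish zero y e _ = refl
    B-vanish (suc d) y e d< = trans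
      (+-cong (C-vanish d (y ∘ suc) e d<) (trans (*-congˡ (B-vanish d (y ∘ suc) e (ℕ.<⇒≤ d<))) (zeroʳ _)))
      (+-identityˡ 0#)

    C-vanish : ∀ d y e → d < e ℕ.+ e → C-coeff d y e ≈ 0#
    C-vanish zero y (suc e) _ = refl
    C-vanish (suc d) y (suc e) (s≤s d<) = trans
      (+-cong (trans (*-congˡ (C-vanish d (y ∘ suc) (suc e) (ℕ.m≤n⇒m≤1+n d<))) (zeroʳ _))
        (B-vanish d (y ∘ suc) e (ℕ.≤-pred (≡.subst (suc d ≤_) (ℕ.+-suc e e) d<))))
      (+-identityˡ 0#)

  hurwitz-vanish : ∀ d y k e → d ℕ.+ k ≤ e ℕ.+ e → hurwitz d y k e ≈ 0#
  hurwitz-vanish d y zero e le = B-vanish d y e (≡.subst (_≤ e ℕ.+ e) (ℕ.+-identityʳ d) le)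
  hurwitz-vanish d y (suc zero) e le = C-vanish d y e (≡.subst (_≤ e ℕ.+ e) (ℕ.+-comm d 1) le)
  hurwitz-vanish d y (suc (suc k)) zero le = refl
  hurwitz-vanish d y (suc (suc k)) (suc e) le = hurwitz-vanish d y k e
    (ℕ.≤-pred (ℕ.≤-pred (≡.subst₂ _≤_ (≡.trans (ℕ.+-suc d (suc k)) (≡.cong suc (ℕ.+-suc d k))) (≡.cong suc (ℕ.+-suc e e)) le)))

  -- Horner sums and synthetic division

  module Horner (σ : Carrier) where
    -- The sum of q(i + t) σ^t over t < m. Once it reaches past the degree, it is the value of q at
    -- σ for i = 0, and for i + 1 it is the coefficient of s^i in the quotient of q by s - σ.
    horner : ℕ → ℕ → Seq → Carrier
    horner zero i q = 0#
    horner (suc m) i q = q i + σ * horner m (suc i) q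

    horner-+ : ∀ m i (f g : Seq) → horner m i (λ e → f e + g e) ≈ horner m i f + horner m i g
    horner-+ zero i f g = sym (+-identityˡ 0#)
    horner-+ (suc m) i f g = trans (+-congˡ (trans (*-congˡ (horner-+ m (suc i) f g)) (distribˡ _ _ _))) (interchange _ _ _ _)

    horner-* : ∀ m i c (f : Seq) → horner m i (λ e → c * f e) ≈ c * horner m i f
    horner-* zero i c f = sym (zeroʳ c)
    horner-* (suc m) i c f = trans (+-congˡ (trans (*-congˡ (horner-* m (suc i) c f)) (Mul.x∙yz≈y∙xz _ _ _))) (sym (distribˡ _ _ _))

    horner-shift : ∀ m i f → horner m (suc i) (shift f) ≈ horner m i f
    horner-shift zero i f = refl
    horner-shift (suc m) i f = +-congˡ (*-congˡ (horner-shift m (suc i) f))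

    horner-last : ∀ m i q → q (i ℕ.+ m) ≈ 0# → horner (suc m) i q ≈ horner m i q
    horner-last zero i q eq = trans (+-cong (trans (reflexive (≡.cong q (≡.sym (ℕ.+-identityʳ i)))) eq) (zeroʳ σ)) (+-identityˡ 0#)
    horner-last (suc m) i q eq = +-congˡ (*-congˡ (horner-last m (suc i) q (trans (reflexive (≡.cong q (≡.sym (ℕ.+-suc i m)))) eq)))

    timesLinear : Seq → Seq
    timesLinear f e = shift f e - σ * f e

    x-y+y : ∀ x y → (x - y) + y ≈ x
    x-y+y x y = trans (+-assoc _ _ _) (trans (+-congˡ (-‿inverseˡ y)) (+-identityʳ x))

    -- Column operations turn coefficients into Horner partial sums, which is synthetic division by s − σ.
    horner-timesLinear : ∀ m i f → f (i ℕ.+ suc m) ≈ 0# → horner (suc m) (suc i) (timesLinear f) ≈ f i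
    horner-timesLinear zero i f eq = begin
      (f i - σ * f (suc i)) + σ * 0#
        ≈⟨ +-cong (+-congˡ (-‿cong (*-congˡ (trans (reflexive (≡.cong f (ℕ.+-comm 1 i))) eq)))) refl ⟩
      (f i - σ * 0#) + σ * 0# ≈⟨ x-y+y _ _ ⟩
      f i ∎
    horner-timesLinear (suc m) i f eq = trans
      (+-congˡ (*-congˡ (horner-timesLinear m (suc i) f (trans (reflexive (≡.cong f (≡.sym (ℕ.+-suc i (suc m))))) eq))))
      (x-y+y _ _)

    horner-timesLinear-0 : ∀ m f → f m ≈ 0# → horner (suc m) 0 (timesLinear f) ≈ 0#
    horner-timesLinear-0 zero f eq = trans (+-cong (trans (+-congˡ (-‿cong (trans (*-congˡ eq) (zeroʳ σ)))) (-‿inverseʳ 0#)) (zeroʳ σ)) (+-identityˡ 0#)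
    horner-timesLinear-0 (suc m) f eq = trans (+-congˡ (*-congˡ (horner-timesLinear m 0 f eq))) (x-y+y _ _)

    coefficient : ℕ → Seq → Carrier
    coefficient e q = q e

    hornerCols : ℕ → ℕ → List (Seq → Carrier)
    hornerCols zero i = []
    hornerCols (suc m) i = horner (suc m) i ∷ hornerCols m (suc i)

    apply : Seq → (Seq → Carrier) → Carrier
    apply q f = f q

    -- Each Horner column is a coefficient column plus σ times the next Horner column, so the change
    -- of columns is unitriangular. The prefix holds the columns already converted.
    det-hornerCols : ∀ rs pre m i →
      det apply rs (pre ++ hornerCols m i) ≈ det apply rs (pre ++ map coefficient (range i m))
    det-hornerCols rs pre zero i = refl
    det-hornerCols rs pre (suc zero) i = trans
      -- The last Horner column has no successor, so linearity is invoked with the scalar 0 and a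
      -- dummy third column.
      (ColumnLinear.det-linear (horner 1 i) (coefficient i) (coefficient i) 0# apply
        (λ q → +-congˡ (trans (zeroʳ σ) (sym (zeroˡ _)))) rs pre [])
      (trans (+-congˡ (zeroˡ _)) (+-identityʳ _))
    det-hornerCols rs pre (suc (suc m)) i = begin
      det apply rs (pre ++ horner (suc (suc m)) i ∷ h ∷ tl)
        ≈⟨ ColumnLinear.det-linear (horner (suc (suc m)) i) (coefficient i) h σ apply (λ q → refl) rs pre (h ∷ tl) ⟩
      det apply rs (pre ++ coefficient i ∷ h ∷ tl) + σ * det apply rs (pre ++ h ∷ h ∷ tl)
        ≈⟨ trans (+-congˡ (trans (*-congˡ (ColumnAlternating.det-alternating h apply rs pre tl)) (zeroʳ σ))) (+-identityʳ _) ⟩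
      det apply rs (pre ++ coefficient i ∷ h ∷ tl)
        ≈⟨ reflexive (≡.cong (det apply rs) (≡.sym (++-assoc pre (coefficient i ∷ []) (h ∷ tl)))) ⟩
      det apply rs ((pre ++ coefficient i ∷ []) ++ hornerCols (suc m) (suc i))
        ≈⟨ det-hornerCols rs (pre ++ coefficient i ∷ []) (suc m) (suc i) ⟩
      det apply rs ((pre ++ coefficient i ∷ []) ++ map coefficient (range (suc i) (suc m)))
        ≈⟨ reflexive (≡.cong (det apply rs) (++-assoc pre (coefficient i ∷ []) _)) ⟩
      det apply rs (pre ++ map coefficient (range i (suc (suc m)))) ∎
      where h = horner (suc m) (suc i)
            tl = hornerCols m (suc (suc i))

  module _ (x : Carrier) where
    open Horner (x * (1# + x))

    -- At s = x(1 + x) the relation v² = s - v has the solution v = x, which turns C(s) + (1 + v)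
    -- B(s) into the product at v = x. More than d terms certainly exhaust both polynomials.
    horner-product : ∀ d y m → d < m →
      horner m 0 (C-coeff d y) + (1# + x) * horner m 0 (B-coeff d y) ≈ prodF d (λ i → 1# + x + y i)
    horner-product zero y (suc m) _ = begin
      (1# + σ * horner m 1 (C-coeff 0 y)) + (1# + x) * (0# + σ * horner m 1 (B-coeff 0 y))
        ≈⟨ +-cong (+-congˡ (trans (*-congˡ (vanish m 0 (C-coeff 0 y) (λ e → refl))) (zeroʳ σ)))
             (trans (*-congˡ (trans (+-identityˡ _) (trans (*-congˡ (vanish m 0 (B-coeff 0 y) (λ e → refl))) (zeroʳ σ)))) (zeroʳ _)) ⟩
      (1# + 0#) + 0# ≈⟨ trans (+-identityʳ _) (+-identityʳ _) ⟩
      1# ∎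
      where
      σ = x * (1# + x)
      vanish : ∀ m i q → (∀ e → q (suc e) ≈ 0#) → horner m (suc i) q ≈ 0#
      vanish zero i q eq = refl
      vanish (suc m) i q eq = trans (+-cong (eq i) (trans (*-congˡ (vanish m (suc i) q eq)) (zeroʳ σ))) (+-identityˡ 0#)
    horner-product (suc d) y (suc m) (s≤s d<m) = begin
      horner (suc m) 0 (C-coeff (suc d) y) + (1# + x) * horner (suc m) 0 (B-coeff (suc d) y)
        ≈⟨ +-cong
             (trans (horner-+ (suc m) 0 _ _) (+-cong (horner-* (suc m) 0 w γ)
               -- The shift yields the factor σ and uses up one term of the sum; the term missing at
               -- the end has coefficient zero.
               (trans (+-identityˡ _) (*-congˡ (trans (horner-shift m 0 β) (sym (horner-last m 0 β (B-vanish d y′ m (ℕ.≤-trans (ℕ.<⇒≤ d<m) (ℕ.m≤m+n m m))))))))))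
             (*-congˡ (trans (horner-+ (suc m) 0 _ _) (+-congˡ (horner-* (suc m) 0 (1# + w) β)))) ⟩
      (w * hC + (x * (1# + x)) * hB) + (1# + x) * (hC + (1# + w) * hB)
        ≈⟨ solve 4 (λ x w hC hB → (w :* hC :+ (x :* (con 1 :+ x)) :* hB) :+ (con 1 :+ x) :* (hC :+ (con 1 :+ w) :* hB)
             := (con 1 :+ x :+ w) :* (hC :+ (con 1 :+ x) :* hB)) refl x w hC hB ⟩
      (1# + x + w) * (hC + (1# + x) * hB)
        ≈⟨ *-congˡ (horner-product d y′ (suc m) (ℕ.m≤n⇒m≤1+n d<m)) ⟩
      (1# + x + w) * prodF d (λ i → 1# + x + y′ i)
        ≈⟨ prodF-suc d _ ⟨
      prodF (suc d) (λ i → 1# + x + y i) ∎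
      where
      w = y zero
      y′ = y ∘ suc
      γ = C-coeff d y′
      β = B-coeff d y′
      hC = horner (suc m) 0 γ
      hB = horner (suc m) 0 β

  -- Adjoining a variable

  module Step (n : ℕ) (y : Fin (suc (suc n)) → Carrier) where
    w = y zero
    y′ = y ∘ suc
    d = suc n
    open Horner (w * (1# + w))
    P N T : ℕ → Seq
    P = hurwitz d y′
    N = hurwitz (suc d) y
    T k = timesLinear (P k)

    -- As s = v(1 + v), the factors 1, v, s, vs, ... arise by multiplying alternately by v and by 1
    -- + v. Subtracting w, respectively 1 + w, times the preceding factor leaves v - w times that
    -- factor in both cases.
    κ : ℕ → Carrier
    κ zero = w
    κ (suc zero) = 1# + w
    κ (suc (suc k)) = κ k

    -- The difference of the two `N` terms belongs to (v - w) times the k-th factor; the new factor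
    -- 1 + v + w of the product turns v - w into s - w(1 + w).
    N-suc : ∀ k e → N (suc k) e ≈ T k e + κ k * N k e
    N-suc zero e = sym (begin
      (shift β e - σ * β e) + w * (γ e + (1# + w) * β e)
        ≈⟨ +-congˡ (solve 3 (λ w γ β → w :* (γ :+ (con 1 :+ w) :* β) := w :* (con 1 :+ w) :* β :+ w :* γ) refl w (γ e) (β e)) ⟩
      (shift β e - σ * β e) + (σ * β e + w * γ e) ≈⟨ +-assoc _ _ _ ⟨
      ((shift β e - σ * β e) + σ * β e) + w * γ e ≈⟨ +-congʳ (x-y+y _ _) ⟩
      shift β e + w * γ e ≈⟨ +-comm _ _ ⟩
      w * γ e + shift β e ∎)
      where σ = w * (1# + w)
            β = B-coeff d y′
            γ = C-coeff d y′
    N-suc (suc zero) e = sym (begin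
      (shift γ e - σ * γ e) + (1# + w) * (w * γ e + shift β e)
        ≈⟨ +-congˡ (solve 3 (λ w γ β → (con 1 :+ w) :* (w :* γ :+ β) := w :* (con 1 :+ w) :* γ :+ (con 1 :+ w) :* β) refl w (γ e) (shift β e)) ⟩
      (shift γ e - σ * γ e) + (σ * γ e + (1# + w) * shift β e) ≈⟨ +-assoc _ _ _ ⟨
      ((shift γ e - σ * γ e) + σ * γ e) + (1# + w) * shift β e ≈⟨ +-congʳ (x-y+y _ _) ⟩
      shift γ e + (1# + w) * shift β e ≈⟨ shift-lin e ⟩
      shift (B-coeff (suc d) y) e ∎)
      where
      σ = w * (1# + w)
      β = B-coeff d y′
      γ = C-coeff d y′
      shift-lin : ∀ e → shift γ e + (1# + w) * shift β e ≈ shift (B-coeff (suc d) y) e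
      shift-lin zero = trans (+-identityˡ _) (zeroʳ _)
      shift-lin (suc e) = refl
    N-suc (suc (suc k)) zero = sym (trans (+-cong (trans (+-congˡ (-‿cong (zeroʳ _))) (-‿inverseʳ 0#)) (zeroʳ _)) (+-identityˡ 0#))
    N-suc (suc (suc k)) (suc e) = N-suc k e

    at : Seq → ℕ → Carrier
    at q e = q e

    -- Rows are reduced from the bottom upwards, so that each one is reduced against a predecessor
    -- that is still unchanged.
    det-chain : ∀ m k cs → det at (map N (range k (suc m))) cs ≈ det at (N k ∷ map T (range k m)) cs
    det-chain zero k cs = refl
    det-chain (suc m) k cs = trans (pickΣ-cong (λ x xs → *-congˡ (det-chain m (suc k) xs)) cs)
      (det-add-row-multiple at (map T (range (suc k) m)) (N-suc k) cs)

    -- Here d = n + 1, so k < n gives d + k ≤ 2n. The coefficient at n, just beyond the columns of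
    -- the smaller matrix, is the remainder term of the synthetic division.
    P-vanish : ∀ {k} → k < n → P k n ≈ 0#
    P-vanish {k} k<n = hurwitz-vanish d y′ k n (≡.subst (_≤ n ℕ.+ n) (ℕ.+-suc n k) (ℕ.+-monoʳ-≤ n k<n))

    Matching : Seq → Seq → Set a
    Matching f g = ∃[ k ] (k < n) × (f ≡ T k) × (g ≡ P k)

    matching-rows : ∀ i m → i ℕ.+ m ≤ n → Pointwise Matching (map T (range i m)) (map P (range i m))
    matching-rows i zero le = []
    matching-rows i (suc m) le = (i , ℕ.≤-trans (ℕ.m≤m+n (suc i) m) le′ , ≡.refl , ≡.refl) ∷ matching-rows (suc i) m le′
      where le′ = ≡.subst (_≤ n) (ℕ.+-suc i m) le

    matching-cols : ∀ i m → i ℕ.+ m ≡ n →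
      Pointwise (λ f e → ∀ k → k < n → f (T k) ≈ P k e) (hornerCols m (suc i)) (range i m)
    matching-cols i zero eq = []
    matching-cols i (suc m) eq =
      (λ k k<n → horner-timesLinear m i (P k) (trans (reflexive (≡.cong (P k) eq)) (P-vanish k<n)))
      ∷ matching-cols (suc i) m (≡.trans (≡.sym (ℕ.+-suc i m)) eq)

    zero-T : ∀ i m → i ℕ.+ m ≤ n → ∀ {f} → f ∈ map T (range i m) → horner (suc n) 0 f ≈ 0#
    zero-T i (suc m) le (here ≡.refl) = horner-timesLinear-0 n (P i) (P-vanish (ℕ.≤-trans (ℕ.m≤m+n (suc i) m) (≡.subst (_≤ n) (ℕ.+-suc i m) le)))
    zero-T i (suc m) le (there f∈) = zero-T (suc i) m (≡.subst (_≤ n) (ℕ.+-suc i m) le) f∈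

    -- In Horner columns the first column is evaluation at σ, which kills every row divisible by s -
    -- σ and leaves a single entry. In its minor the remaining columns read off quotients by s - σ,
    -- which are the rows for `y′`.
    det-step : det at (map N (range 0 (suc n))) (range 0 (suc n)) ≈
      prodF d (λ i → 1# + w + y′ i) * det at (map P (range 0 n)) (range 0 n)
    det-step = begin
      det at (map N (range 0 (suc n))) (range 0 (suc n)) ≈⟨ det-chain n 0 (range 0 (suc n)) ⟩
      det at (N 0 ∷ Ts) (range 0 (suc n)) ≈⟨ det-map-cols apply coefficient (N 0 ∷ Ts) (range 0 (suc n)) ⟨
      det apply (N 0 ∷ Ts) (map coefficient (range 0 (suc n))) ≈⟨ det-hornerCols (N 0 ∷ Ts) [] (suc n) 0 ⟨
      det apply (N 0 ∷ Ts) (horner (suc n) 0 ∷ hornerCols n 1)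
        ≈⟨ -‿cong₂ (*-congˡ (det-Pointwise (λ {_} {_} {c} {e} → matching-entry c e) (matching-rows 0 n ℕ.≤-refl) (matching-cols 0 n ≡.refl)))
             (pickΣ-vanish (λ x xs → trans (*-congˡ (det-zero-column apply (horner (suc n) 0) Ts (zero-T 0 n ℕ.≤-refl) xs)) (zeroʳ _)) (hornerCols n 1)) ⟩
      horner (suc n) 0 (N 0) * D - 0# ≈⟨ trans (+-congˡ -0#≈0#) (+-identityʳ _) ⟩
      horner (suc n) 0 (N 0) * D ≈⟨ *-congʳ evaluate ⟩
      prodF d (λ i → 1# + w + y′ i) * D ∎
      where
      Ts = map T (range 0 n)
      D = det at (map P (range 0 n)) (range 0 n)
      matching-entry : ∀ c e {f g} → Matching f g → (∀ k → k < n → c (T k) ≈ P k e) → apply f c ≈ at g e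
      matching-entry c e (k , k<n , ≡.refl , ≡.refl) eq = eq k k<n
      evaluate : horner d 0 (N 0) ≈ prodF d (λ i → 1# + w + y′ i)
      evaluate = begin
        -- `horner-product` asks for more terms than there are variables; the coefficient appended
        -- here is zero.
        horner d 0 (N 0) ≈⟨ horner-last d 0 (N 0) (hurwitz-vanish (suc d) y 0 d (s≤s (≡.subst (_≤ n ℕ.+ d) (≡.sym (ℕ.+-identityʳ d)) (ℕ.m≤n+m d n)))) ⟨
        horner (suc d) 0 (N 0) ≈⟨ trans (horner-+ (suc d) 0 _ _) (+-congˡ (horner-* (suc d) 0 _ _)) ⟩
        _ ≈⟨ horner-product w d y′ (suc d) ℕ.≤-refl ⟩
        prodF d (λ i → 1# + w + y′ i) ∎

  det-hurwitz : ∀ n (y : Fin (suc n) → Carrier) →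
    det (hurwitz (suc n) y) (range 0 n) (range 0 n) ≈ pairProduct (suc n) y
  det-hurwitz zero y = sym (*-identityˡ 1#)
  det-hurwitz (suc n) y = begin
    det (hurwitz (suc (suc n)) y) (range 0 (suc n)) (range 0 (suc n))
      ≈⟨ det-map-rows at (hurwitz (suc (suc n)) y) (range 0 (suc n)) (range 0 (suc n)) ⟨
    det at (map N (range 0 (suc n))) (range 0 (suc n)) ≈⟨ det-step ⟩
    prodF (suc n) (λ i → 1# + w + y′ i) * det at (map P (range 0 n)) (range 0 n)
      ≈⟨ *-congˡ (trans (det-map-rows at P (range 0 n) (range 0 n)) (det-hurwitz n y′)) ⟩
    pairProduct (suc (suc n)) y ∎
    where open Step n y

-- The generating function of oriented graphs

allF-suc : ∀ n (p : Fin (suc n) → Bool) → allF (suc n) p ≡ p zero ∧ allF n (p ∘ suc)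
allF-suc n p = ≡.cong (foldr _∧_ true) (allFin-map-suc n p)

allF-cong : ∀ n {p q : Fin n → Bool} → (∀ i → p i ≡ q i) → allF n p ≡ allF n q
allF-cong zero eq = ≡.refl
allF-cong (suc n) {p} {q} eq = ≡.trans (allF-suc n p)
  (≡.trans (≡.cong₂ _∧_ (eq zero) (allF-cong n (eq ∘ suc))) (≡.sym (allF-suc n q)))

∧-interchange : ∀ a b c d → (a ∧ b) ∧ (c ∧ d) ≡ (a ∧ c) ∧ (b ∧ d)
∧-interchange true true c d = ≡.refl
∧-interchange true false true d = ≡.refl
∧-interchange true false false d = ≡.refl
∧-interchange false b c d = ≡.refl

allF-∧ : ∀ n (p q : Fin n → Bool) → allF n (λ i → p i ∧ q i) ≡ allF n p ∧ allF n q
allF-∧ zero p q = ≡.refl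
allF-∧ (suc n) p q = ≡.trans (allF-suc n (λ i → p i ∧ q i)) (≡.trans (≡.cong ((p zero ∧ q zero) ∧_) (allF-∧ n (p ∘ suc) (q ∘ suc)))
  (≡.trans (∧-interchange (p zero) (q zero) _ _) (≡.sym (≡.cong₂ _∧_ (allF-suc n p) (allF-suc n q)))))

minor : ∀ {d} → Digraph (suc d) → Digraph d
minor g i j = g (suc i) (suc j)

-- The tests of (0, i) and of (i, 0) are the same condition, so the first row and the first column
-- of tests merge into one.
isDSG-suc : ∀ d (g : Digraph (suc d)) →
  isDSG (suc d) g ≡ not (g zero zero) ∧ (allF d (λ i → not (g zero (suc i) ∧ g (suc i) zero)) ∧ isDSG d (minor g))
isDSG-suc d g = begin
  isDSG (suc d) g
    ≡⟨ ≡.cong₂ _∧_ (allF-suc d (λ i → not (g i i)))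
         (≡.trans (allF-suc d (λ i → allF (suc d) (compatible i))) (≡.cong₂ _∧_ (allF-suc d (compatible zero))
           (≡.trans (allF-cong d (λ i → allF-suc d (compatible (suc i))))
             (≡.trans (allF-∧ d (λ i → compatible (suc i) zero) (λ i → allF d (compatible (suc i) ∘ suc)))
               (≡.cong (_∧ pairs) (allF-cong d (λ i → ≡.cong not (∧-comm (g (suc i) zero) (g zero (suc i)))))))))) ⟩
  (not b ∧ loops) ∧ ((not (b ∧ b) ∧ zs) ∧ (zs ∧ pairs)) ≡⟨ simplify b loops zs pairs ⟩
  not b ∧ (zs ∧ (loops ∧ pairs)) ∎
  where
  open ≡.≡-Reasoning
  compatible : Fin (suc d) → Fin (suc d) → Bool
  compatible i j = not (g i j ∧ g j i)
  b = g zero zero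
  loops = allF d (λ i → not (g (suc i) (suc i)))
  zs = allF d (λ i → not (g zero (suc i) ∧ g (suc i) zero))
  pairs = allF d (λ i → allF d (λ j → not (g (suc i) (suc j) ∧ g (suc j) (suc i))))
  simplify : ∀ b x y z → (not b ∧ x) ∧ ((not (b ∧ b) ∧ y) ∧ (y ∧ z)) ≡ not b ∧ (y ∧ (x ∧ z))
  simplify true x y z = ≡.refl
  simplify false true true z = ≡.refl
  simplify false true false z = ≡.refl
  simplify false false true z = ≡.refl
  simplify false false false z = ≡.refl

module Digraphs {a ℓ} (R : CommutativeRing a ℓ) where
  open CommutativeRing R hiding (zero)
  open InRing R using (prodF; weight)
  open Sums R
  open Hurwitz R using (pairProduct)
  open SetoidReasoning setoid
  open Solver commutativeSemiring using (solve; _:+_; _:*_; _:=_; con)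

  optional : Bool → Carrier → Carrier
  optional b x = if b then x else 1#

  -- A 2-cycle gets weight zero, so the four settings of a pair of opposite edges add up to 1 + u +
  -- v.
  pairWeight : Carrier → Carrier → Bool → Bool → Carrier
  pairWeight u v b c = [ not (b ∧ c) ]? (optional b u * optional c v)

  dsgWeight : (d : ℕ) → (Fin d → Carrier) → Digraph d → Carrier
  dsgWeight zero y g = 1#
  dsgWeight (suc d) y g =
    ([ not (g zero zero) ]? 1# * prodF d (λ i → pairWeight (y zero) (y (suc i)) (g zero (suc i)) (g (suc i) zero)))
    * dsgWeight d (y ∘ suc) (minor g)

  []?-∧ : ∀ b c x y → [ b ∧ c ]? (x * y) ≈ [ b ]? x * [ c ]? y
  []?-∧ true c x y = sym ([]?-* c x y)
  []?-∧ false c x y = sym (zeroˡ _)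

  []?-allF : ∀ n (p : Fin n → Bool) (f : Fin n → Carrier) → [ allF n p ]? (prodF n f) ≈ prodF n (λ i → [ p i ]? (f i))
  []?-allF zero p f = refl
  []?-allF (suc n) p f = begin
    [ allF (suc n) p ]? (prodF (suc n) f)
      ≈⟨ trans (reflexive (≡.cong (λ b → [ b ]? _) (allF-suc n p))) ([]?-cong (p zero ∧ allF n (p ∘ suc)) (prodF-suc n f)) ⟩
    [ p zero ∧ allF n (p ∘ suc) ]? (f zero * prodF n (f ∘ suc)) ≈⟨ []?-∧ (p zero) _ _ _ ⟩
    [ p zero ]? (f zero) * [ allF n (p ∘ suc) ]? (prodF n (f ∘ suc)) ≈⟨ *-congˡ ([]?-allF n (p ∘ suc) (f ∘ suc)) ⟩
    [ p zero ]? (f zero) * prodF n (λ i → [ p (suc i) ]? (f (suc i))) ≈⟨ prodF-suc n _ ⟨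
    prodF (suc n) (λ i → [ p i ]? (f i)) ∎

  weight-suc : ∀ d y (g : Digraph (suc d)) → weight (suc d) y g ≈
    optional (g zero zero) (y zero)
    * (prodF d (λ i → optional (g zero (suc i)) (y zero) * optional (g (suc i) zero) (y (suc i)))
      * weight d (y ∘ suc) (minor g))
  weight-suc d y g = begin
    weight (suc d) y g
      ≈⟨ trans (prodF-suc d _) (*-cong (prodF-suc d _) (trans (prodF-cong d (λ i → prodF-suc d _)) (prodF-* d _ _))) ⟩
    (_ * _) * (_ * _)
      ≈⟨ trans (*-assoc _ _ _) (*-congˡ (trans (sym (*-assoc _ _ _)) (*-congʳ (sym (prodF-* d _ _))))) ⟩
    _ ∎

  dsgWeight-weight : ∀ d y g → [ isDSG d g ]? (weight d y g) ≈ dsgWeight d y g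
  dsgWeight-weight zero y g = refl
  dsgWeight-weight (suc d) y g = begin
    [ isDSG (suc d) g ]? (weight (suc d) y g)
      ≈⟨ trans (reflexive (≡.cong (λ b → [ b ]? (weight (suc d) y g)) (isDSG-suc d g))) ([]?-cong (not b ∧ (zs ∧ isDSG d (minor g))) (weight-suc d y g)) ⟩
    [ not b ∧ (zs ∧ isDSG d (minor g)) ]? (optional b (y zero) * (P * weight d (y ∘ suc) (minor g)))
      ≈⟨ trans ([]?-∧ (not b) _ _ _) (*-congˡ ([]?-∧ zs _ _ _)) ⟩
    [ not b ]? (optional b (y zero)) * ([ zs ]? P * [ isDSG d (minor g) ]? (weight d (y ∘ suc) (minor g)))
      ≈⟨ *-cong (loopless b) (*-cong ([]?-allF d _ _) (dsgWeight-weight d (y ∘ suc) (minor g))) ⟩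
    [ not b ]? 1# * (_ * dsgWeight d (y ∘ suc) (minor g)) ≈⟨ *-assoc _ _ _ ⟨
    dsgWeight (suc d) y g ∎
    where
    b = g zero zero
    zs = allF d (λ i → not (g zero (suc i) ∧ g (suc i) zero))
    P = prodF d (λ i → optional (g zero (suc i)) (y zero) * optional (g (suc i) zero) (y (suc i)))
    loopless : ∀ b → [ not b ]? (optional b (y zero)) ≈ [ not b ]? 1#
    loopless true = refl
    loopless false = refl

  dsgWeight-ext : ∀ d y {g h : Digraph d} → (∀ i j → g i j ≡ h i j) → dsgWeight d y g ≈ dsgWeight d y h
  dsgWeight-ext zero y eq = refl
  dsgWeight-ext (suc d) y eq = *-cong
    (*-cong (reflexive (≡.cong (λ b → [ not b ]? 1#) (eq zero zero)))
      (prodF-cong d (λ i → reflexive (≡.cong₂ (pairWeight _ _) (eq zero (suc i)) (eq (suc i) zero)))))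
    (dsgWeight-ext d (y ∘ suc) (λ i j → eq (suc i) (suc j)))

  Σ-bools : (φ : Bool → Carrier) → Σ[ bools ] φ ≈ φ false + φ true
  Σ-bools φ = +-congˡ (+-identityʳ _)

  Σ-allFns-prodF : ∀ n (ψ : Fin n → Bool → Carrier) →
    Σ[ allFns bools n ] (λ r → prodF n (λ i → ψ i (r i))) ≈ prodF n (λ i → ψ i false + ψ i true)
  Σ-allFns-prodF zero ψ = +-identityʳ 1#
  Σ-allFns-prodF (suc n) ψ = begin
    _ ≈⟨ Σ-allFns bools n (λ b r → ψ zero b * prodF n (λ i → ψ (suc i) (r i))) (λ r → prodF-suc n _) ⟩
    _ ≈⟨ Σ-cong bools (λ b → trans (Σ-*ˡ (allFns bools n) (ψ zero b) _) (*-congˡ (Σ-allFns-prodF n (ψ ∘ suc)))) ⟩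
    _ ≈⟨ trans (Σ-*ʳ bools _ (ψ zero)) (*-congʳ (Σ-bools (ψ zero))) ⟩
    _ ≈⟨ prodF-suc n _ ⟨
    _ ∎

  -- With the row of vertex 0 fixed, the edges into vertex 0 vary independently of the remaining
  -- graph. `ext` takes the place of function extensionality: splitting off a row gives a matrix
  -- that is only pointwise equal to the original one.
  Σ-first-column : ∀ m n (φ : Fin n → Bool → Carrier) (G : (Fin n → Fin m → Bool) → Carrier) →
    (∀ {g h} → (∀ i j → g i j ≡ h i j) → G g ≈ G h) →
    Σ[ allFns (allFns bools (suc m)) n ] (λ g → prodF n (λ i → φ i (g i zero)) * G (λ i j → g i (suc j)))
    ≈ prodF n (λ i → φ i false + φ i true) * Σ[ allFns (allFns bools m) n ] G
  Σ-first-column m zero φ G ext = trans (+-identityʳ _) (*-congˡ (trans (ext (λ ())) (sym (+-identityʳ _))))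
  Σ-first-column m (suc n) φ G ext = begin
    _ ≈⟨ Σ-allFns (allFns bools (suc m)) n
           (λ r g → (φ zero (r zero) * prodF n (λ i → φ (suc i) (g i zero))) * G ((r ∘ suc) Vector.∷ (λ i j → g i (suc j))))
           (λ g → *-cong (prodF-suc n _) (ext (λ { zero j → ≡.refl ; (suc i) j → ≡.refl }))) ⟩
    _ ≈⟨ Σ-cong (allFns bools (suc m)) (λ r → trans (Σ-cong (allFns (allFns bools (suc m)) n) (λ g → *-assoc _ _ _))
           (trans (Σ-*ˡ (allFns (allFns bools (suc m)) n) _ _) (*-congˡ (Σ-first-column m n (φ ∘ suc) (λ h → G ((r ∘ suc) Vector.∷ h))
             (λ eq → ext (λ { zero j → ≡.refl ; (suc i) j → eq i j })))))) ⟩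
    _ ≈⟨ Σ-allFns bools m (λ b r → φ zero b * (P * Σ[ allFns (allFns bools m) n ] (λ h → G (r Vector.∷ h)))) (λ r → refl) ⟩
    _ ≈⟨ Σ-cong bools (λ b → trans (Σ-*ˡ (allFns bools m) (φ zero b) _) (*-congˡ (Σ-*ˡ (allFns bools m) P (λ r → Σ[ allFns (allFns bools m) n ] (λ h → G (r Vector.∷ h)))))) ⟩
    _ ≈⟨ trans (Σ-*ʳ bools (P * Σ[ allFns bools m ] (λ r → Σ[ allFns (allFns bools m) n ] (λ h → G (r Vector.∷ h)))) (φ zero)) (*-congʳ (Σ-bools (φ zero))) ⟩
    (φ zero false + φ zero true) * (P * Σ[ allFns bools m ] (λ r → Σ[ allFns (allFns bools m) n ] (λ h → G (r Vector.∷ h))))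
      ≈⟨ *-assoc _ _ _ ⟨
    ((φ zero false + φ zero true) * P) * _
      ≈⟨ *-cong (sym (prodF-suc n _)) (sym (Σ-allFns (allFns bools m) n (λ r h → G (r Vector.∷ h))
           (λ g → ext (λ { zero j → ≡.refl ; (suc i) j → ≡.refl })))) ⟩
    prodF (suc n) (λ i → φ i false + φ i true) * Σ[ allFns (allFns bools m) (suc n) ] G ∎
    where P = prodF n (λ i → φ (suc i) false + φ (suc i) true)

  Σ-dsgWeight : ∀ d y → Σ[ allFns (allFns bools d) d ] (dsgWeight d y) ≈ pairProduct d y
  Σ-dsgWeight zero y = +-identityʳ 1#
  Σ-dsgWeight (suc d) y = begin
    _ ≈⟨ Σ-allFns rows d (λ r g → ([ not (r zero) ]? 1# * prodF d (λ i → pw i (r (suc i)) (g i zero))) * dsgWeight d (y ∘ suc) (λ i j → g i (suc j)))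
          (λ g → refl) ⟩
    _ ≈⟨ Σ-cong rows (λ r → trans (Σ-cong (allFns rows d) (λ g → *-assoc _ _ _)) (trans (Σ-*ˡ (allFns rows d) _ _)
          (*-congˡ (Σ-first-column d d (λ i → pw i (r (suc i))) (dsgWeight d (y ∘ suc)) (dsgWeight-ext d (y ∘ suc)))))) ⟩
    _ ≈⟨ Σ-allFns bools d (λ b r → [ not b ]? 1# * (prodF d (λ i → pw i (r i) false + pw i (r i) true) * D)) (λ r → refl) ⟩
    _ ≈⟨ Σ-cong bools (λ b → trans (Σ-*ˡ (allFns bools d) ([ not b ]? 1#) (λ r → S r * D)) (*-congˡ (Σ-*ʳ (allFns bools d) D S))) ⟩
    _ ≈⟨ trans (Σ-*ʳ bools (Σ[ allFns bools d ] S * D) (λ b → [ not b ]? 1#)) (trans (*-congʳ (trans (Σ-bools (λ b → [ not b ]? 1#)) (+-identityʳ 1#))) (*-identityˡ _)) ⟩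
    Σ[ allFns bools d ] S * D
      ≈⟨ *-cong (trans (Σ-allFns-prodF d (λ i b → pw i b false + pw i b true)) (prodF-cong d (λ i → total (y zero) (y (suc i))))) (Σ-dsgWeight d (y ∘ suc)) ⟩
    pairProduct (suc d) y ∎
    where
    rows = allFns bools (suc d)
    pw = λ i → pairWeight (y zero) (y (suc i))
    S : (Fin d → Bool) → Carrier
    S r = prodF d (λ i → pw i (r i) false + pw i (r i) true)
    D = Σ[ allFns (allFns bools d) d ] (dsgWeight d (y ∘ suc))
    total : ∀ u v → (1# * 1# + 1# * v) + (u * 1# + 0#) ≈ 1# + u + v
    total = solve 2 (λ u v → (con 1 :* con 1 :+ con 1 :* v) :+ (u :* con 1 :+ con 0) := con 1 :+ u :+ v) refl

  Σ-DSG : ∀ d y → Σ[ DSG d ] (weight d y) ≈ pairProduct d y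
  Σ-DSG d y = trans (Σ-filterᵇ (isDSG d) (allFns (allFns bools d) d) (weight d y)) (trans (Σ-cong (allFns (allFns bools d) d) (dsgWeight-weight d y)) (Σ-dsgWeight d y))

-- Counting lattice paths

≟P-sound : ∀ p q → (p ≟P q) ≡ true → p ≡ q
≟P-sound p q eq with ≡-dec ℤ._≟_ ℤ._≟_ p q
... | yes p≡q = p≡q

≟P-refl : ∀ p → (p ≟P p) ≡ true
≟P-refl p with ≡-dec ℤ._≟_ ℤ._≟_ p p
... | yes _ = ≡.refl
... | no p≢p = contradiction ≡.refl p≢p

≟P-false : ∀ {p q} → p ≢ q → (p ≟P q) ≡ false
≟P-false {p} {q} p≢q with ≡-dec ℤ._≟_ ℤ._≟_ p q
... | yes p≡q = contradiction p≡q p≢q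
... | no _ = ≡.refl

infix 4 _≟ℤ_

_≟ℤ_ : ℤ → ℤ → Bool
i ≟ℤ j = ⌊ i ℤ.≟ j ⌋

≟ℤ-sound : ∀ i j → (i ≟ℤ j) ≡ true → i ≡ j
≟ℤ-sound i j eq with i ℤ.≟ j
... | yes i≡j = i≡j

≟ℤ-refl : ∀ i → (i ≟ℤ i) ≡ true
≟ℤ-refl i with i ℤ.≟ i
... | yes _ = ≡.refl
... | no i≢i = contradiction ≡.refl i≢i

≟ℤ-false : ∀ {i j} → i ≢ j → (i ≟ℤ j) ≡ false
≟ℤ-false {i} {j} i≢j with i ℤ.≟ j
... | yes i≡j = contradiction i≡j i≢j
... | no _ = ≡.refl

bool-ext : ∀ {b c} → (b ≡ true → c ≡ true) → (c ≡ true → b ≡ true) → b ≡ c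
bool-ext {true} {c} f g = ≡.sym (f ≡.refl)
bool-ext {false} {true} f g = g ≡.refl
bool-ext {false} {false} f g = ≡.refl

step-y : ∀ p b → proj₂ (step p b) ≡ proj₂ p ℤ.+ + 1
step-y p false = ≡.refl
step-y p true = ≡.refl

height : Point → Point → ℤ
height p t = proj₂ t ℤ.- proj₂ p

height-step : ∀ p b t → height (step p b) t ≡ height p t ℤ.- + 1
height-step (x , y) false (x′ , y′) = solve 2 (λ y y′ → y′ :- (y :+ con (+ 1)) := (y′ :- y) :- con (+ 1)) ≡.refl y y′
  where open +-*-Solver
height-step (x , y) true (x′ , y′) = solve 2 (λ y y′ → y′ :- (y :+ con (+ 1)) := (y′ :- y) :- con (+ 1)) ≡.refl y y′
  where open +-*-Solver

height-endpoint : ∀ p bs t → endpoint p bs ≡ t → height p t ≡ + length bs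
height-endpoint p [] t ≡.refl = ℤ.+-inverseʳ (proj₂ p)
height-endpoint p (b ∷ bs) t eq = begin
  height p t ≡⟨ solve 1 (λ h → h := (h :- con (+ 1)) :+ con (+ 1)) ≡.refl (height p t) ⟩
  (height p t ℤ.- + 1) ℤ.+ + 1 ≡⟨ ≡.cong (ℤ._+ + 1) (≡.trans (≡.sym (height-step p b t)) (height-endpoint (step p b) bs t eq)) ⟩
  + length bs ℤ.+ + 1 ≡⟨ ℤ.+-comm (+ length bs) (+ 1) ⟩
  + length (b ∷ bs) ∎
  where
  open ≡.≡-Reasoning
  open +-*-Solver

module Paths {a ℓ} (R : CommutativeRing a ℓ) where
  open CommutativeRing R hiding (zero)
  open Sums R
  open SetoidReasoning setoid

  Σ-pathsTo : ∀ p t (φ : List Bool → Carrier) →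
    Σ[ pathsTo p t ] φ ≈ Σ[ allBoolLists ℤ.∣ height p t ∣ ] (λ bs → [ endpoint p bs ≟P t ]? (φ bs))
  Σ-pathsTo p t φ = Σ-filterᵇ (λ bs → endpoint p bs ≟P t) (allBoolLists ℤ.∣ height p t ∣) φ

  Σ-allBoolLists : ∀ m (φ : List Bool → Carrier) →
    Σ[ allBoolLists (suc m) ] φ ≈ Σ[ allBoolLists m ] (φ ∘ (false ∷_)) + Σ[ allBoolLists m ] (φ ∘ (true ∷_))
  Σ-allBoolLists m φ = trans (Σ-concatMap (λ b → map (b ∷_) (allBoolLists m)) bools φ)
    (+-cong (reflexive (Σ-map (false ∷_) (allBoolLists m) φ))
      (trans (+-identityʳ _) (reflexive (Σ-map (true ∷_) (allBoolLists m) φ))))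

  -- Because `pathsTo` uses the absolute value of the height, step sequences are listed even for a
  -- target below the start; the endpoint filter rejects them all.
  Σ-pathsTo-below : ∀ p t {m} φ → height p t ≡ -[1+ m ] → Σ[ pathsTo p t ] φ ≈ 0#
  Σ-pathsTo-below p t φ eq = trans (Σ-pathsTo p t φ) (Σ-vanish (allBoolLists ℤ.∣ height p t ∣) (λ bs →
    reflexive (≡.cong (λ b → [ b ]? (φ bs)) (≟P-false (λ end → absurd (≡.trans (≡.sym eq) (height-endpoint p bs t end)))))))
    where
    absurd : ∀ {m n} → ¬ (-[1+ m ] ≡ + n)
    absurd ()

  -- Decomposition by the first step, valid wherever t lies. At height 0 both continuations start
  -- above the target and contribute nothing; at positive height the empty path is rejected; at
  -- negative height every term is zero.
  Σ-pathsTo-step : ∀ p t φ → Σ[ pathsTo p t ] φ ≈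
    [ p ≟P t ]? (φ []) + (Σ[ pathsTo (step p false) t ] (φ ∘ (false ∷_)) + Σ[ pathsTo (step p true) t ] (φ ∘ (true ∷_)))
  Σ-pathsTo-step p t φ = by-height (height p t) ≡.refl
    where
    by-height : ∀ h → height p t ≡ h → Σ[ pathsTo p t ] φ ≈
      [ p ≟P t ]? (φ []) + (Σ[ pathsTo (step p false) t ] (φ ∘ (false ∷_)) + Σ[ pathsTo (step p true) t ] (φ ∘ (true ∷_)))
    by-height (+ zero) eq = begin
      Σ[ pathsTo p t ] φ ≈⟨ Σ-pathsTo p t φ ⟩
      Σ[ allBoolLists ℤ.∣ height p t ∣ ] (λ bs → [ endpoint p bs ≟P t ]? (φ bs))
        ≈⟨ reflexive (≡.cong (λ h → Σ[ allBoolLists ℤ.∣ h ∣ ] (λ bs → [ endpoint p bs ≟P t ]? (φ bs))) eq) ⟩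
      [ p ≟P t ]? (φ []) + 0#
        ≈⟨ +-congˡ (trans (+-cong (below false) (below true)) (+-identityˡ 0#)) ⟨
      _ ∎
      where
      below : ∀ b → Σ[ pathsTo (step p b) t ] (φ ∘ (b ∷_)) ≈ 0#
      below b = Σ-pathsTo-below (step p b) t _ (≡.trans (height-step p b t) (≡.cong (ℤ._- + 1) eq))
    by-height (+ suc m) eq = begin
      Σ[ pathsTo p t ] φ ≈⟨ Σ-pathsTo p t φ ⟩
      Σ[ allBoolLists ℤ.∣ height p t ∣ ] (λ bs → [ endpoint p bs ≟P t ]? (φ bs))
        ≈⟨ reflexive (≡.cong (λ h → Σ[ allBoolLists ℤ.∣ h ∣ ] (λ bs → [ endpoint p bs ≟P t ]? (φ bs))) eq) ⟩
      Σ[ allBoolLists (suc m) ] (λ bs → [ endpoint p bs ≟P t ]? (φ bs))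
        ≈⟨ Σ-allBoolLists m (λ bs → [ endpoint p bs ≟P t ]? (φ bs)) ⟩
      _ ≈⟨ +-cong (level false) (level true) ⟨
      Σ[ pathsTo (step p false) t ] (φ ∘ (false ∷_)) + Σ[ pathsTo (step p true) t ] (φ ∘ (true ∷_))
        ≈⟨ +-identityˡ _ ⟨
      0# + _ ≈⟨ +-congʳ (reflexive (≡.cong (λ b → [ b ]? (φ [])) (≡.sym (≟P-false p≢t)))) ⟩
      _ ∎
      where
      p≢t : p ≢ t
      p≢t p≡t with ≡.trans (≡.sym eq) (height-endpoint p [] t p≡t)
      ... | ()
      level : ∀ b → Σ[ pathsTo (step p b) t ] (φ ∘ (b ∷_)) ≈
        Σ[ allBoolLists m ] (λ bs → [ endpoint (step p b) bs ≟P t ]? (φ (b ∷ bs)))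
      level b = trans (Σ-pathsTo (step p b) t (φ ∘ (b ∷_)))
        (reflexive (≡.cong (λ h → Σ[ allBoolLists ℤ.∣ h ∣ ] (λ bs → [ endpoint (step p b) bs ≟P t ]? (φ (b ∷ bs))))
          (≡.trans (height-step p b t) (≡.cong (ℤ._- + 1) eq))))
    by-height -[1+ m ] eq = begin
      Σ[ pathsTo p t ] φ ≈⟨ Σ-pathsTo-below p t φ eq ⟩
      0# ≈⟨ trans (+-identityˡ _) (+-identityˡ 0#) ⟨
      0# + (0# + 0#) ≈⟨ +-cong (reflexive (≡.cong (λ b → [ b ]? (φ [])) (≡.sym (≟P-false p≢t)))) (sym (+-cong (below false) (below true))) ⟩
      _ ∎
      where
      p≢t : p ≢ t
      p≢t p≡t with ≡.trans (≡.sym eq) (height-endpoint p [] t p≡t)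
      ... | ()
      below : ∀ b → Σ[ pathsTo (step p b) t ] (φ ∘ (b ∷_)) ≈ 0#
      below b = Σ-pathsTo-below (step p b) t _ (≡.trans (height-step p b t) (≡.cong (ℤ._- + 1) eq))

  pathCount : Point → Point → Carrier
  pathCount p t = Σ[ pathsTo p t ] (λ _ → 1#)

  pascal : ℕ → ℤ → Carrier
  pascal zero δ = [ δ ≟ℤ + 0 ]? 1#
  pascal (suc h) δ = pascal h δ + pascal h (δ ℤ.- + 1)

  binomial : ℤ → ℤ → Carrier
  binomial δ (+ h) = pascal h δ
  binomial δ -[1+ h ] = 0#

  pathCount-binomial : ∀ p t → pathCount p t ≈ binomial (proj₁ t ℤ.- proj₁ p) (height p t)
  pathCount-binomial p t = by-height (height p t) p t ≡.refl
    where
    by-height : ∀ h p t → height p t ≡ h → pathCount p t ≈ binomial (proj₁ t ℤ.- proj₁ p) h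
    by-height -[1+ m ] p t eq = Σ-pathsTo-below p t _ eq
    by-height (+ zero) p t eq = begin
      pathCount p t ≈⟨ Σ-pathsTo-step p t _ ⟩
      [ p ≟P t ]? 1# + (pathCount (step p false) t + pathCount (step p true) t)
        ≈⟨ +-congˡ (trans (+-cong (below false) (below true)) (+-identityˡ 0#)) ⟩
      [ p ≟P t ]? 1# + 0# ≈⟨ +-identityʳ _ ⟩
      [ p ≟P t ]? 1# ≈⟨ reflexive (≡.cong (λ b → [ b ]? 1#) (bool-ext to from)) ⟩
      [ (proj₁ t ℤ.- proj₁ p) ≟ℤ + 0 ]? 1# ∎
      where
      below : ∀ b → pathCount (step p b) t ≈ 0#
      below b = Σ-pathsTo-below (step p b) t _ (≡.trans (height-step p b t) (≡.cong (ℤ._- + 1) eq))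
      to : (p ≟P t) ≡ true → ((proj₁ t ℤ.- proj₁ p) ≟ℤ + 0) ≡ true
      to e with ≟P-sound p t e
      ... | ≡.refl = ≡.trans (≡.cong (_≟ℤ + 0) (ℤ.+-inverseʳ (proj₁ p))) (≟ℤ-refl (+ 0))
      from : ((proj₁ t ℤ.- proj₁ p) ≟ℤ + 0) ≡ true → (p ≟P t) ≡ true
      from e = ≡.trans (≡.cong (p ≟P_) (≡.sym (≡.cong₂ _,_
        (≡.sym (ℤ.i-j≡0⇒i≡j _ _ (≟ℤ-sound _ _ e))) (≡.sym (ℤ.i-j≡0⇒i≡j _ _ eq))))) (≟P-refl p)
    by-height (+ suc m) p t eq = begin
      pathCount p t ≈⟨ Σ-pathsTo-step p t _ ⟩
      [ p ≟P t ]? 1# + (pathCount (step p false) t + pathCount (step p true) t)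
        ≈⟨ +-cong (reflexive (≡.cong (λ b → [ b ]? 1#) (≟P-false p≢t)))
             (+-cong (by-height (+ m) (step p false) t (level false)) (by-height (+ m) (step p true) t (level true))) ⟩
      0# + (pascal m (proj₁ t ℤ.- proj₁ p) + pascal m (proj₁ t ℤ.- (proj₁ p ℤ.+ + 1))) ≈⟨ +-identityˡ _ ⟩
      _ ≈⟨ +-congˡ (reflexive (≡.cong (pascal m) (solve 2 (λ x x′ → x′ :- (x :+ con (+ 1)) := (x′ :- x) :- con (+ 1)) ≡.refl (proj₁ p) (proj₁ t)))) ⟩
      _ ∎
      where
      open +-*-Solver
      p≢t : p ≢ t
      p≢t p≡t with ≡.trans (≡.sym eq) (height-endpoint p [] t p≡t)
      ... | ()
      level : ∀ b → height (step p b) t ≡ + m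
      level b = ≡.trans (height-step p b t) (≡.cong (ℤ._- + 1) eq)

  pascal-negative : ∀ h m → pascal h -[1+ m ] ≈ 0#
  pascal-negative zero m = refl
  pascal-negative (suc h) m = trans (+-cong (pascal-negative h m) (pascal-negative h _)) (+-identityˡ 0#)

  binomial-negative : ∀ h m → binomial -[1+ m ] h ≈ 0#
  binomial-negative (+ h) m = pascal-negative h m
  binomial-negative -[1+ h ] m = refl

  -- Pascal's rule for all integers. With the value 0 for negative h it fails only at δ = h = 0,
  -- which the indicator corrects; this correction is what the jumps account for.
  binomial-step : ∀ δ h → binomial δ h ≈
    ([ (δ ≟ℤ + 0) ∧ (h ≟ℤ + 0) ]? 1# + binomial (δ ℤ.- + 1) (h ℤ.- + 1)) + binomial δ (h ℤ.- + 1)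
  binomial-step δ (+ zero) with δ ≟ℤ + 0
  ... | true = sym (trans (+-identityʳ _) (+-identityʳ _))
  ... | false = sym (trans (+-identityʳ _) (+-identityʳ _))
  binomial-step δ (+ suc h) with δ ≟ℤ + 0
  ... | true = trans (+-comm _ _) (+-congʳ (sym (+-identityˡ _)))
  ... | false = trans (+-comm _ _) (+-congʳ (sym (+-identityˡ _)))
  binomial-step δ -[1+ h ] with δ ≟ℤ + 0
  ... | true = sym (trans (+-identityʳ _) (+-identityʳ _))
  ... | false = sym (trans (+-identityʳ _) (+-identityʳ _))

-- Elementary symmetric polynomials and the entries of the determinant

sumF-suc : ∀ n (f : Fin (suc n) → ℕ) → sumF (suc n) f ≡ f zero ℕ.+ sumF n (f ∘ suc)
sumF-suc n f = ≡.cong (foldr ℕ._+_ 0) (allFin-map-suc n f)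

==-suc : ∀ m n → (suc m == suc n) ≡ (m == n)
==-suc m n = ≡.trans (isYes≗does (suc m ℕ.≟ suc n)) (≡.sym (isYes≗does (m ℕ.≟ n)))

==-sound : ∀ m n → (m == n) ≡ true → m ≡ n
==-sound m n eq with m ℕ.≟ n
... | yes m≡n = m≡n

==-refl : ∀ n → (n == n) ≡ true
==-refl n with n ℕ.≟ n
... | yes _ = ≡.refl
... | no n≢n = contradiction ≡.refl n≢n

module Convolution {a ℓ} (R : CommutativeRing a ℓ) where
  open CommutativeRing R hiding (zero)
  open Sums R
  open Hurwitz R using (Seq)
  open CSemi +-commutativeSemigroup using (interchange)
  open SetoidReasoning setoid

  conv : Seq → Seq → Seq
  conv f g zero = f 0 * g 0
  conv f g (suc n) = f 0 * g (suc n) + conv (f ∘ suc) g n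

  conv-cong : ∀ {f f′ g g′ : Seq} n → (∀ {i} → i ≤ n → f i ≈ f′ i) → (∀ {i} → i ≤ n → g i ≈ g′ i) →
    conv f g n ≈ conv f′ g′ n
  conv-cong zero p q = *-cong (p z≤n) (q z≤n)
  conv-cong (suc n) p q = +-cong (*-cong (p z≤n) (q ℕ.≤-refl)) (conv-cong n (λ i≤n → p (s≤s i≤n)) (λ i≤n → q (ℕ.m≤n⇒m≤1+n i≤n)))

  conv-+ˡ : ∀ f g h n → conv (λ i → f i + g i) h n ≈ conv f h n + conv g h n
  conv-+ˡ f g h zero = distribʳ _ _ _
  conv-+ˡ f g h (suc n) = trans (+-cong (distribʳ _ _ _) (conv-+ˡ (f ∘ suc) (g ∘ suc) h n)) (interchange _ _ _ _)

  conv-*ˡ : ∀ c f h n → conv (λ i → c * f i) h n ≈ c * conv f h n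
  conv-*ˡ c f h zero = *-assoc _ _ _
  conv-*ˡ c f h (suc n) = trans (+-cong (*-assoc _ _ _) (conv-*ˡ c (f ∘ suc) h n)) (sym (distribˡ _ _ _))

  conv-+ʳ : ∀ f g h n → conv f (λ i → g i + h i) n ≈ conv f g n + conv f h n
  conv-+ʳ f g h zero = distribˡ _ _ _
  conv-+ʳ f g h (suc n) = trans (+-cong (distribˡ _ _ _) (conv-+ʳ (f ∘ suc) g h n)) (interchange _ _ _ _)

  conv-zeroˡ : ∀ {f : Seq} g n → (∀ {i} → i ≤ n → f i ≈ 0#) → conv f g n ≈ 0#
  conv-zeroˡ g zero eq = trans (*-congʳ (eq z≤n)) (zeroˡ _)
  conv-zeroˡ g (suc n) eq = trans (+-cong (trans (*-congʳ (eq z≤n)) (zeroˡ _)) (conv-zeroˡ g n (eq ∘ s≤s))) (+-identityˡ 0#)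

  conv-zeroʳ : ∀ f n → conv f (λ _ → 0#) n ≈ 0#
  conv-zeroʳ f zero = zeroʳ _
  conv-zeroʳ f (suc n) = trans (+-cong (zeroʳ _) (conv-zeroʳ (f ∘ suc) n)) (+-identityˡ 0#)

  conv-last : ∀ f g n → conv f g (suc n) ≈ conv f (g ∘ suc) n + f (suc n) * g 0
  conv-last f g zero = refl
  conv-last f g (suc n) = trans (+-congˡ (conv-last (f ∘ suc) g n)) (sym (+-assoc _ _ _))

  Σ-upTo-suc : ∀ n F → Σ[ upTo (suc n) ] F ≈ F 0 + Σ[ upTo n ] (F ∘ suc)
  Σ-upTo-suc n F = +-congˡ (reflexive (≡.trans (≡.cong (λ xs → Σ[ xs ] F) (≡.sym (map-upTo suc n))) (Σ-map suc (upTo n) F)))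

  Σ-upTo-conv : ∀ f g n → Σ[ upTo (suc n) ] (λ i → f i * g (n ∸ i)) ≈ conv f g n
  Σ-upTo-conv f g zero = +-identityʳ _
  Σ-upTo-conv f g (suc n) = trans (Σ-upTo-suc (suc n) (λ i → f i * g (suc n ∸ i))) (+-congˡ (Σ-upTo-conv (f ∘ suc) g n))

module Elementary {a ℓ} (R : CommutativeRing a ℓ) where
  open CommutativeRing R hiding (zero)
  open InRing R using (prodF; elem)
  open Sums R
  open Paths R
  open Hurwitz R
  open Convolution R
  open SetoidReasoning setoid

  term : (d : ℕ) → (Fin d → Carrier) → (Fin d → Bool) → Carrier
  term d z S = prodF d (λ i → if S i then z i else 1#)

  elem-Σ : ∀ d z k → elem d z k ≈ Σ[ allFns bools d ] (λ S → [ card d S == k ]? (term d z S))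
  elem-Σ d z k = Σ-filterᵇ (λ S → card d S == k) (allFns bools d) (term d z)

  elem-split : ∀ d z k → elem (suc d) z k ≈
    Σ[ allFns bools d ] (λ S → [ card d S == k ]? (term d (z ∘ suc) S))
    + z zero * Σ[ allFns bools d ] (λ S → [ suc (card d S) == k ]? (term d (z ∘ suc) S))
  elem-split d z k = begin
    elem (suc d) z k ≈⟨ elem-Σ (suc d) z k ⟩
    _ ≈⟨ Σ-allFns bools d (λ b S → [ ((if b then 1 else 0) ℕ.+ card d S) == k ]? ((if b then z zero else 1#) * term d (z ∘ suc) S))
           (λ S → trans (reflexive (≡.cong (λ m → [ m == k ]? (term (suc d) z S)) (sumF-suc d (λ i → if S i then 1 else 0))))
             ([]?-cong (((if S zero then 1 else 0) ℕ.+ card d (S ∘ suc)) == k) (prodF-suc d _))) ⟩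
    _ ≈⟨ +-congˡ (+-identityʳ _) ⟩
    _ ≈⟨ +-cong (Σ-cong (allFns bools d) (λ S → []?-cong (card d S == k) (*-identityˡ _)))
          (trans (Σ-cong (allFns bools d) (λ S → sym ([]?-* (suc (card d S) == k) (z zero) _))) (Σ-*ˡ (allFns bools d) (z zero) _)) ⟩
    _ ∎

  elem-suc-zero : ∀ d z → elem (suc d) z 0 ≈ elem d (z ∘ suc) 0
  elem-suc-zero d z = trans (elem-split d z 0) (trans (+-cong (sym (elem-Σ d (z ∘ suc) 0))
    (trans (*-congˡ (Σ-zero (allFns bools d))) (zeroʳ _))) (+-identityʳ _))

  elem-suc-suc : ∀ d z k → elem (suc d) z (suc k) ≈ elem d (z ∘ suc) (suc k) + z zero * elem d (z ∘ suc) k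
  elem-suc-suc d z k = trans (elem-split d z (suc k)) (+-cong (sym (elem-Σ d (z ∘ suc) (suc k)))
    (*-congˡ (trans (Σ-cong (allFns bools d) (λ S → reflexive (≡.cong (λ b → [ b ]? (term d (z ∘ suc) S)) (==-suc (card d S) k))))
      (sym (elem-Σ d (z ∘ suc) k)))))

  elem-suc : ∀ d z k → elem (suc d) z k ≈ elem d (z ∘ suc) k + z zero * shift (elem d (z ∘ suc)) k
  elem-suc d z zero = trans (elem-suc-zero d z) (sym (trans (+-congˡ (zeroʳ _)) (+-identityʳ _)))
  elem-suc d z (suc k) = elem-suc-suc d z k

  elem-vanish : ∀ d z {k} → d < k → elem d z k ≈ 0#
  elem-vanish zero z (s≤s _) = refl
  elem-vanish (suc d) z (s≤s d<k) = trans (elem-suc-suc d z _)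
    (trans (+-cong (elem-vanish d (z ∘ suc) (ℕ.m≤n⇒m≤1+n d<k)) (trans (*-congˡ (elem-vanish d (z ∘ suc) d<k)) (zeroʳ _))) (+-identityˡ 0#))

  -- If f(n) stands for (1 + v)^n, this splits the factor 1 + v + z₀ off ∏ᵢ (1 + v + z i). A top
  -- term drops out because e_{d+1} of d variables is zero.
  conv-elem : ∀ d z f → conv (elem (suc d) z) f (suc d) ≈
    conv (elem d (z ∘ suc)) (f ∘ suc) d + z zero * conv (elem d (z ∘ suc)) f d
  conv-elem d z f = begin
    conv (elem (suc d) z) f (suc d) ≈⟨ conv-cong (suc d) (λ {i} _ → elem-suc d z i) (λ _ → refl) ⟩
    conv (λ k → e k + z zero * shift e k) f (suc d) ≈⟨ trans (conv-+ˡ e (λ k → z zero * shift e k) f (suc d)) (+-congˡ (conv-*ˡ (z zero) (shift e) f (suc d))) ⟩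
    conv e f (suc d) + z zero * (0# * f (suc d) + conv e f d)
      ≈⟨ +-cong (trans (conv-last e f d) (trans (+-congˡ (trans (*-congʳ (elem-vanish d (z ∘ suc) ℕ.≤-refl)) (zeroˡ _))) (+-identityʳ _)))
           (*-congˡ (trans (+-congʳ (zeroˡ _)) (+-identityˡ _))) ⟩
    conv e (f ∘ suc) d + z zero * conv e f d ∎
    where e = elem d (z ∘ suc)

  -- The coefficient of s^j in the v-part of g_k (1 + v)^n, where g_{2m} = s^m and g_{2m+1} = v s^m (modulo v² = s − v).
  entry : ℕ → ℕ → ℕ → Carrier
  entry zero j n = binomial (+ j) ((+ n ℤ.- + 1) ℤ.- + j)
  entry (suc zero) j n = [ (j == 0) ∧ (n == 0) ]? 1# + binomial (+ j ℤ.- + 1) ((+ n ℤ.- + 1) ℤ.- + j)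
  entry (suc (suc k)) zero n = 0#
  entry (suc (suc k)) (suc j) n = entry k j n

  entry-even-zero : ∀ j → entry 0 j 0 ≈ 0#
  entry-even-zero zero = refl
  entry-even-zero (suc j) = refl

  -- The v-part of (1 + v)^(n+1) = v(1 + v)^n + (1 + v)^n, which on path numbers is Pascal's rule;
  -- its exceptional case is the indicator inside `entry 1`.
  entry-even-suc : ∀ j n → entry 0 j (suc n) ≈ entry 1 j n + entry 0 j n
  entry-even-suc j n = trans (binomial-step (+ j) h)
    (+-cong (+-cong (indicator j n) (reflexive (≡.cong (binomial (+ j ℤ.- + 1)) h-1))) (reflexive (≡.cong (binomial (+ j)) h-1)))
    where
    h = (+ suc n ℤ.- + 1) ℤ.- + j
    h-1 : h ℤ.- + 1 ≡ (+ n ℤ.- + 1) ℤ.- + j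
    h-1 = solve 2 (λ n j → (con (+ 1) :+ n :- con (+ 1) :- j) :- con (+ 1) := n :- con (+ 1) :- j) ≡.refl (+ n) (+ j)
      where open +-*-Solver
    indicator : ∀ j n → [ (+ j ≟ℤ + 0) ∧ (((+ suc n ℤ.- + 1) ℤ.- + j) ≟ℤ + 0) ]? 1# ≈ [ (j == 0) ∧ (n == 0) ]? 1#
    indicator zero zero = refl
    indicator zero (suc n) = refl
    indicator (suc j) n = refl

  entry-odd-zero : ∀ z j → entry 1 j 0 ≈ C-coeff 0 z j
  entry-odd-zero z zero = +-identityʳ _
  entry-odd-zero z (suc j) = +-identityˡ _

  -- This is v(1 + v)^(n+1) = s (1 + v)^n.
  entry-odd-suc : ∀ j n → entry 1 j (suc n) ≈ shift (λ i → entry 0 i n) j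
  entry-odd-suc zero n = trans (+-identityˡ _) (binomial-negative ((+ suc n ℤ.- + 1) ℤ.- + 0) 0)
  entry-odd-suc (suc j) n = trans (+-identityˡ _) (reflexive (≡.cong₂ binomial
    (solve 1 (λ j → (con (+ 1) :+ j) :- con (+ 1) := j) ≡.refl (+ j))
    (solve 2 (λ n j → (con (+ 1) :+ n :- con (+ 1)) :- (con (+ 1) :+ j) := n :- con (+ 1) :- j) ≡.refl (+ n) (+ j))))
    where open +-*-Solver

  conv-shift : ∀ e d (f : ℕ → Seq) j → conv e (λ n → shift (λ i → f i n) j) d ≈ shift (λ i → conv e (f i) d) j
  conv-shift e d f zero = conv-zeroʳ e d
  conv-shift e d f (suc j) = refl

  mutual
    -- Take v-parts in ∏ᵢ (1 + v + z i) = Σ_r e_r(z) (1 + v)^(d-r). The induction follows the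
    -- defining recursions of `B-coeff` and `C-coeff`.
    B-conv : ∀ d z j → conv (elem d z) (entry 0 j) d ≈ B-coeff d z j
    B-conv zero z j = trans (*-congˡ (entry-even-zero j)) (zeroʳ _)
    B-conv (suc d) z j = begin
      conv (elem (suc d) z) (entry 0 j) (suc d) ≈⟨ conv-elem d z (entry 0 j) ⟩
      conv e (entry 0 j ∘ suc) d + z zero * conv e (entry 0 j) d
        ≈⟨ +-cong (trans (conv-cong d (λ _ → refl) (λ {n} _ → entry-even-suc j n)) (conv-+ʳ e (entry 1 j) (entry 0 j) d)) refl ⟩
      (conv e (entry 1 j) d + conv e (entry 0 j) d) + z zero * conv e (entry 0 j) d
        ≈⟨ trans (+-assoc _ _ _) (+-cong (C-conv d (z ∘ suc) j) (trans (+-cong (sym (*-identityˡ _)) refl)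
            (trans (sym (distribʳ _ _ _)) (*-congˡ (B-conv d (z ∘ suc) j))))) ⟩
      B-coeff (suc d) z j ∎
      where e = elem d (z ∘ suc)

    C-conv : ∀ d z j → conv (elem d z) (entry 1 j) d ≈ C-coeff d z j
    C-conv zero z j = trans (*-cong (+-identityʳ 1#) (entry-odd-zero z j)) (*-identityˡ _)
    C-conv (suc d) z j = begin
      conv (elem (suc d) z) (entry 1 j) (suc d) ≈⟨ conv-elem d z (entry 1 j) ⟩
      conv e (entry 1 j ∘ suc) d + z zero * conv e (entry 1 j) d
        ≈⟨ +-cong (trans (conv-cong d (λ _ → refl) (λ {n} _ → entry-odd-suc j n)) (conv-shift e d (entry 0) j)) (*-congˡ (C-conv d (z ∘ suc) j)) ⟩
      shift (λ i → conv e (entry 0 i) d) j + z zero * C-coeff d (z ∘ suc) j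
        ≈⟨ trans (+-comm _ _) (+-congˡ (shift-cong j (λ i → B-conv d (z ∘ suc) i))) ⟩
      C-coeff (suc d) z j ∎
      where
      e = elem d (z ∘ suc)
      shift-cong : ∀ {f g : Seq} j → (∀ i → f i ≈ g i) → shift f j ≈ shift g j
      shift-cong zero eq = refl
      shift-cong (suc j) eq = eq j

  hurwitz-conv : ∀ d z k j → conv (elem d z) (entry k j) d ≈ hurwitz d z k j
  hurwitz-conv d z zero j = B-conv d z j
  hurwitz-conv d z (suc zero) j = C-conv d z j
  hurwitz-conv d z (suc (suc k)) zero = conv-zeroʳ (elem d z) d
  hurwitz-conv d z (suc (suc k)) (suc j) = hurwitz-conv d z k j

  sourceSinkEntry : ℕ → ℕ → ℕ → ℕ → Carrier
  sourceSinkEntry d k j r =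
    pathCount (source (suc k)) (sink d (suc j) r) + [ (suc j ℕ.* 2 == suc k) ∧ (r == d) ]? 1#

  -- Raising k by 2 and j by 1 moves source and sink alike by (1, -1) and preserves the jump
  -- condition 2(j + 1) = k + 1, so only k = 0, k = 1 and the first column need inspection. The
  -- parts enter through n = d - r alone.
  sourceSinkEntry-entry : ∀ d k j r → r ≤ d → sourceSinkEntry d k j r ≈ entry k j (d ∸ r)
  sourceSinkEntry-entry d k j r r≤d = begin
    sourceSinkEntry d k j r
      ≈⟨ +-cong (pathCount-binomial (source (suc k)) (sink d (suc j) r))
           (reflexive (≡.cong (λ b → [ (suc j ℕ.* 2 == suc k) ∧ b ]? 1#) (bool-ext {r == d} {(d ∸ r) == 0}
             (λ e → ≡.cong (_== 0) (≡.trans (≡.cong (d ∸_) (==-sound r d e)) (ℕ.n∸n≡0 d)))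
             (λ e → ≡.trans (≡.cong (_== d) (ℕ.≤-antisym r≤d (ℕ.m∸n≡0⇒m≤n (==-sound (d ∸ r) 0 e)))) (==-refl d))))) ⟩
    binomial (+ suc j ℤ.- + suc ⌊ suc k /2⌋) ((+ d ℤ.- + suc j ℤ.- + r) ℤ.- (ℤ.- + ⌊ k /2⌋)) + [ (suc j ℕ.* 2 == suc k) ∧ ((d ∸ r) == 0) ]? 1#
      ≈⟨ +-congʳ (reflexive (≡.cong (binomial (+ suc j ℤ.- + suc ⌊ suc k /2⌋)) height-eq)) ⟩
    F k j (d ∸ r) ≈⟨ F-entry k j (d ∸ r) ⟩
    entry k j (d ∸ r) ∎
    where
    open +-*-Solver
    height-eq : (+ d ℤ.- + suc j ℤ.- + r) ℤ.- (ℤ.- + ⌊ k /2⌋) ≡ (+ (d ∸ r) ℤ.- + suc j) ℤ.- (ℤ.- + ⌊ k /2⌋)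
    height-eq = ≡.cong (ℤ._- (ℤ.- + ⌊ k /2⌋)) (≡.trans
      (solve 3 (λ d j r → d :- j :- r := (d :- r) :- j) ≡.refl (+ d) (+ suc j) (+ r))
      (≡.cong (ℤ._- + suc j) (≡.trans (ℤ.m-n≡m⊖n d r) (ℤ.⊖-≥ r≤d))))
    F : ℕ → ℕ → ℕ → Carrier
    F k j n = binomial (+ suc j ℤ.- + suc ⌊ suc k /2⌋) ((+ n ℤ.- + suc j) ℤ.- (ℤ.- + ⌊ k /2⌋)) + [ (suc j ℕ.* 2 == suc k) ∧ (n == 0) ]? 1#
    F-entry : ∀ k j n → F k j n ≈ entry k j n
    F-entry zero j n = trans (+-identityʳ _) (reflexive (≡.cong (binomial (+ j))
      (solve 2 (λ n j → (n :- (con (+ 1) :+ j)) :- con (+ 0) := n :- con (+ 1) :- j) ≡.refl (+ n) (+ j))))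
    -- No path leads from source(2) = (2, 0) to sink(1, d) = (1, -1); the jump supplies the value 1
    -- of `entry 1 0 0`.
    F-entry (suc zero) j n = trans (+-comm _ _) (+-cong (reflexive (≡.cong (λ b → [ b ∧ (n == 0) ]? 1#) (twice j)))
      (reflexive (≡.cong₂ binomial (solve 1 (λ j → (con (+ 1) :+ j) :- con (+ 2) := j :- con (+ 1)) ≡.refl (+ j))
        (solve 2 (λ n j → (n :- (con (+ 1) :+ j)) :- con (+ 0) := n :- con (+ 1) :- j) ≡.refl (+ n) (+ j)))))
      where
      twice : ∀ j → (suc j ℕ.* 2 == 2) ≡ (j == 0)
      twice zero = ≡.refl
      twice (suc j) = ≡.refl
    -- The sink lies strictly to the left of the source, and no jump is possible since 2 differs
    -- from k + 3.
    F-entry (suc (suc k)) zero n = trans (+-identityʳ _) (binomial-negative ((+ n ℤ.- + 1) ℤ.- (ℤ.- + ⌊ suc (suc k) /2⌋)) ⌊ suc k /2⌋)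
    F-entry (suc (suc k)) (suc j) n = trans (+-cong (reflexive (≡.cong₂ binomial
        (solve 2 (λ x y → (con (+ 1) :+ x) :- (con (+ 1) :+ y) := x :- y) ≡.refl (+ suc j) (+ suc ⌊ suc k /2⌋))
        (solve 3 (λ n j k → (n :- (con (+ 1) :+ j)) :- (:- (con (+ 1) :+ k)) := (n :- j) :- (:- k)) ≡.refl (+ n) (+ suc j) (+ ⌊ k /2⌋))))
        (reflexive (≡.cong (λ b → [ b ∧ (n == 0) ]? 1#) (≡.trans (==-suc (suc (suc j ℕ.* 2)) (suc (suc k))) (==-suc (suc j ℕ.* 2) (suc k))))))
      (F-entry k j n)

  Σ-elem-entry : ∀ d z k j → Σ[ upTo (suc d) ] (λ r → elem d z r * sourceSinkEntry d k j r) ≈ hurwitz d z k j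
  Σ-elem-entry d z k j = trans
    (Σ-cong-∈ (upTo (suc d)) (λ {r} r∈ → *-congˡ (sourceSinkEntry-entry d k j r (ℕ.≤-pred (∈-upTo⁻ r∈)))))
    (trans (Σ-upTo-conv (elem d z) (entry k j) d) (hurwitz-conv d z k j))

-- Signs of permutations

AllPairs-middle : {R : A → A → Set q} (pre : List A) {x : A} {post : List A} → AllPairs R (pre ++ x ∷ post) →
  All (λ y → R y x) pre × All (R x) post × AllPairs R (pre ++ post)
AllPairs-middle [] (x<post ∷ post-sorted) = [] , x<post , post-sorted
AllPairs-middle (y ∷ pre) (y< ∷ rest) with AllPairs-middle pre rest
... | pre<x , x<post , sorted = (All.head (All-++⁻ʳ pre y<) ∷ pre<x) , x<post
      , (All-++⁺ (All-++⁻ˡ pre y<) (All.tail (All-++⁻ʳ pre y<)) ∷ sorted)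

∈-drop-middle : (pre : List A) {x y : A} {post : List A} → y ∈ pre ++ x ∷ post → x ≢ y → y ∈ pre ++ post
∈-drop-middle [] (here y≡x) x≢y = contradiction (≡.sym y≡x) x≢y
∈-drop-middle [] (there y∈) x≢y = y∈
∈-drop-middle (z ∷ pre) (here eq) x≢y = here eq
∈-drop-middle (z ∷ pre) (there y∈) x≢y = there (∈-drop-middle pre y∈ x≢y)

unique-⊆⇒↭ : {xs ys : List A} → AllPairs _≢_ xs → All (_∈ ys) xs → length xs ≡ length ys → xs ↭ ys
unique-⊆⇒↭ {xs = []} {[]} _ _ _ = ↭-refl
unique-⊆⇒↭ {xs = x ∷ xs} (x∉xs ∷ unique) (x∈ys ∷ xs⊆ys) len with ∈-∃++ x∈ys
... | pre , post , ≡.refl = ↭-trans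
  (prep x (unique-⊆⇒↭ unique (All.zipWith (λ (y∈ , x≢y) → ∈-drop-middle pre y∈ x≢y) (xs⊆ys , x∉xs))
    (ℕ.suc-injective (≡.trans len (≡.trans (length-++ pre) (≡.trans (ℕ.+-suc (length pre) (length post))
      (≡.cong suc (≡.sym (length-++ pre)))))))))
  (↭-sym (↭-shift x pre post))

countBelow : ℤ → List ℤ → ℕ
countBelow x ys = sum (map (λ y → if ⌊ y ℤ.<? x ⌋ then 1 else 0) ys)

inversions : List ℤ → ℕ
inversions [] = 0
inversions (x ∷ xs) = countBelow x xs ℕ.+ inversions xs

countBelow-all : ∀ {x ys} → All (ℤ._< x) ys → countBelow x ys ≡ length ys
countBelow-all [] = ≡.refl
countBelow-all {x} {y ∷ ys} (y<x ∷ ys<x) with y ℤ.<? x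
... | yes _ = ≡.cong suc (countBelow-all ys<x)
... | no y≮x = contradiction y<x y≮x

countBelow-none : ∀ {x ys} → All (x ℤ.<_) ys → countBelow x ys ≡ 0
countBelow-none [] = ≡.refl
countBelow-none {x} {y ∷ ys} (x<y ∷ x<ys) with y ℤ.<? x
... | yes y<x = contradiction y<x (ℤ.<-asym x<y)
... | no _ = countBelow-none x<ys

-- The count does not depend on the order of the list, so it can be made in the sorted list, where
-- it is the position of x.
countBelow-middle : ∀ {x xs pre post} → xs ↭ pre ++ post → All (ℤ._< x) pre → All (x ℤ.<_) post →
  countBelow x xs ≡ length pre
countBelow-middle {x} {xs} {pre} {post} perm below above = begin
  countBelow x xs ≡⟨ sum-↭ (map⁺ below? perm) ⟩
  sum (map below? (pre ++ post)) ≡⟨ ≡.trans (≡.cong sum (map-++ below? pre post)) (sum-++ (map below? pre) (map below? post)) ⟩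
  countBelow x pre ℕ.+ countBelow x post ≡⟨ ≡.cong₂ ℕ._+_ (countBelow-all below) (countBelow-none above) ⟩
  length pre ℕ.+ 0 ≡⟨ ℕ.+-identityʳ _ ⟩
  length pre ∎
  where
  open ≡.≡-Reasoning
  below? : ℤ → ℕ
  below? y = if ⌊ y ℤ.<? x ⌋ then 1 else 0

module PermutationSign {a ℓ} (R : CommutativeRing a ℓ) where
  open CommutativeRing R hiding (zero)
  open InRing R using (sign)
  open Sums R
  open Determinants R
  open RingProperties ring using (-‿distribˡ-*; -0#≈0#)
  open SetoidReasoning setoid

  pickΣ-vanish-All : {φ : B → List B → Carrier} {cs : List B} → All (λ u → ∀ l → φ u l ≈ 0#) cs → pickΣ φ cs ≈ 0#
  pickΣ-vanish-All [] = refl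
  pickΣ-vanish-All (x≈0 ∷ xs≈0) = trans (-‿cong₂ (x≈0 _) (pickΣ-vanish-All (All.map (λ u≈0 l → u≈0 _) xs≈0))) (-‿inverseʳ 0#)

  pickΣ-single : (φ : B → List B → Carrier) (pre : List B) {x : B} {post : List B} →
    All (λ u → ∀ l → φ u l ≈ 0#) pre → All (λ u → ∀ l → φ u l ≈ 0#) post →
    pickΣ φ (pre ++ x ∷ post) ≈ sign (length pre) * φ x (pre ++ post)
  pickΣ-single φ [] [] post≈0 = trans (-‿cong₂ refl (pickΣ-vanish-All (All.map (λ u≈0 l → u≈0 _) post≈0)))
    (trans (+-congˡ -0#≈0#) (trans (+-identityʳ _) (sym (*-identityˡ _))))
  pickΣ-single φ (u ∷ pre) (u≈0 ∷ pre≈0) post≈0 = begin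
    _ ≈⟨ -‿cong₂ (u≈0 _) (pickΣ-single _ pre (All.map (λ v≈0 l → v≈0 _) pre≈0) (All.map (λ v≈0 l → v≈0 _) post≈0)) ⟩
    0# - sign (length pre) * _ ≈⟨ +-identityˡ _ ⟩
    - (sign (length pre) * _) ≈⟨ -‿distribˡ-* _ _ ⟩
    _ ∎

  indicator : ℤ → ℤ → Carrier
  indicator x y = [ x ≟ℤ y ]? 1#

  indicator-≢ : ∀ {x y} → x ≢ y → indicator x y ≈ 0#
  indicator-≢ x≢y = reflexive (≡.cong (λ b → [ b ]? 1#) (≟ℤ-false x≢y))

  indicator-refl : ∀ x → indicator x x ≈ 1#
  indicator-refl x = reflexive (≡.cong (λ b → [ b ]? 1#) (≟ℤ-refl x))

  -- In the row of x only the column x survives. Its sign is given by its position among the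
  -- remaining sorted columns, that is, by the number of later entries below x.
  det-permutation : ∀ xs ys → AllPairs ℤ._<_ ys → xs ↭ ys → det indicator xs ys ≈ sign (inversions xs)
  det-permutation [] ys _ perm with ↭-empty-inv (↭-sym perm)
  ... | ≡.refl = refl
  det-permutation (x ∷ xs) ys sorted perm with ∈-∃++ (∈-resp-↭ perm (here ≡.refl))
  ... | pre , post , ≡.refl with AllPairs-middle pre sorted
  ...   | pre<x , x<post , sorted′ = begin
    det indicator (x ∷ xs) (pre ++ x ∷ post)
      ≈⟨ pickΣ-single _ pre (All.map (λ y<x l → trans (*-congʳ (indicator-≢ (ℤ.<⇒≢ y<x ∘ ≡.sym))) (zeroˡ _)) pre<x)
           (All.map (λ x<y l → trans (*-congʳ (indicator-≢ (ℤ.<⇒≢ x<y))) (zeroˡ _)) x<post) ⟩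
    sign (length pre) * (indicator x x * det indicator xs (pre ++ post))
      ≈⟨ *-congˡ (trans (*-congʳ (indicator-refl x)) (trans (*-identityˡ _) (det-permutation xs (pre ++ post) sorted′ perm′))) ⟩
    sign (length pre) * sign (inversions xs)
      ≈⟨ trans (*-congʳ (reflexive (≡.cong sign (≡.sym (countBelow-middle perm′ pre<x x<post))))) (sym (sign-+ (countBelow x xs) (inversions xs))) ⟩
    sign (inversions (x ∷ xs)) ∎
    where perm′ = drop-mid [] pre perm

-- Cancellation of intersecting path families

posPart : ℤ → ℕ
posPart (+ n) = n
posPart -[1+ n ] = 0

posPart-pred : ∀ i → posPart (i ℤ.- + 1) ≡ ℕ.pred (posPart i)
posPart-pred (+ zero) = ≡.refl
posPart-pred (+ suc n) = ≡.refl
posPart-pred -[1+ n ] = ≡.refl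

posPart-zero : ∀ i → posPart i ≡ 0 → ∃[ k ] i ≡ ℤ.- + k
posPart-zero (+ zero) eq = 0 , ≡.refl
posPart-zero -[1+ n ] eq = suc n , ≡.refl

Repeated-middle : (pre : List A) {x : A} {post : List A} → x ∈ pre ++ post → Repeated x (pre ++ x ∷ post)
Repeated-middle [] x∈ = here x∈
Repeated-middle (y ∷ pre) (here ≡.refl) = here (∈-insert pre)
Repeated-middle (y ∷ pre) (there x∈) = there (Repeated-middle pre x∈)

-- The status of one path in the expansion: `live p` must still be continued from p, `done x` has
-- ended at the sink with abscissa x. A jump can therefore enter as a path that is already finished.
data State : Set where
  live : Point → State
  done : ℤ → State

live? : ∀ p q → Dec (live p ≡ q)
live? p (done x) = no λ ()
live? p (live q) with ≡-dec ℤ._≟_ ℤ._≟_ p q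
... | yes ≡.refl = yes ≡.refl
... | no p≢q = no λ { ≡.refl → p≢q ≡.refl }

-- The vertices a path still has to visit (none for a jump) and the abscissa of its sink.
Item : Set
Item = List Point × ℤ

disjointItems : Item → Item → Bool
disjointItems (ps , _) (qs , _) = disjointPts ps qs

allDisjoint : List Item → Bool
allDisjoint [] = true
allDisjoint (a ∷ as) = all (disjointItems a) as ∧ allDisjoint as

any-∉ : ∀ p qs → p ∉ qs → any (p ≟P_) qs ≡ false
any-∉ p [] p∉ = ≡.refl
any-∉ p (q ∷ qs) p∉ = ≡.cong₂ _∨_ (≟P-false (λ p≡q → p∉ (here p≡q))) (any-∉ p qs (λ p∈ → p∉ (there p∈)))

any-∈ : ∀ p qs → p ∈ qs → any (p ≟P_) qs ≡ true
any-∈ p (q ∷ qs) (here ≡.refl) = ≡.cong (_∨ any (p ≟P_) qs) (≟P-refl p)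
any-∈ p (q ∷ qs) (there p∈) with p ≟P q
... | true = ≡.refl
... | false = any-∈ p qs p∈

disjointPts-[] : ∀ ps → disjointPts ps [] ≡ true
disjointPts-[] [] = ≡.refl
disjointPts-[] (p ∷ ps) = disjointPts-[] ps

disjointPts-dropˡ : ∀ p ps qs → p ∉ qs → disjointPts (p ∷ ps) qs ≡ disjointPts ps qs
disjointPts-dropˡ p ps qs p∉ = ≡.cong (λ b → not b ∧ disjointPts ps qs) (any-∉ p qs p∉)

disjointPts-dropʳ : ∀ p ps qs → p ∉ ps → disjointPts ps (p ∷ qs) ≡ disjointPts ps qs
disjointPts-dropʳ p [] qs p∉ = ≡.refl
disjointPts-dropʳ p (r ∷ ps) qs p∉ = ≡.cong₂ _∧_
  (≡.cong (λ b → not (b ∨ any (r ≟P_) qs)) (≟P-false (λ r≡p → p∉ (here (≡.sym r≡p)))))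
  (disjointPts-dropʳ p ps qs (λ p∈ → p∉ (there p∈)))

disjointPts-common : ∀ p ps qs → p ∈ ps → p ∈ qs → disjointPts ps qs ≡ false
disjointPts-common p (r ∷ ps) qs (here ≡.refl) p∈qs = ≡.cong (λ b → not b ∧ disjointPts ps qs) (any-∈ p qs p∈qs)
disjointPts-common p (r ∷ ps) qs (there p∈ps) p∈qs with any (r ≟P_) qs
... | true = ≡.refl
... | false = disjointPts-common p ps qs p∈ps p∈qs

all-disjoint-drop : ∀ p vs x as → All (λ a → p ∉ proj₁ a) as →
  all (disjointItems (p ∷ vs , x)) as ≡ all (disjointItems (vs , x)) as
all-disjoint-drop p vs x [] [] = ≡.refl
all-disjoint-drop p vs x (a ∷ as) (p∉a ∷ p∉as) = ≡.cong₂ _∧_ (disjointPts-dropˡ p vs (proj₁ a) p∉a) (all-disjoint-drop p vs x as p∉as)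

all-disjoint-drop-middle : ∀ p vs x a as bs → p ∉ proj₁ a →
  all (disjointItems a) (as ++ (p ∷ vs , x) ∷ bs) ≡ all (disjointItems a) (as ++ (vs , x) ∷ bs)
all-disjoint-drop-middle p vs x a [] bs p∉ = ≡.cong (_∧ all (disjointItems a) bs) (disjointPts-dropʳ p (proj₁ a) vs p∉)
all-disjoint-drop-middle p vs x a (b ∷ as) bs p∉ = ≡.cong (disjointItems a b ∧_) (all-disjoint-drop-middle p vs x a as bs p∉)

allDisjoint-drop : ∀ p vs x as bs → All (λ a → p ∉ proj₁ a) as → All (λ b → p ∉ proj₁ b) bs →
  allDisjoint (as ++ (p ∷ vs , x) ∷ bs) ≡ allDisjoint (as ++ (vs , x) ∷ bs)
allDisjoint-drop p vs x [] bs [] p∉bs = ≡.cong (_∧ allDisjoint bs) (all-disjoint-drop p vs x bs p∉bs)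
allDisjoint-drop p vs x (a ∷ as) bs (p∉a ∷ p∉as) p∉bs =
  ≡.cong₂ _∧_ (all-disjoint-drop-middle p vs x a as bs p∉a) (allDisjoint-drop p vs x as bs p∉as p∉bs)

all-disjoint-common : ∀ p a as → p ∈ proj₁ a → Any (λ b → p ∈ proj₁ b) as → all (disjointItems a) as ≡ false
all-disjoint-common p a (b ∷ as) p∈a (here p∈b) = ≡.cong (_∧ all (disjointItems a) as) (disjointPts-common p (proj₁ a) (proj₁ b) p∈a p∈b)
all-disjoint-common p a (b ∷ as) p∈a (there p∈as) with disjointItems a b
... | true = all-disjoint-common p a as p∈a p∈as
... | false = ≡.refl

allDisjoint-[] : ∀ xs → allDisjoint (map ([] ,_) xs) ≡ true
allDisjoint-[] [] = ≡.refl
allDisjoint-[] (x ∷ xs) = ≡.cong₂ _∧_ (all-true xs) (allDisjoint-[] xs)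
  where
  all-true : ∀ ys → all (disjointItems ([] , x)) (map ([] ,_) ys) ≡ true
  all-true [] = ≡.refl
  all-true (y ∷ ys) = all-true ys

module LGV {a ℓ} (R : CommutativeRing a ℓ) (n : ℕ) (c : Fin n → ℕ) where
  open CommutativeRing R hiding (zero)
  open InRing R using (sumL)
  open Sums R
  open Determinants R
  open Paths R
  open PermutationSign R
  open SetoidReasoning setoid

  d : ℕ
  d = suc n

  target : Fin n → Point
  target = Bpt d c

  abscissa : Fin n → ℤ
  abscissa j = + idx j

  abscissa-injective : ∀ {i j} → abscissa i ≡ abscissa j → i ≡ j
  abscissa-injective eq = Fin.toℕ-injective (ℕ.suc-injective (ℤ.+-injective eq))

  -- Every target has ordinate at most d - 1. From rank 0 no target can be reached, so nothing is
  -- lost by truncating at 0.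
  rank : Point → ℕ
  rank p = posPart (+ d ℤ.- proj₂ p)

  rank-step : ∀ p b → rank (step p b) ≡ ℕ.pred (rank p)
  rank-step p b = ≡.trans (≡.cong posPart (≡.trans (≡.cong (λ y → + d ℤ.- y) (step-y p b))
    (solve 2 (λ d y → d :- (y :+ con (+ 1)) := (d :- y) :- con (+ 1)) ≡.refl (+ d) (proj₂ p)))) (posPart-pred (+ d ℤ.- proj₂ p))
    where open +-*-Solver

  rank-vertices : ∀ p bs {v} → v ∈ vertices p bs → rank v ≤ rank p
  rank-vertices p [] (here ≡.refl) = ℕ.≤-refl
  rank-vertices p (b ∷ bs) (here ≡.refl) = ℕ.≤-refl
  rank-vertices p (b ∷ bs) (there v∈) = ℕ.≤-trans (rank-vertices (step p b) bs v∈)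
    (≡.subst (_≤ rank p) (≡.sym (rank-step p b)) ℕ.pred[n]≤n)

  rank-tail : ∀ p bs {v} → v ∈ vertices p bs → v ≢ p → rank v ≤ ℕ.pred (rank p)
  rank-tail p [] (here v≡p) v≢p = contradiction v≡p v≢p
  rank-tail p (b ∷ bs) (here v≡p) v≢p = contradiction v≡p v≢p
  rank-tail p (b ∷ bs) {v} (there v∈) v≢p = ≡.subst (rank v ≤_) (rank-step p b) (rank-vertices (step p b) bs v∈)

  vertices-start : ∀ p bs → p ∈ vertices p bs
  vertices-start p [] = here ≡.refl
  vertices-start p (b ∷ bs) = here ≡.refl

  item : Point → List Bool → Item
  item p bs = vertices p bs , proj₁ (endpoint p bs)

  items : State → List Item
  items (live p) = concatMap (λ j → map (item p) (pathsTo p (target j))) (allFin n)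
  items (done x) = ([] , x) ∷ []

  ∈-pathsTo⁻ : ∀ p t {bs} → bs ∈ pathsTo p t → endpoint p bs ≡ t
  ∈-pathsTo⁻ p t {bs} bs∈ = ≟P-sound (endpoint p bs) t (Equivalence.to T-≡
    (proj₂ (∈-filter⁻ (λ bs → T? (endpoint p bs ≟P t)) {xs = allBoolLists ℤ.∣ proj₂ t ℤ.- proj₂ p ∣} bs∈)))

  ∈-items-live : ∀ p {it} → it ∈ items (live p) → ∃[ j ] ∃[ bs ] endpoint p bs ≡ target j × it ≡ item p bs
  ∈-items-live p it∈ with Any.satisfied (∈-concatMap⁻ (λ j → map (item p) (pathsTo p (target j))) {xs = allFin n} it∈)
  ... | j , it∈′ with ∈-map⁻ (item p) it∈′
  ...   | bs , bs∈ , eq = j , bs , ∈-pathsTo⁻ p (target j) bs∈ , eq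

  rank-zero : ∀ p bs j → rank p ≡ 0 → endpoint p bs ≢ target j
  rank-zero p bs j rank≡0 end with posPart-zero (+ d ℤ.- proj₂ p) rank≡0
  ... | k , d-y with ≡.trans (≡.sym (height-endpoint p bs (target j) end)) height≡
    where
    open +-*-Solver
    height≡ : height p (target j) ≡ -[1+ toℕ j ℕ.+ c j ℕ.+ k ]
    height≡ = ≡.trans (solve 4 (λ d i c y → (d :- i :- c) :- y := (d :- y) :- i :- c) ≡.refl (+ d) (+ idx j) (+ c j) (proj₂ p))
      (≡.trans (≡.cong (λ h → h ℤ.- + idx j ℤ.- + c j) d-y)
        (solve 3 (λ k j c → (:- k) :- (con (+ 1) :+ j) :- c := :- (con (+ 1) :+ (j :+ c :+ k))) ≡.refl (+ k) (+ toℕ j) (+ c j)))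
  ...   | ()

  -- The determinant of indicators replaces the inversion sign because it vanishes when two sinks
  -- coincide. Arbitrary lists of states do contain such tuples, and the induction has to cover
  -- them.
  signedDisjoint : List Item → Carrier
  signedDisjoint t = [ allDisjoint t ]? (det indicator (map proj₂ t) (map abscissa (allFin n)))

  stateEntry : State → Fin n → Carrier
  stateEntry (live p) j = pathCount p (target j)
  stateEntry (done x) j = indicator x (abscissa j)

  Σ-allFin-single : ∀ {m} (j : Fin m) (f : Fin m → Carrier) → (∀ i → i ≢ j → f i ≈ 0#) → Σ[ allFin m ] f ≈ f j
  Σ-allFin-single {suc m} zero f eq = trans (reflexive (≡.cong sumL (allFin-map-suc m f)))
    (trans (+-congˡ (Σ-vanish (allFin m) (λ i → eq (suc i) (λ ())))) (+-identityʳ _))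
  Σ-allFin-single {suc m} (suc j) f eq = trans (reflexive (≡.cong sumL (allFin-map-suc m f)))
    (trans (+-cong (eq zero (λ ())) (Σ-allFin-single j (f ∘ suc) (λ i i≢j → eq (suc i) (λ { ≡.refl → i≢j ≡.refl })))) (+-identityˡ _))

  stops : Point → List State
  stops p = concatMap (λ j → if p ≟P target j then done (proj₁ p) ∷ [] else []) (allFin n)

  nexts : Point → List State
  nexts p = stops p ++ live (step p false) ∷ live (step p true) ∷ []

  Σ-if : ∀ b (x : A) (φ : A → Carrier) → Σ[ if b then x ∷ [] else [] ] φ ≈ [ b ]? (φ x)
  Σ-if true x φ = +-identityʳ _
  Σ-if false x φ = refl

  Σ-stops : ∀ p (φ : State → Carrier) → Σ[ stops p ] φ ≈ Σ[ allFin n ] (λ j → [ p ≟P target j ]? (φ (done (proj₁ p))))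
  Σ-stops p φ = trans (Σ-concatMap _ (allFin n) φ) (Σ-cong (allFin n) (λ j → Σ-if (p ≟P target j) _ φ))

  Σ-nexts : ∀ p (φ : State → Carrier) → Σ[ nexts p ] φ ≈
    Σ[ allFin n ] (λ j → [ p ≟P target j ]? (φ (done (proj₁ p)))) + (φ (live (step p false)) + φ (live (step p true)))
  Σ-nexts p φ = trans (Σ-++ (stops p) _ φ) (+-cong (Σ-stops p φ) (+-congˡ (+-identityʳ _)))

  -- Targets in different columns have different abscissae, so the abscissa kept by `done`
  -- determines the column, and at most one stop at p contributes to column j.
  stateEntry-nexts : ∀ p j → stateEntry (live p) j ≈ Σ[ nexts p ] (λ q → stateEntry q j)
  stateEntry-nexts p j = trans (Σ-pathsTo-step p (target j) _)
    (trans (+-congʳ (sym (trans (Σ-allFin-single j _ other) same))) (sym (Σ-nexts p (λ q → stateEntry q j))))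
    where
    other : ∀ i → i ≢ j → [ p ≟P target i ]? (indicator (proj₁ p) (abscissa j)) ≈ 0#
    other i i≢j with p ≟P target i in eq
    ... | false = refl
    ... | true = indicator-≢ (λ x≡ → i≢j (abscissa-injective (≡.trans (≡.sym (≡.cong proj₁ (≟P-sound p (target i) eq))) x≡)))
    same : [ p ≟P target j ]? (indicator (proj₁ p) (abscissa j)) ≈ [ p ≟P target j ]? 1#
    same with p ≟P target j in eq
    ... | false = refl
    ... | true = trans (reflexive (≡.cong (λ x → indicator x (abscissa j)) (≡.cong proj₁ (≟P-sound p (target j) eq)))) (indicator-refl (abscissa j))

  Σ-items-live : ∀ p φ → Σ[ items (live p) ] φ ≈ Σ[ allFin n ] (λ j → Σ[ pathsTo p (target j) ] (φ ∘ item p))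
  Σ-items-live p φ = trans (Σ-concatMap _ (allFin n) φ)
    (Σ-cong (allFin n) (λ j → reflexive (Σ-map (item p) (pathsTo p (target j)) φ)))

  prepend : Point → Item → Item
  prepend p (vs , x) = p ∷ vs , x

  Σ-items-nexts : ∀ p (φ : Item → Carrier) →
    Σ[ items (live p) ] φ ≈ Σ[ nexts p ] (λ q → Σ[ items q ] (φ ∘ prepend p))
  Σ-items-nexts p φ = begin
    Σ[ items (live p) ] φ ≈⟨ Σ-items-live p φ ⟩
    Σ[ allFin n ] (λ j → Σ[ pathsTo p (target j) ] (φ ∘ item p))
      ≈⟨ Σ-cong (allFin n) (λ j → Σ-pathsTo-step p (target j) (φ ∘ item p)) ⟩
    _ ≈⟨ trans (Σ-+ (allFin n) _ _) (+-congˡ (Σ-+ (allFin n) _ _)) ⟩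
    _ ≈⟨ +-cong (Σ-cong (allFin n) (λ j → []?-cong (p ≟P target j) (sym (+-identityʳ _))))
          (+-cong (sym (Σ-items-live (step p false) (φ ∘ prepend p))) (sym (Σ-items-live (step p true) (φ ∘ prepend p)))) ⟩
    _ ≈⟨ Σ-nexts p (λ q → Σ[ items q ] (φ ∘ prepend p)) ⟨
    _ ∎

  -- The hypothesis allows the vertex p to be forgotten once it has been passed, so that the
  -- remainder is again a tuple of items for a list of states.
  Σ-tuples-expand : ∀ pre p post (Ψ : List Item → Carrier) →
    (∀ {as bs} it → Pointwise _∈_ as (map items pre) → Pointwise _∈_ bs (map items post) →
      Ψ (as ++ prepend p it ∷ bs) ≈ Ψ (as ++ it ∷ bs)) →
    Σ-tuples (map items (pre ++ live p ∷ post)) Ψ ≈ Σ[ nexts p ] (λ q → Σ-tuples (map items (pre ++ q ∷ post)) Ψ)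
  Σ-tuples-expand [] p post Ψ eq = trans (Σ-items-nexts p _)
    (Σ-cong (nexts p) (λ q → Σ-cong (items q) (λ it → Σ-tuples-cong-∈ (map items post) (λ bs∈ → eq it [] bs∈))))
  Σ-tuples-expand (r ∷ pre) p post Ψ eq = trans
    (Σ-cong-∈ (items r) (λ {a} a∈ → Σ-tuples-expand pre p post (λ t → Ψ (a ∷ t)) (λ it as∈ bs∈ → eq it (a∈ ∷ as∈) bs∈)))
    (Σ-swap (items r) (nexts p) _)

  Σ-tuples-empty : ∀ pre p post (Ψ : List Item → Carrier) → rank p ≡ 0 → Σ-tuples (map items (pre ++ live p ∷ post)) Ψ ≈ 0#
  Σ-tuples-empty [] p post Ψ rank≡0 = trans
    (Σ-cong-∈ (items (live p)) {g = λ _ → 0#} (λ it∈ → let j , bs , end , _ = ∈-items-live p it∈ in contradiction end (rank-zero p bs j rank≡0)))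
    (Σ-zero (items (live p)))
  Σ-tuples-empty (r ∷ pre) p post Ψ rank≡0 = Σ-vanish (items r) (λ a → Σ-tuples-empty pre p post (λ t → Ψ (a ∷ t)) rank≡0)

  stateEntry-empty : ∀ p j → rank p ≡ 0 → stateEntry (live p) j ≈ 0#
  stateEntry-empty p j rank≡0 = trans
    (Σ-cong-∈ (pathsTo p (target j)) {g = λ _ → 0#} (λ {bs} bs∈ → contradiction (∈-pathsTo⁻ p (target j) bs∈) (rank-zero p bs j rank≡0)))
    (Σ-zero (pathsTo p (target j)))

  start∈item : ∀ p {it} → it ∈ items (live p) → p ∈ proj₁ it
  start∈item p it∈ with ∈-items-live p it∈
  ... | j , bs , _ , ≡.refl = vertices-start p bs

  start∈items : ∀ {p qs as} → live p ∈ qs → Pointwise _∈_ as (map items qs) → Any (λ it → p ∈ proj₁ it) as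
  start∈items {p} (here ≡.refl) (a∈ ∷ as∈) = here (start∈item p a∈)
  start∈items (there p∈) (a∈ ∷ as∈) = there (start∈items p∈ as∈)

  allDisjoint-repeated : ∀ {p qs as} → Repeated (live p) qs → Pointwise _∈_ as (map items qs) → allDisjoint as ≡ false
  allDisjoint-repeated {p} (here p∈) (_∷_ {x = a} {xs = as} a∈ as∈) =
    ≡.cong (_∧ allDisjoint as) (all-disjoint-common p a as (start∈item p a∈) (start∈items p∈ as∈))
  allDisjoint-repeated (there rep) (_∷_ {x = a} {xs = as} a∈ as∈) with all (disjointItems a) as
  ... | true = allDisjoint-repeated rep as∈
  ... | false = ≡.refl

  stateRank : State → ℕ
  stateRank (live p) = rank p
  stateRank (done x) = 0

  data Selected : List State → Set where
    allDone : ∀ xs → Selected (map done xs)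
    highest : ∀ pre p post → All (λ q → stateRank q ≤ rank p) (pre ++ live p ∷ post) → Selected (pre ++ live p ∷ post)

  select : ∀ qs → Selected qs
  select [] = allDone []
  select (q ∷ qs) with select qs
  select (done x ∷ .(map done xs)) | allDone xs = allDone (x ∷ xs)
  select (live p ∷ .(map done xs)) | allDone xs = highest [] p (map done xs) (ℕ.≤-refl ∷ low xs)
    where
    low : ∀ xs → All (λ q → stateRank q ≤ rank p) (map done xs)
    low [] = []
    low (x ∷ xs) = z≤n ∷ low xs
  select (q ∷ .(pre ++ live p ∷ post)) | highest pre p post low with stateRank q ℕ.≤? rank p
  ... | yes le = highest (q ∷ pre) p post (le ∷ low)
  select (done x ∷ .(pre ++ live p ∷ post)) | highest pre p post low | no nle = contradiction z≤n nle
  select (live p′ ∷ .(pre ++ live p ∷ post)) | highest pre p post low | no nle =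
    highest [] p′ (pre ++ live p ∷ post) (ℕ.≤-refl ∷ All.map (λ le → ℕ.≤-trans le (ℕ.<⇒≤ (ℕ.≰⇒> nle))) low)

  -- The extra 1 ensures that total cost zero leaves no live state, not even one of rank 0.
  cost : State → ℕ
  cost (live p) = suc (rank p)
  cost (done x) = 0

  totalCost : List State → ℕ
  totalCost qs = sum (map cost qs)

  totalCost-middle : ∀ pre {q r} post → cost q < cost r → totalCost (pre ++ q ∷ post) < totalCost (pre ++ r ∷ post)
  totalCost-middle [] post lt = ℕ.+-monoˡ-< (totalCost post) lt
  totalCost-middle (s ∷ pre) post lt = ℕ.+-monoʳ-< (cost s) (totalCost-middle pre post lt)

  ∈-nexts-cost : ∀ p {r q} → rank p ≡ suc r → q ∈ nexts p → cost q < cost (live p)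
  ∈-nexts-cost p {r} rank≡ q∈ with ∈-++⁻ (stops p) q∈
  ... | inj₂ (here ≡.refl) = s≤s (≡.subst₂ _<_ (≡.sym (≡.trans (rank-step p false) (≡.cong ℕ.pred rank≡))) (≡.sym rank≡) ℕ.≤-refl)
  ... | inj₂ (there (here ≡.refl)) = s≤s (≡.subst₂ _<_ (≡.sym (≡.trans (rank-step p true) (≡.cong ℕ.pred rank≡))) (≡.sym rank≡) ℕ.≤-refl)
  ... | inj₁ q∈stops with Any.satisfied (∈-concatMap⁻ (λ j → if p ≟P target j then done (proj₁ p) ∷ [] else []) {xs = allFin n} q∈stops)
  ...   | j , q∈′ with p ≟P target j | q∈′
  ...     | true | here ≡.refl = s≤s z≤n
  ...     | false | ()

  -- A path starting no lower than p, and not at p itself, never visits p: paths only go up.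
  avoids : ∀ p {r} → rank p ≡ suc r → ∀ q → stateRank q ≤ rank p → live p ≢ q → ∀ {it} → it ∈ items q → p ∉ proj₁ it
  avoids p rank≡ (done x) le p≢q (here ≡.refl) ()
  avoids p {r} rank≡ (live p′) le p≢q it∈ p∈ with ∈-items-live p′ it∈
  ... | j , bs , _ , ≡.refl = ℕ.<-irrefl ≡.refl (ℕ.≤-trans (≡.subst (_≤ ℕ.pred (rank p′)) rank≡ (rank-tail p′ bs p∈ (λ p≡ → p≢q (≡.cong live p≡))))
    (≡.subst (λ m → ℕ.pred (rank p′) ≤ ℕ.pred m) rank≡ (ℕ.pred-mono-≤ le)))

  avoids-All : ∀ p {r} → rank p ≡ suc r → ∀ {qs} → All (λ q → stateRank q ≤ rank p) qs → live p ∉ qs →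
    ∀ {as} → Pointwise _∈_ as (map items qs) → All (λ it → p ∉ proj₁ it) as
  avoids-All p rank≡ {[]} [] p∉ [] = []
  avoids-All p rank≡ {q ∷ qs} (le ∷ les) p∉ (a∈ ∷ as∈) =
    avoids p rank≡ q le (λ p≡ → p∉ (here p≡)) a∈ ∷ avoids-All p rank≡ les (λ p∈ → p∉ (there p∈)) as∈

  Σ-tuples-done : ∀ xs Ψ → Σ-tuples (map items (map done xs)) Ψ ≈ Ψ (map ([] ,_) xs)
  Σ-tuples-done [] Ψ = refl
  Σ-tuples-done (x ∷ xs) Ψ = trans (+-identityʳ _) (Σ-tuples-done xs (λ t → Ψ (([] , x) ∷ t)))

  map-proj₂-[] : ∀ xs → map proj₂ (map {B = Item} ([] ,_) xs) ≡ xs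
  map-proj₂-[] [] = ≡.refl
  map-proj₂-[] (x ∷ xs) = ≡.cong (x ∷_) (map-proj₂-[] xs)

  Claim : List State → Set _
  Claim qs = Σ-tuples (map items qs) signedDisjoint ≈ det stateEntry qs (allFin n)

  claim-done : ∀ xs → Claim (map done xs)
  claim-done xs = begin
    Σ-tuples (map items (map done xs)) signedDisjoint ≈⟨ Σ-tuples-done xs signedDisjoint ⟩
    signedDisjoint (map ([] ,_) xs)
      ≈⟨ reflexive (≡.cong₂ (λ b ys → [ b ]? (det indicator ys (map abscissa (allFin n)))) (allDisjoint-[] xs) (map-proj₂-[] xs)) ⟩
    det indicator xs (map abscissa (allFin n)) ≈⟨ det-map-cols indicator abscissa xs (allFin n) ⟩
    det (λ x j → indicator x (abscissa j)) xs (allFin n) ≈⟨ det-map-rows stateEntry done xs (allFin n) ⟨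
    det stateEntry (map done xs) (allFin n) ∎

  -- Both sides obey the same recursion in the first step of the path at p. As p has maximal rank,
  -- another path can visit p only by being live there now; otherwise p may be deleted before the
  -- expansion continues.
  claim-step : ∀ pre p post → All (λ q → stateRank q ≤ rank p) (pre ++ live p ∷ post) →
    (∀ q → cost q < cost (live p) → Claim (pre ++ q ∷ post)) → Claim (pre ++ live p ∷ post)
  claim-step pre p post low IH with rank p in rank≡
  -- No target can be reached: the sum over families is empty, and the row of p is an empty sum.
  ... | zero = trans (Σ-tuples-empty pre p post signedDisjoint rank≡)
    (sym (det-row-Σ stateEntry pre [] post (λ j → stateEntry-empty p j rank≡) (allFin n)))
  ... | suc r with any? (live? p) (pre ++ post)
  ...   | yes p∈ = begin
    Σ-tuples (map items (pre ++ live p ∷ post)) signedDisjoint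
      ≈⟨ Σ-tuples-cong-∈ (map items (pre ++ live p ∷ post)) (λ {t} t∈ →
          reflexive (≡.cong (λ b → [ b ]? (det indicator (map proj₂ t) (map abscissa (allFin n)))) (allDisjoint-repeated rep t∈))) ⟩
    Σ-tuples (map items (pre ++ live p ∷ post)) (λ _ → 0#) ≈⟨ Σ-tuples-zero (map items (pre ++ live p ∷ post)) ⟩
    0# ≈⟨ det-repeated stateEntry rep (allFin n) ⟨
    det stateEntry (pre ++ live p ∷ post) (allFin n) ∎
    where rep = Repeated-middle pre p∈
  ...   | no p∉ = begin
    Σ-tuples (map items (pre ++ live p ∷ post)) signedDisjoint ≈⟨ Σ-tuples-expand pre p post signedDisjoint drop ⟩
    Σ[ nexts p ] (λ q → Σ-tuples (map items (pre ++ q ∷ post)) signedDisjoint)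
      ≈⟨ Σ-cong-∈ (nexts p) (λ {q} q∈ → IH q (≡.subst (λ m → cost q < suc m) rank≡ (∈-nexts-cost p rank≡ q∈))) ⟩
    Σ[ nexts p ] (λ q → det stateEntry (pre ++ q ∷ post) (allFin n))
      ≈⟨ det-row-Σ stateEntry pre (nexts p) post (stateEntry-nexts p) (allFin n) ⟨
    det stateEntry (pre ++ live p ∷ post) (allFin n) ∎
    where
    low′ = All.map (λ {q} → ≡.subst (stateRank q ≤_) (≡.sym rank≡)) low
    drop : ∀ {as bs} it → Pointwise _∈_ as (map items pre) → Pointwise _∈_ bs (map items post) →
      signedDisjoint (as ++ prepend p it ∷ bs) ≈ signedDisjoint (as ++ it ∷ bs)
    drop {as} {bs} (vs , x) as∈ bs∈ = reflexive (≡.cong₂ (λ b ys → [ b ]? (det indicator ys (map abscissa (allFin n))))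
      (allDisjoint-drop p vs x as bs
        (avoids-All p rank≡ (All-++⁻ˡ pre low′) (λ p∈ → p∉ (∈-++⁺ˡ p∈)) as∈)
        (avoids-All p rank≡ (All.tail (All-++⁻ʳ pre low′)) (λ p∈ → p∉ (∈-++⁺ʳ pre p∈)) bs∈))
      (≡.trans (map-++ proj₂ as ((p ∷ vs , x) ∷ bs)) (≡.sym (map-++ proj₂ as ((vs , x) ∷ bs)))))

  -- Total cost bounds the recursion, since replacing the selected state by any of its successors
  -- lowers it.
  states-determinant : ∀ qs → Claim qs
  states-determinant qs = bounded (totalCost qs) qs ℕ.≤-refl
    where
    bounded : ∀ N qs → totalCost qs ≤ N → Claim qs
    bounded N qs le with select qs
    ... | allDone xs = claim-done xs
    bounded zero .(pre ++ live p ∷ post) le | highest pre p post low =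
      -- Any state of cost 0 would do in place of `done (+ 0)`; it only shows that the total cost is
      -- positive.
      contradiction (ℕ.<-≤-trans (totalCost-middle pre {done (+ 0)} {live p} post (s≤s z≤n)) le) (λ ())
    bounded (suc N) .(pre ++ live p ∷ post) le | highest pre p post low =
      claim-step pre p post low (λ q lt → bounded N (pre ++ q ∷ post)
        (ℕ.≤-pred (ℕ.≤-trans (totalCost-middle pre post lt) le)))

-- Vertex-disjoint families

<ᵇ-suc : ∀ m n → (suc m <ᵇ suc n) ≡ (m <ᵇ n)
<ᵇ-suc m n = ≡.trans (isYes≗does (suc m ℕ.<? suc n)) (≡.sym (isYes≗does (m ℕ.<? n)))

any-true : (f : A → Bool) (xs : List A) → any f xs ≡ true → ∃[ x ] f x ≡ true
any-true f (x ∷ xs) eq with f x in fx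
... | true = x , fx
... | false = any-true f xs eq

any-intro : (f : A → Bool) {x : A} {xs : List A} → x ∈ xs → f x ≡ true → any f xs ≡ true
any-intro f {xs = x ∷ xs} (here ≡.refl) fx = ≡.cong (_∨ any f xs) fx
any-intro f {xs = y ∷ xs} (there x∈) fx with f y
... | true = ≡.refl
... | false = any-intro f x∈ fx

sumF-cong : ∀ n {f g : Fin n → ℕ} → (∀ i → f i ≡ g i) → sumF n f ≡ sumF n g
sumF-cong zero eq = ≡.refl
sumF-cong (suc n) {f} {g} eq = ≡.trans (sumF-suc n f)
  (≡.trans (≡.cong₂ ℕ._+_ (eq zero) (sumF-cong n (eq ∘ suc))) (≡.sym (sumF-suc n g)))

allF-tabulate : ∀ n (f : Fin n → A) (P : A → Bool) → allF n (P ∘ f) ≡ all P (tabulate f)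
allF-tabulate n f P = ≡.cong (foldr _∧_ true) (≡.trans (map-tabulate id (P ∘ f)) (≡.sym (map-tabulate f P)))

allDisjoint-tabulate : ∀ n (f : Fin n → Item) →
  allF n (λ p → allF n (λ q → if toℕ p <ᵇ toℕ q then disjointItems (f p) (f q) else true)) ≡ allDisjoint (tabulate f)
allDisjoint-tabulate zero f = ≡.refl
allDisjoint-tabulate (suc n) f = ≡.trans (allF-suc n (λ p → allF (suc n) (ok p))) (≡.cong₂ _∧_
  (≡.trans (allF-suc n (ok zero)) (allF-tabulate n (f ∘ suc) (disjointItems (f zero))))
  (≡.trans (allF-cong n (λ p → ≡.trans (allF-suc n (ok (suc p))) (allF-cong n (λ q →
      ≡.cong (λ b → if b then disjointItems (f (suc p)) (f (suc q)) else true) (<ᵇ-suc (toℕ p) (toℕ q))))))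
    (allDisjoint-tabulate n (f ∘ suc))))
  where
  ok : Fin (suc n) → Fin (suc n) → Bool
  ok p q = if toℕ p <ᵇ toℕ q then disjointItems (f p) (f q) else true

inversions-tabulate : ∀ n (f : Fin n → ℤ) →
  sumF n (λ p → sumF n (λ q → if (toℕ p <ᵇ toℕ q) ∧ ⌊ f q ℤ.<? f p ⌋ then 1 else 0)) ≡ inversions (tabulate f)
inversions-tabulate zero f = ≡.refl
inversions-tabulate (suc n) f = ≡.trans (sumF-suc n (λ p → sumF (suc n) (inverted p))) (≡.cong₂ ℕ._+_
  (≡.trans (sumF-suc n (inverted zero)) (≡.cong sum (≡.trans (map-tabulate id (below ∘ f ∘ suc)) (≡.sym (map-tabulate (f ∘ suc) below)))))
  (≡.trans (sumF-cong n (λ p → ≡.trans (sumF-suc n (inverted (suc p))) (sumF-cong n (λ q →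
      ≡.cong (λ b → if b ∧ ⌊ f (suc q) ℤ.<? f (suc p) ⌋ then 1 else 0) (<ᵇ-suc (toℕ p) (toℕ q))))))
    (inversions-tabulate n (f ∘ suc))))
  where
  inverted : Fin (suc n) → Fin (suc n) → ℕ
  inverted p q = if (toℕ p <ᵇ toℕ q) ∧ ⌊ f q ℤ.<? f p ⌋ then 1 else 0
  below : ℤ → ℕ
  below y = if ⌊ y ℤ.<? f zero ⌋ then 1 else 0

Positive : ℤ → Set
Positive i = ∃[ m ] i ≡ + suc m

coordinateSum : Point → ℤ
coordinateSum (x , y) = x ℤ.+ y

coordinateSum-endpoint : ∀ p bs → Positive (coordinateSum p) → Positive (coordinateSum (endpoint p bs))
coordinateSum-endpoint p [] pos = pos
coordinateSum-endpoint (x , y) (false ∷ bs) (m , eq) = coordinateSum-endpoint _ bs (suc m ,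
  ≡.trans (solve 2 (λ x y → x :+ (y :+ con (+ 1)) := con (+ 1) :+ (x :+ y)) ≡.refl x y) (≡.cong (λ i → + 1 ℤ.+ i) eq))
  where open +-*-Solver
coordinateSum-endpoint (x , y) (true ∷ bs) (m , eq) = coordinateSum-endpoint _ bs (suc (suc m) ,
  ≡.trans (solve 2 (λ x y → (x :+ con (+ 1)) :+ (y :+ con (+ 1)) := con (+ 2) :+ (x :+ y)) ≡.refl x y) (≡.cong (λ i → + 2 ℤ.+ i) eq))
  where open +-*-Solver

coordinateSum-source : ∀ k → Positive (coordinateSum (source (suc k)))
coordinateSum-source k = a ∸ b , (begin
  + suc a ℤ.+ ℤ.- + b ≡⟨ ≡.cong (λ m → + suc m ℤ.+ ℤ.- + b) (≡.sym (ℕ.m∸n+n≡m (ℕ.⌊n/2⌋-mono (ℕ.n≤1+n k)))) ⟩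
  + suc ((a ∸ b) ℕ.+ b) ℤ.+ ℤ.- + b ≡⟨ solve 2 (λ x y → (con (+ 1) :+ (x :+ y)) :- y := con (+ 1) :+ x) ≡.refl (+ (a ∸ b)) (+ b) ⟩
  + suc (a ∸ b) ∎)
  where
  open ≡.≡-Reasoning
  open +-*-Solver
  a = ⌊ suc k /2⌋
  b = ⌊ k /2⌋

half-double : ∀ m → ⌊ m ℕ.* 2 /2⌋ ≡ m
half-double zero = ≡.refl
half-double (suc m) = ≡.cong suc (half-double m)

module VertexDisjoint {a ℓ} (R : CommutativeRing a ℓ) (n : ℕ) (c : Fin n → ℕ) where
  open CommutativeRing R hiding (zero)
  open InRing R using (sign)
  open Sums R
  open Determinants R
  open Paths R
  open Elementary R using (sourceSinkEntry)
  open PermutationSign R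
  open LGV R n c
  open SetoidReasoning setoid

  -- A jump gets no vertices and is thereby disjoint from everything, as `disjointPair` prescribes.
  toItem : Fin n → PathChoice → Item
  toItem k (along bs) = item (source (idx k)) bs
  toItem k jump = [] , + ⌊ idx k /2⌋

  sinkX-toItem : ∀ k x → proj₁ (sinkOf d (idx k) x) ≡ proj₂ (toItem k x)
  sinkX-toItem k (along bs) = ≡.refl
  sinkX-toItem k jump = ≡.refl

  disjointPair-toItem : ∀ k l x y → disjointPair (idx k) (idx l) x y ≡ disjointItems (toItem k x) (toItem l y)
  disjointPair-toItem k l (along bs) (along cs) = ≡.refl
  disjointPair-toItem k l (along bs) jump = ≡.sym (disjointPts-[] (vertices (source (idx k)) bs))
  disjointPair-toItem k l jump y = ≡.refl

  familyItems : Family d → List Item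
  familyItems G = tabulate (λ k → toItem k (G k))

  pairwiseDisjoint-items : ∀ G → pairwiseDisjoint d G ≡ allDisjoint (familyItems G)
  pairwiseDisjoint-items G = ≡.trans
    (allF-cong n (λ p → allF-cong n (λ q → ≡.cong (λ b → if toℕ p <ᵇ toℕ q then b else true) (disjointPair-toItem p q (G p) (G q)))))
    (allDisjoint-tabulate n (λ k → toItem k (G k)))

  inv-items : ∀ G → inv d G ≡ inversions (map proj₂ (familyItems G))
  inv-items G = ≡.trans (inversions-tabulate n (sinkX d G))
    (≡.cong inversions (≡.trans (tabulate-cong (λ k → sinkX-toItem k (G k))) (≡.sym (map-tabulate (λ k → toItem k (G k)) proj₂))))

  rowStates : Fin n → List State
  rowStates k = live (source (idx k)) ∷ (if jumpOK d c (idx k) then done (+ ⌊ idx k /2⌋) ∷ [] else [])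

  rowItems : Fin n → List Item
  rowItems k = concatMap items (rowStates k)

  choices-items : ∀ k → map (toItem k) (choices d c k) ≡ rowItems k
  choices-items k = ≡.trans (map-++ (toItem k) (map along paths) _) (≡.cong₂ _++_
    (≡.trans (≡.sym (map-∘ paths)) (map-concatMap (item s) (λ j → pathsTo s (target j)) (allFin n)))
    (jumps (jumpOK d c (idx k))))
    where
    s = source (idx k)
    paths = concatMap (λ j → pathsTo s (target j)) (allFin n)
    jumps : ∀ b → map (toItem k) (if b then jump ∷ [] else []) ≡ concatMap items (if b then done (+ ⌊ idx k /2⌋) ∷ [] else [])
    jumps true = ≡.refl
    jumps false = ≡.refl

  Valid : Fin n → Item → Set
  Valid k (vs , x) = ∃[ j ] x ≡ abscissa j × ((target j ∈ vs × c j ≢ d) ⊎ (idx j ℕ.* 2 ≡ idx k × c j ≡ d))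

  endpoint∈vertices : ∀ p bs → endpoint p bs ∈ vertices p bs
  endpoint∈vertices p [] = here ≡.refl
  endpoint∈vertices p (b ∷ bs) = there (endpoint∈vertices (step p b) bs)

  target-sum : ∀ j → c j ≡ d → coordinateSum (target j) ≡ + 0
  target-sum j cj≡d = ≡.trans (≡.cong (λ m → + idx j ℤ.+ ((+ d ℤ.- + idx j) ℤ.- + m)) cj≡d)
    (solve 2 (λ i d → i :+ ((d :- i) :- d) := con (+ 0)) ≡.refl (+ idx j) (+ d))
    where open +-*-Solver

  -- E-paths from a source stay in the half-plane x + y ≥ 1, while sink(i, d) lies on x + y = 0.
  unreachable : ∀ (k : Fin n) bs j → endpoint (source (idx k)) bs ≡ target j → c j ≢ d
  unreachable k bs j end cj≡d with coordinateSum-endpoint (source (idx k)) bs (coordinateSum-source (toℕ k))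
  ... | m , eq with ≡.trans (≡.sym eq) (≡.trans (≡.cong coordinateSum end) (target-sum j cj≡d))
  ...   | ()

  jumpOK⁻ : ∀ l → jumpOK d c l ≡ true → ∃ λ (j : Fin n) → idx j ℕ.* 2 ≡ l × c j ≡ d
  jumpOK⁻ l ok with any-true (λ j → (idx j ℕ.* 2 == l) ∧ (c j == d)) (allFin n) ok
  ... | j , eq = j , ==-sound _ _ (∧-conicalˡ _ (c j == d) eq) , ==-sound _ _ (∧-conicalʳ (idx j ℕ.* 2 == l) _ eq)

  half-jump : ∀ (j : Fin n) {l} → idx j ℕ.* 2 ≡ l → ⌊ l /2⌋ ≡ idx j
  half-jump j ≡.refl = half-double (idx j)

  valid-row : ∀ k {it} → it ∈ rowItems k → Valid k it
  valid-row k it∈ with ∈-++⁻ (items (live (source (idx k)))) it∈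
  ... | inj₁ it∈live with ∈-items-live (source (idx k)) it∈live
  ...   | j , bs , end , ≡.refl = j , ≡.cong proj₁ end ,
            inj₁ (≡.subst (_∈ vertices (source (idx k)) bs) end (endpoint∈vertices (source (idx k)) bs) , unreachable k bs j end)
  valid-row k it∈ | inj₂ it∈jump with jumpOK d c (idx k) in ok | it∈jump
  ... | true | here ≡.refl with jumpOK⁻ (idx k) ok
  ...   | j , 2j≡k , cj≡d = j , ≡.cong +_ (half-jump j 2j≡k) , inj₂ (2j≡k , cj≡d)

  -- Suppose both items end at column i. Two paths would share the target as a vertex, a path and a
  -- jump disagree on whether c(i) = d, and two jumps would both start at index 2i.
  valid-distinct : ∀ {k l a b} → k ≢ l → Valid k a → Valid l b → disjointItems a b ≡ true → proj₂ a ≢ proj₂ b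
  valid-distinct {k} {l} {a} {b} k≢l (i , xi , vi) (j , xj , vj) dis eq with abscissa-injective (≡.trans (≡.sym xi) (≡.trans eq xj))
  ... | ≡.refl with vi | vj
  ...   | inj₁ (i∈a , _) | inj₁ (i∈b , _) = contradiction (≡.trans (≡.sym dis) (disjointPts-common (target i) (proj₁ a) (proj₁ b) i∈a i∈b)) (λ ())
  ...   | inj₁ (_ , c≢d) | inj₂ (_ , c≡d) = c≢d c≡d
  ...   | inj₂ (_ , c≡d) | inj₁ (_ , c≢d) = c≢d c≡d
  ...   | inj₂ (2i≡k , _) | inj₂ (2i≡l , _) = k≢l (Fin.toℕ-injective (ℕ.suc-injective (≡.trans (≡.sym 2i≡k) 2i≡l)))

  distinct-head : ∀ k {a} ls {as} → All (k ≢_) ls → Valid k a → Pointwise _∈_ as (map rowItems ls) →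
    all (disjointItems a) as ≡ true → All (proj₂ a ≢_) (map proj₂ as)
  distinct-head k [] [] va [] dis = []
  distinct-head k (l ∷ ls) (k≢l ∷ k≢ls) va (b∈ ∷ bs∈) dis =
    valid-distinct k≢l va (valid-row l b∈) (∧-conicalˡ _ _ dis) ∷ distinct-head k ls k≢ls va bs∈ (∧-conicalʳ _ _ dis)

  distinct-sinks : ∀ ks {as} → AllPairs _≢_ ks → Pointwise _∈_ as (map rowItems ks) →
    allDisjoint as ≡ true → AllPairs _≢_ (map proj₂ as)
  distinct-sinks [] [] [] dis = []
  distinct-sinks (k ∷ ks) (k≢ ∷ ks≢) (a∈ ∷ as∈) dis =
    distinct-head k ks k≢ (valid-row k a∈) as∈ (∧-conicalˡ _ _ dis) ∷ distinct-sinks ks ks≢ as∈ (∧-conicalʳ _ _ dis)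

  abscissae : List ℤ
  abscissae = map abscissa (allFin n)

  sinks⊆abscissae : ∀ ks {as} → Pointwise _∈_ as (map rowItems ks) → All (_∈ abscissae) (map proj₂ as)
  sinks⊆abscissae [] [] = []
  sinks⊆abscissae (k ∷ ks) (a∈ ∷ as∈) with valid-row k a∈
  ... | j , eq , _ = ≡.subst (_∈ abscissae) (≡.sym eq) (∈-map⁺ abscissa (∈-allFin j)) ∷ sinks⊆abscissae ks as∈

  abscissae-sorted : AllPairs ℤ._<_ abscissae
  abscissae-sorted = ≡.subst (AllPairs ℤ._<_) (≡.sym (map-tabulate id abscissa)) (tabulate⁺-< (λ i<j → ℤ.+<+ (s≤s i<j)))

  signed : List Item → Carrier
  signed t = [ allDisjoint t ]? (sign (inversions (map proj₂ t)))

  -- Disjoint families that start from the sources have n distinct sinks, so their abscissae permute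
  -- 1, ..., n and the determinant of indicators is the inversion sign. Intersecting families count
  -- zero on both sides.
  signed-disjoint : ∀ {t} → Pointwise _∈_ t (map rowItems (allFin n)) → signed t ≈ signedDisjoint t
  signed-disjoint {t} t∈ with allDisjoint t in dis
  ... | false = refl
  ... | true = sym (det-permutation (map proj₂ t) abscissae abscissae-sorted (unique-⊆⇒↭
    (distinct-sinks (allFin n) (tabulate⁺ id) t∈ dis) (sinks⊆abscissae (allFin n) t∈)
    (≡.trans (length-map proj₂ t) (≡.trans (Pointwise-length t∈)
      (≡.trans (length-map rowItems (allFin n)) (≡.sym (length-map abscissa (allFin n))))))))

  -- First each row decides between path and jump, then the paths are chosen; `states-determinant`
  -- then applies to every fixed pattern of jumps.
  Σ-tuples-concatMap : (g : A → List B) (xss : List (List A)) (Ψ : List B → Carrier) →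
    Σ-tuples (map (concatMap g) xss) Ψ ≈ Σ-tuples xss (λ t → Σ-tuples (map g t) Ψ)
  Σ-tuples-concatMap g [] Ψ = refl
  Σ-tuples-concatMap g (xs ∷ xss) Ψ = begin
    _ ≈⟨ Σ-concatMap g xs _ ⟩
    _ ≈⟨ Σ-cong xs (λ x → Σ-cong (g x) (λ y → Σ-tuples-concatMap g xss _)) ⟩
    _ ≈⟨ Σ-cong xs (λ x → sym (Σ-tuples-swap xss (g x) (λ t y → Σ-tuples (map g t) (λ u → Ψ (y ∷ u))))) ⟩
    _ ∎

  -- A jump from source index 2i ends in column i only, so it adds 1 to a single entry of its row.
  rowStates-entry : ∀ k j → Σ[ rowStates k ] (λ q → stateEntry q j) ≈ sourceSinkEntry d (toℕ k) (toℕ j) (c j)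
  rowStates-entry k j = +-congˡ (trans (Σ-if (jumpOK d c (idx k)) (done (+ ⌊ idx k /2⌋)) (λ q → stateEntry q j)) jump-entry)
    where
    jump-entry : [ jumpOK d c (idx k) ]? (indicator (+ ⌊ idx k /2⌋) (abscissa j)) ≈ [ (idx j ℕ.* 2 == idx k) ∧ (c j == d) ]? 1#
    jump-entry with jumpOK d c (idx k) in ok
    ... | false = reflexive (≡.cong (λ b → [ b ]? 1#) (bool-ext {false} {(idx j ℕ.* 2 == idx k) ∧ (c j == d)} (λ ())
          (λ eq → ≡.trans (≡.sym ok) (any-intro (λ j → (idx j ℕ.* 2 == idx k) ∧ (c j == d)) (∈-allFin j) eq))))
    ... | true = reflexive (≡.cong (λ b → [ b ]? 1#) (bool-ext to from))
      where
      to : ((+ ⌊ idx k /2⌋) ≟ℤ abscissa j) ≡ true → ((idx j ℕ.* 2 == idx k) ∧ (c j == d)) ≡ true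
      to eq with jumpOK⁻ (idx k) ok
      ... | i , 2i≡k , ci≡d with abscissa-injective {i} {j} (≡.trans (≡.cong +_ (≡.sym (half-jump i 2i≡k))) (≟ℤ-sound _ _ eq))
      ...   | ≡.refl = ≡.cong₂ _∧_ (≡.trans (≡.cong (_== idx k) 2i≡k) (==-refl (idx k))) (≡.trans (≡.cong (_== d) ci≡d) (==-refl d))
      from : ((idx j ℕ.* 2 == idx k) ∧ (c j == d)) ≡ true → ((+ ⌊ idx k /2⌋) ≟ℤ abscissa j) ≡ true
      from eq = ≡.trans (≡.cong (λ m → + m ≟ℤ abscissa j) (half-jump j (==-sound _ _ (∧-conicalˡ _ (c j == d) eq)))) (≟ℤ-refl (abscissa j))

  VD-determinant : Σ[ VD d c ] (λ G → sign (inv d G)) ≈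
    det (λ k j → sourceSinkEntry d (toℕ k) (toℕ j) (c j)) (allFin n) (allFin n)
  VD-determinant = begin
    Σ[ VD d c ] (λ G → sign (inv d G)) ≈⟨ Σ-filterᵇ (pairwiseDisjoint d) (depFns n (choices d c)) (λ G → sign (inv d G)) ⟩
    Σ[ depFns n (choices d c) ] (λ G → [ pairwiseDisjoint d G ]? (sign (inv d G)))
      ≈⟨ Σ-cong (depFns n (choices d c)) (λ G → reflexive (≡.cong₂ (λ b m → [ b ]? (sign m)) (pairwiseDisjoint-items G) (inv-items G))) ⟩
    Σ[ depFns n (choices d c) ] (signed ∘ familyItems) ≈⟨ Σ-depFns-tuples n (choices d c) toItem signed ⟩
    Σ-tuples (tabulate (λ k → map (toItem k) (choices d c k))) signed
      ≈⟨ reflexive (≡.cong (λ rows → Σ-tuples rows signed) (≡.trans (tabulate-cong choices-items) (≡.sym (map-tabulate id rowItems)))) ⟩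
    Σ-tuples (map rowItems (allFin n)) signed ≈⟨ Σ-tuples-cong-∈ (map rowItems (allFin n)) signed-disjoint ⟩
    Σ-tuples (map rowItems (allFin n)) signedDisjoint
      ≈⟨ reflexive (≡.cong (λ rows → Σ-tuples rows signedDisjoint) (map-∘ (allFin n))) ⟩
    Σ-tuples (map (concatMap items) (map rowStates (allFin n))) signedDisjoint
      ≈⟨ Σ-tuples-concatMap items (map rowStates (allFin n)) signedDisjoint ⟩
    Σ-tuples (map rowStates (allFin n)) (λ qs → Σ-tuples (map items qs) signedDisjoint)
      ≈⟨ Σ-tuples-cong (map rowStates (allFin n)) states-determinant ⟩
    Σ-tuples (map rowStates (allFin n)) (λ qs → det stateEntry qs (allFin n))
      ≈⟨ det-rows-Σ stateEntry (map rowStates (allFin n)) (allFin n) ⟩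
    det (λ qs j → Σ[ qs ] (λ q → stateEntry q j)) (map rowStates (allFin n)) (allFin n)
      ≈⟨ det-map-rows (λ qs j → Σ[ qs ] (λ q → stateEntry q j)) rowStates (allFin n) (allFin n) ⟩
    det (λ k j → Σ[ rowStates k ] (λ q → stateEntry q j)) (allFin n) (allFin n)
      ≈⟨ det-cong rowStates-entry (allFin n) (allFin n) ⟩
    det (λ k j → sourceSinkEntry d (toℕ k) (toℕ j) (c j)) (allFin n) (allFin n) ∎

-- Truncated power series

module PowerSeries {a ℓ} (R : CommutativeRing a ℓ) (L : ℕ) where
  open CommutativeRing R hiding (zero)
  open InRing R
  open Sums R
  open Hurwitz R using (Seq; shift)
  open Convolution R
  open Elementary R using (term)
  open RingProperties ring using (-0#≈0#)
  open SetoidReasoning setoid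

  monomial : ℕ → Carrier → Seq
  monomial zero x zero = x
  monomial zero x (suc n) = 0#
  monomial (suc k) x = shift (monomial k x)

  conv-comm : ∀ f g n → conv f g n ≈ conv g f n
  conv-comm f g zero = *-comm _ _
  conv-comm f g (suc n) = begin
    f 0 * g (suc n) + conv (f ∘ suc) g n ≈⟨ +-cong (*-comm _ _) (conv-comm (f ∘ suc) g n) ⟩
    g (suc n) * f 0 + conv g (f ∘ suc) n ≈⟨ +-comm _ _ ⟩
    conv g (f ∘ suc) n + g (suc n) * f 0 ≈⟨ conv-last g f n ⟨
    conv g f (suc n) ∎

  conv-assoc : ∀ f g h n → conv (conv f g) h n ≈ conv f (conv g h) n
  conv-assoc f g h zero = *-assoc _ _ _
  conv-assoc f g h (suc n) = begin
    (f 0 * g 0) * h (suc n) + conv (λ m → f 0 * g (suc m) + conv (f ∘ suc) g m) h n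
      ≈⟨ +-cong (*-assoc _ _ _) (trans (conv-+ˡ (λ m → f 0 * g (suc m)) (conv (f ∘ suc) g) h n)
           (+-cong (conv-*ˡ (f 0) (g ∘ suc) h n) (conv-assoc (f ∘ suc) g h n))) ⟩
    f 0 * (g 0 * h (suc n)) + (f 0 * conv (g ∘ suc) h n + conv (f ∘ suc) (conv g h) n)
      ≈⟨ trans (sym (+-assoc _ _ _)) (+-congʳ (sym (distribˡ _ _ _))) ⟩
    conv f (conv g h) (suc n) ∎

  conv-constant : ∀ x f n → conv (monomial 0 x) f n ≈ x * f n
  conv-constant x f zero = refl
  conv-constant x f (suc n) = trans (+-congˡ (conv-zeroˡ f n (λ _ → refl))) (+-identityʳ _)

  conv-identityˡ : ∀ f n → conv (monomial 0 1#) f n ≈ f n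
  conv-identityˡ f n = trans (conv-constant 1# f n) (*-identityˡ _)

  -- R[τ] / (τ^(L+1)), with an element given by its sequence of coefficients.
  truncatedSeries : CommutativeRing a ℓ
  truncatedSeries = record
    { Carrier = Seq
    ; _≈_ = λ f g → ∀ n → n ≤ L → f n ≈ g n
    ; _+_ = λ f g n → f n + g n
    ; _*_ = conv
    ; -_ = λ f n → - f n
    ; 0# = λ _ → 0#
    ; 1# = monomial 0 1#
    ; isCommutativeRing = record
      { isRing = record
        { +-isAbelianGroup = record
          { isGroup = record
            { isMonoid = record
              { isSemigroup = record
                { isMagma = record
                  { isEquivalence = record { refl = λ _ _ → refl ; sym = λ p n n≤ → sym (p n n≤) ; trans = λ p q n n≤ → trans (p n n≤) (q n n≤) }
                  ; ∙-cong = λ p q n n≤ → +-cong (p n n≤) (q n n≤)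
                  }
                ; assoc = λ f g h _ _ → +-assoc _ _ _
                }
              ; identity = (λ f _ _ → +-identityˡ _) , (λ f _ _ → +-identityʳ _)
              }
            ; inverse = (λ f _ _ → -‿inverseˡ _) , (λ f _ _ → -‿inverseʳ _)
            ; ⁻¹-cong = λ p n n≤ → -‿cong (p n n≤)
            }
          ; comm = λ f g _ _ → +-comm _ _
          }
        ; *-cong = λ p q n n≤ → conv-cong n (λ i≤n → p _ (ℕ.≤-trans i≤n n≤)) (λ i≤n → q _ (ℕ.≤-trans i≤n n≤))
        ; *-assoc = λ f g h n _ → conv-assoc f g h n
        ; *-identity = (λ f n _ → conv-identityˡ f n) , (λ f n _ → trans (conv-comm f (monomial 0 1#) n) (conv-identityˡ f n))
        ; distrib = (λ f g h n _ → conv-+ʳ f g h n) , (λ f g h n _ → conv-+ˡ g h f n)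
        }
      ; *-comm = λ f g n _ → conv-comm f g n
      }
    }

  module S = CommutativeRing truncatedSeries
  module SR = InRing truncatedSeries
  module SΣ = Sums truncatedSeries
  module SE = Elementary truncatedSeries

  monomial-cong : ∀ k {x y} → x ≈ y → ∀ n → monomial k x n ≈ monomial k y n
  monomial-cong zero eq zero = eq
  monomial-cong zero eq (suc n) = refl
  monomial-cong (suc k) eq zero = refl
  monomial-cong (suc k) eq (suc n) = monomial-cong k eq n

  monomial-0 : ∀ k n → monomial k 0# n ≈ 0#
  monomial-0 zero zero = refl
  monomial-0 zero (suc n) = refl
  monomial-0 (suc k) zero = refl
  monomial-0 (suc k) (suc n) = monomial-0 k n

  monomial-+ : ∀ k x y n → monomial k (x + y) n ≈ monomial k x n + monomial k y n
  monomial-+ zero x y zero = refl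
  monomial-+ zero x y (suc n) = sym (+-identityˡ _)
  monomial-+ (suc k) x y zero = sym (+-identityˡ _)
  monomial-+ (suc k) x y (suc n) = monomial-+ k x y n

  monomial-scale : ∀ k x y n → x * monomial k y n ≈ monomial k (x * y) n
  monomial-scale zero x y zero = refl
  monomial-scale zero x y (suc n) = zeroʳ x
  monomial-scale (suc k) x y zero = zeroʳ x
  monomial-scale (suc k) x y (suc n) = monomial-scale k x y n

  monomial-* : ∀ j k x y n → conv (monomial j x) (monomial k y) n ≈ monomial (j ℕ.+ k) (x * y) n
  monomial-* zero k x y n = trans (conv-constant x (monomial k y) n) (monomial-scale k x y n)
  monomial-* (suc j) k x y zero = zeroˡ _
  monomial-* (suc j) k x y (suc n) = trans (+-cong (zeroˡ _) (monomial-* j k x y n)) (+-identityˡ _)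

  monomial-coefficient : ∀ k x n → monomial k x n ≈ [ k == n ]? x
  monomial-coefficient zero x zero = refl
  monomial-coefficient zero x (suc n) = refl
  monomial-coefficient (suc k) x zero = refl
  monomial-coefficient (suc k) x (suc n) = trans (monomial-coefficient k x n)
    (reflexive (≡.cong (λ b → [ b ]? x) (≡.sym (==-suc k n))))

  monomial-below : ∀ {k n} x → n < k → monomial k x n ≈ 0#
  monomial-below {suc k} {zero} x _ = refl
  monomial-below {suc k} {suc n} x (s≤s n<k) = monomial-below x n<k

  Σ-monomial : (xs : List A) (k : ℕ) (f : A → Carrier) → SΣ.Σ[ xs ] (monomial k ∘ f) S.≈ monomial k (Σ[ xs ] f)
  Σ-monomial [] k f n _ = sym (monomial-0 k n)
  Σ-monomial (x ∷ xs) k f n n≤ = trans (+-congˡ (Σ-monomial xs k f n n≤)) (sym (monomial-+ k _ _ n))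

  Σ-coefficient : (xs : List A) (F : A → Seq) (n : ℕ) → SΣ.Σ[ xs ] F n ≈ Σ[ xs ] (λ x → F x n)
  Σ-coefficient [] F n = refl
  Σ-coefficient (x ∷ xs) F n = +-congˡ (Σ-coefficient xs F n)

  prodF-monomial : ∀ n (k : Fin n → ℕ) (x : Fin n → Carrier) →
    SR.prodF n (λ i → monomial (k i) (x i)) S.≈ monomial (sumF n k) (prodF n x)
  prodF-monomial zero k x _ n≤ = refl
  prodF-monomial (suc n) k x m m≤ = begin
    SR.prodF (suc n) (λ i → monomial (k i) (x i)) m ≈⟨ SΣ.prodF-suc n (λ i → monomial (k i) (x i)) m m≤ ⟩
    conv (monomial (k zero) (x zero)) (SR.prodF n (λ i → monomial (k (suc i)) (x (suc i)))) m
      ≈⟨ S.*-congˡ {monomial (k zero) (x zero)} (prodF-monomial n (k ∘ suc) (x ∘ suc)) m m≤ ⟩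
    conv (monomial (k zero) (x zero)) (monomial (sumF n (k ∘ suc)) (prodF n (x ∘ suc))) m ≈⟨ monomial-* (k zero) _ _ _ m ⟩
    monomial (k zero ℕ.+ sumF n (k ∘ suc)) (x zero * prodF n (x ∘ suc)) m
      ≈⟨ reflexive (≡.cong₂ (λ j y → monomial j y m) (≡.sym (sumF-suc n k)) (≡.sym (≡.cong (foldr _*_ 1#) (allFin-map-suc n x)))) ⟩
    monomial (sumF (suc n) k) (prodF (suc n) x) m ∎

  module _ (d : ℕ) (z : Fin d → Carrier) where
    variables : Fin d → Seq
    variables i = monomial 1 (z i)

    optional-monomial : ∀ b i → (if b then variables i else S.1#) ≡ monomial (if b then 1 else 0) (if b then z i else 1#)
    optional-monomial true i = ≡.refl
    optional-monomial false i = ≡.refl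

    term-monomial : ∀ T → SE.term d variables T S.≈ monomial (card d T) (term d z T)
    term-monomial T = S.trans (SΣ.prodF-cong d (λ i → S.reflexive (optional-monomial (T i) i)))
      (prodF-monomial d (λ i → if T i then 1 else 0) (λ i → if T i then z i else 1#))

    -- Every edge brings one factor τ, so the exponent of τ records the number of edges.
    weight-monomial : ∀ g → SR.weight d variables g S.≈ monomial (edgeCount d g) (weight d z g)
    weight-monomial g = S.trans
      (SΣ.prodF-cong d (λ i → S.trans (SΣ.prodF-cong d (λ j → S.reflexive (optional-monomial (g i j) i)))
        (prodF-monomial d (λ j → if g i j then 1 else 0) (λ j → if g i j then z i else 1#))))
      (prodF-monomial d (λ i → sumF d (λ j → if g i j then 1 else 0)) (λ i → prodF d (λ j → if g i j then z i else 1#)))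

    -- Homogeneity: e_r(τz) = τ^r e_r(z).
    elem-monomial : ∀ r → SR.elem d variables r S.≈ monomial r (elem d z r)
    elem-monomial r = S.trans (SE.elem-Σ d variables r) (S.trans
      (SΣ.Σ-cong (allFns bools d) (λ T → S.trans (SΣ.[]?-cong (card d T == r) (term-monomial T)) (graded T)))
      (S.trans (Σ-monomial (allFns bools d) r (λ T → [ card d T == r ]? (term d z T)))
        (λ n _ → monomial-cong r (sym (Elementary.elem-Σ R d z r)) n)))
      where
      graded : ∀ T → SΣ.[ card d T == r ]? (monomial (card d T) (term d z T)) S.≈ monomial r ([ card d T == r ]? (term d z T))
      graded T with card d T == r in eq
      ... | true = S.reflexive (≡.cong (λ k → monomial k (term d z T)) (==-sound (card d T) r eq))
      ... | false = λ n _ → sym (monomial-0 r n)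

  sign-monomial : ∀ m → SR.sign m S.≈ monomial 0 (sign m)
  sign-monomial zero _ n≤ = refl
  sign-monomial (suc m) zero n≤ = -‿cong (sign-monomial m zero n≤)
  sign-monomial (suc m) (suc n) n≤ = trans (-‿cong (sign-monomial m (suc n) n≤)) -0#≈0#

module Vanishing {a ℓ} (R : CommutativeRing a ℓ) where
  open CommutativeRing R hiding (zero)
  open Sums R
  open Convolution R using (Σ-upTo-suc)

  Σ-upTo-extend : ∀ m k (f : ℕ → Carrier) → (∀ {r} → m ≤ r → f r ≈ 0#) → Σ[ upTo (m ℕ.+ k) ] f ≈ Σ[ upTo m ] f
  Σ-upTo-extend zero k f f≈0 = Σ-vanish (upTo k) (λ r → f≈0 z≤n)
  Σ-upTo-extend (suc m) k f f≈0 = trans (Σ-upTo-suc (m ℕ.+ k) f)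
    (trans (+-congˡ (Σ-upTo-extend m k (f ∘ suc) (f≈0 ∘ s≤s))) (sym (Σ-upTo-suc m f)))

  -- Both sums extend by zeros to the range below m + k.
  Σ-upTo-≈ : ∀ m k (f : ℕ → Carrier) → (∀ {r} → m ≤ r → f r ≈ 0#) → (∀ {r} → k ≤ r → f r ≈ 0#) →
    Σ[ upTo m ] f ≈ Σ[ upTo k ] f
  Σ-upTo-≈ m k f f≈0 f≈0′ = trans (sym (Σ-upTo-extend m k f f≈0))
    (trans (reflexive (≡.cong (λ N → Σ[ upTo N ] f) (ℕ.+-comm m k))) (Σ-upTo-extend k m f f≈0′))

tabulate-range : ∀ n i → tabulate {n = n} (λ j → i ℕ.+ toℕ j) ≡ range i n
tabulate-range zero i = ≡.refl
tabulate-range (suc n) i = ≡.cong₂ _∷_ (ℕ.+-identityʳ i)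
  (≡.trans (tabulate-cong (λ j → ℕ.+-suc i (toℕ j))) (tabulate-range n (suc i)))

-- Assembly through the coefficient of τ^l

module Main {a ℓ} (R : CommutativeRing a ℓ) (n l : ℕ) (z : Fin (suc n) → CommutativeRing.Carrier R) where
  open CommutativeRing R hiding (zero)
  open InRing R
  open Sums R
  open PowerSeries R l
  module SD = Determinants truncatedSeries
  module SH = Hurwitz truncatedSeries

  d = suc n
  τz = variables d z

  LHS-coefficient : LHS d l z ≈ SH.pairProduct d τz l
  LHS-coefficient = begin
    LHS d l z ≈⟨ Σ-filterᵇ (λ g → edgeCount d g == l) (DSG d) (weight d z) ⟩
    Σ[ DSG d ] (λ g → [ edgeCount d g == l ]? (weight d z g))
      ≈⟨ Σ-cong (DSG d) (λ g → trans (sym (monomial-coefficient (edgeCount d g) (weight d z g) l)) (sym (weight-monomial d z g l ℕ.≤-refl))) ⟩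
    Σ[ DSG d ] (λ g → SR.weight d τz g l) ≈⟨ Σ-coefficient (DSG d) (SR.weight d τz) l ⟨
    SΣ.Σ[ DSG d ] (SR.weight d τz) l ≈⟨ Digraphs.Σ-DSG truncatedSeries d τz l ℕ.≤-refl ⟩
    SH.pairProduct d τz l ∎
    where open SetoidReasoning setoid

  elemSeries : ℕ → S.Carrier
  elemSeries r = monomial r (elem d z r)

  signedFamilies : (Fin n → ℕ) → Carrier
  signedFamilies c = Σ[ VD d c ] (λ G → sign (inv d G))

  signedFamiliesˢ : (Fin n → ℕ) → S.Carrier
  signedFamiliesˢ c = SΣ.Σ[ VD d c ] (λ G → SR.sign (inv d G))

  signedFamilies-monomial : ∀ c → signedFamiliesˢ c S.≈ monomial 0 (signedFamilies c)
  signedFamilies-monomial c = S.trans (SΣ.Σ-cong (VD d c) (λ G → sign-monomial (inv d G)))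
    (Σ-monomial (VD d c) 0 (λ G → sign (inv d G)))

  summand : (Fin n → ℕ) → S.Carrier
  summand c = SR.prodF n (λ j → elemSeries (c j)) S.* signedFamiliesˢ c

  -- The signed count of families has degree 0 in τ, so the coefficient of τ^l keeps exactly the c
  -- with sum l. The sum over c may then run over all tuples, one independent choice per column.
  summand-coefficient : ∀ c → summand c l ≈ [ sumF n c == l ]? (elemC d z c * signedFamilies c)
  summand-coefficient c = begin
    summand c l ≈⟨ S.*-cong {SR.prodF n (λ j → elemSeries (c j))} (prodF-monomial n c (λ j → elem d z (c j))) (signedFamilies-monomial c) l ℕ.≤-refl ⟩
    (monomial (sumF n c) (elemC d z c) S.* monomial 0 (signedFamilies c)) l ≈⟨ monomial-* (sumF n c) 0 _ _ l ⟩
    monomial (sumF n c ℕ.+ 0) (elemC d z c * signedFamilies c) l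
      ≈⟨ reflexive (≡.cong (λ k → monomial k (elemC d z c * signedFamilies c) l) (ℕ.+-identityʳ (sumF n c))) ⟩
    monomial (sumF n c) (elemC d z c * signedFamilies c) l ≈⟨ monomial-coefficient (sumF n c) _ l ⟩
    [ sumF n c == l ]? (elemC d z c * signedFamilies c) ∎
    where open SetoidReasoning setoid

  RHS-coefficient : RHS d l z ≈ SΣ.Σ[ allFns (upTo (suc l)) n ] summand l
  RHS-coefficient = begin
    RHS d l z ≈⟨ Σ-filterᵇ (λ c → sumF n c == l) (allFns (upTo (suc l)) n) (λ c → elemC d z c * signedFamilies c) ⟩
    _ ≈⟨ Σ-cong (allFns (upTo (suc l)) n) (λ c → sym (summand-coefficient c)) ⟩
    _ ≈⟨ Σ-coefficient (allFns (upTo (suc l)) n) summand l ⟨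
    SΣ.Σ[ allFns (upTo (suc l)) n ] summand l ∎
    where open SetoidReasoning setoid

  entryˢ : Fin n → Fin n × ℕ → S.Carrier
  entryˢ k (j , r) = SE.sourceSinkEntry d (toℕ k) (toℕ j) r

  -- The index j travels with the part c(j), because the matrix entry depends on both.
  column : (Fin n → ℕ) → List (Fin n × ℕ)
  column c = tabulate (λ j → j , c j)

  summand-determinant : ∀ c → summand c S.≈ SD.weights (elemSeries ∘ proj₂) (column c) S.* SD.det entryˢ (allFin n) (column c)
  summand-determinant c = S.*-cong
    (S.reflexive (≡.cong (foldr S._*_ S.1#) (≡.trans (map-tabulate id (elemSeries ∘ c)) (≡.sym (map-tabulate (λ j → j , c j) (elemSeries ∘ proj₂))))))
    (S.trans (VertexDisjoint.VD-determinant truncatedSeries n c)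
      (S.trans (S.sym (SD.det-map-cols entryˢ (λ j → j , c j) (allFin n) (allFin n)))
        (S.reflexive (≡.cong (SD.det entryˢ (allFin n)) (map-tabulate id (λ j → j , c j))))))

  -- Parts of compositions range up to l, whereas the generating function needs r up to d. The two
  -- sums agree, since the terms with r > l vanish by τ^(l+1) = 0 and those with r > d by e_r = 0.
  Σ-entryˢ : ∀ k j → SΣ.Σ[ map (j ,_) (upTo (suc l)) ] (λ x → elemSeries (proj₂ x) S.* entryˢ k x) S.≈ SH.hurwitz d τz (toℕ k) (toℕ j)
  Σ-entryˢ k j = S.trans (S.reflexive (SΣ.Σ-map (j ,_) (upTo (suc l)) _))
    (S.trans (Vanishing.Σ-upTo-≈ truncatedSeries (suc l) (suc d) _
        (λ {r} l<r → zero-product r (λ _ n≤l → monomial-below (elem d z r) (ℕ.≤-trans (s≤s n≤l) l<r)))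
        (λ {r} d<r → zero-product r (S.trans (S.sym (elem-monomial d z r)) (SE.elem-vanish d τz d<r))))
      (S.trans (SΣ.Σ-cong (upTo (suc d)) (λ r → S.*-congʳ (S.sym (elem-monomial d z r))))
        (SE.Σ-elem-entry d τz (toℕ k) (toℕ j))))
    where
    zero-product : ∀ r → elemSeries r S.≈ S.0# → elemSeries r S.* entryˢ k (j , r) S.≈ S.0#
    zero-product r eq = S.trans (S.*-congʳ eq) (S.zeroˡ (entryˢ k (j , r)))

  determinant : SΣ.Σ[ allFns (upTo (suc l)) n ] summand S.≈ SH.pairProduct d τz
  determinant = begin
    SΣ.Σ[ allFns (upTo (suc l)) n ] summand ≈⟨ SΣ.Σ-cong (allFns (upTo (suc l)) n) summand-determinant ⟩
    SΣ.Σ[ allFns (upTo (suc l)) n ] (weightedDet ∘ column)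
      ≈⟨ SΣ.Σ-allFns-tuples n (upTo (suc l)) _,_ weightedDet ⟩
    SΣ.Σ-tuples (tabulate (λ j → map (j ,_) (upTo (suc l)))) weightedDet
      ≈⟨ S.reflexive (≡.cong (λ css → SΣ.Σ-tuples css weightedDet) (≡.sym (map-tabulate id (λ j → map (j ,_) (upTo (suc l)))))) ⟩
    SΣ.Σ-tuples (map (λ j → map (j ,_) (upTo (suc l))) (allFin n)) weightedDet
      ≈⟨ SD.det-columns-Σ (elemSeries ∘ proj₂) entryˢ (allFin n) (map (λ j → map (j ,_) (upTo (suc l))) (allFin n)) ⟩
    SD.det columnEntry (allFin n) (map (λ j → map (j ,_) (upTo (suc l))) (allFin n))
      ≈⟨ SD.det-map-cols columnEntry (λ j → map (j ,_) (upTo (suc l))) (allFin n) (allFin n) ⟩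
    SD.det (λ k j → columnEntry k (map (j ,_) (upTo (suc l)))) (allFin n) (allFin n)
      ≈⟨ SD.det-cong Σ-entryˢ (allFin n) (allFin n) ⟩
    SD.det (λ k j → SH.hurwitz d τz (toℕ k) (toℕ j)) (allFin n) (allFin n)
      ≈⟨ SD.det-map-cols (λ k → SH.hurwitz d τz (toℕ k)) toℕ (allFin n) (allFin n) ⟨
    SD.det (λ k → SH.hurwitz d τz (toℕ k)) (allFin n) (map toℕ (allFin n))
      ≈⟨ SD.det-map-rows (SH.hurwitz d τz) toℕ (allFin n) (map toℕ (allFin n)) ⟨
    SD.det (SH.hurwitz d τz) (map toℕ (allFin n)) (map toℕ (allFin n))
      ≈⟨ S.reflexive (≡.cong (λ ks → SD.det (SH.hurwitz d τz) ks ks) (≡.trans (map-tabulate id toℕ) (tabulate-range n 0))) ⟩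
    SD.det (SH.hurwitz d τz) (range 0 n) (range 0 n) ≈⟨ SH.det-hurwitz n τz ⟩
    SH.pairProduct d τz ∎
    where
    open SetoidReasoning S.setoid
    weightedDet : List (Fin n × ℕ) → S.Carrier
    weightedDet cs = SD.weights (elemSeries ∘ proj₂) cs S.* SD.det entryˢ (allFin n) cs
    columnEntry : Fin n → List (Fin n × ℕ) → S.Carrier
    columnEntry k cs = SΣ.Σ[ cs ] (λ x → elemSeries (proj₂ x) S.* entryˢ k x)

theorem4 : ∀ {a ℓ} (R : CommutativeRing a ℓ) (d l : ℕ) → 2 ≤ d →
    (z : Fin d → CommutativeRing.Carrier R) →
    CommutativeRing._≈_ R (InRing.LHS R d l z) (InRing.RHS R d l z)
theorem4 R (suc n) l _ z = trans LHS-coefficient (trans (sym (determinant l ℕ.≤-refl)) (sym RHS-coefficient))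
  where
  open CommutativeRing R using (sym; trans)
  open Main R n l z
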